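{- Let $p>2$ be a prime, let $\mathbb{K}$ be a cyclic number field of degree $p$ (that is, $\mathbb{K}/\mathbb{Q}$ is Galois with cyclic Galois group of order $p$), with ring of integers $\mathcal{O}_{\mathbb{K}}$, let $\theta$ be a generator of $\mathrm{Gal}(\mathbb{K}/\mathbb{Q})$, and let $\sigma:\mathbb{K}\to\mathbb{R}^p$ be the canonical embedding. Let $\mathcal{M}\subseteq\mathcal{O}_{\mathbb{K}}$ be a $\mathbb{Z}$-submodule such that $\theta(\mathcal{M})\subseteq\mathcal{M}$. Let $\alpha\in\mathcal{M}\setminus\mathbb{Z}$ be such that $\sigma(\alpha)$ is one of the shortest nonzero vectors in the lattice $\Lambda=\sigma(\mathcal{M})$. Then $Tr_{\mathbb{K}}(\alpha)\neq 0$ if and only if $B=\{\sigma(\alpha),\sigma(\theta(\alpha)),\ldots,\sigma(\theta^{p-1}(\alpha))\}$ generates (over $\mathbb{Z}$) a well-rounded sublattice of $\Lambda$ of rank $p$.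
   Context: The field $\mathbb{K}$ is totally real and is regarded as a subfield of $\mathbb{R}$. $Tr_{\mathbb{K}}(\alpha)=\sum_{i=0}^{p-1}\theta^i(\alpha)$ is the trace from $\mathbb{K}$ to $\mathbb{Q}$. The canonical embedding is $\sigma(x)=(x,\theta(x),\theta^2(x),\ldots,\theta^{p-1}(x))$ for $x\in\mathbb{K}$. A lattice in $\mathbb{R}^p$ is the $\mathbb{Z}$-span of a set of $\mathbb{R}$-linearly independent vectors; its rank is the number of these vectors. "Shortest" refers to the Euclidean norm: $\sigma(\alpha)\neq 0$ and $\|\sigma(\alpha)\|\leq\|v\|$ for all nonzero $v\in\Lambda$. A rank-$p$ lattice $L\subset\mathbb{R}^p$ is well-rounded if its set of minimal vectors $S(L)=\{v\in L: \|v\|^2=t_L\}$, where $t_L=\min\{\|v\|^2: 0\neq v\in L\}$, contains $p$ linearly independent vectors (equivalently, spans $\mathbb{R}^p$). -}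

module Defs where

open import Level using (Level; 0ℓ; _⊔_) renaming (suc to lsuc)
open import Algebra.Bundles using (CommutativeRing; Semiring)
import Algebra.Definitions.RawMonoid as RawMonoidOps
import Algebra.Definitions.RawSemiring as RawSemiringOps
open import Algebra.Morphism.Structures using (IsRingHomomorphism; IsRingMonomorphism; IsRingIsomorphism)
open import Data.Nat.Base as ℕ using (ℕ; zero; suc)
import Data.Nat.Properties as ℕ
open import Data.Nat.GeneralisedArithmetic using (fold)
open import Data.Fin.Base using (Fin; toℕ)
open import Data.Integer.Base as ℤ using (ℤ)
import Data.Integer.Properties as ℤ
open import Data.Rational.Base as ℚ using (ℚ; 0ℚ; 1ℚ; ½; _+_; _*_; -_; _-_; ∣_∣; _≤_; _<_; _/_; 1/_)
import Data.Rational.Properties as ℚ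
import Data.Rational.Unnormalised.Base as ℚᵘ
import Data.Rational.Unnormalised.Properties as ℚᵘ
open import Data.Rational.Solver using (module +-*-Solver)
open import Data.Product.Base using (∃; ∃-syntax; Σ-syntax; _×_; _,_; proj₁; proj₂)
open import Data.Sum.Base using (inj₁; inj₂)
open import Data.Vec.Functional using (Vector)
open import Relation.Nullary using (¬_; yes; no; contradiction)
open import Relation.Unary using (Pred; _∈_; _≐_)
open import Relation.Binary.PropositionalEquality

private

  half : ∀ ε → ½ * ε + ½ * ε ≡ ε
  half = solve 1 (λ e → con ½ :* e :+ con ½ :* e := e) refl
    where open +-*-Solver

  *-pos : ∀ {p q} → 0ℚ < p → 0ℚ < q → 0ℚ < p * q
  *-pos {p} {q} 0<p 0<q =
    ℚ.positive⁻¹ (p * q) {{ℚ.pos*pos⇒pos p {{ℚ.positive 0<p}} q {{ℚ.positive 0<q}}}}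

  0<½ : 0ℚ < ½
  0<½ = ℚ.positive⁻¹ ½

  0<½* : ∀ {ε} → 0ℚ < ε → 0ℚ < ½ * ε
  0<½* = *-pos 0<½

  ½*-< : ∀ {ε} → 0ℚ < ε → ½ * ε < ε
  ½*-< {ε} 0<ε = subst₂ _<_ (ℚ.+-identityʳ (½ * ε)) (half ε)
    (ℚ.+-monoʳ-< (½ * ε) (0<½* 0<ε))

  ∣-∣-sym : ∀ p q → ∣ p - q ∣ ≡ ∣ q - p ∣
  ∣-∣-sym p q = trans (sym (ℚ.∣-p∣≡∣p∣ (p - q))) (cong ∣_∣ (neg-sub p q))
    where
    open +-*-Solver
    neg-sub : ∀ p q → - (p - q) ≡ q - p
    neg-sub = solve 2 (λ p q → :- (p :- q) := q :- p) refl

  ∣-∣-refl : ∀ {ε} p → 0ℚ < ε → ∣ p - p ∣ < ε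
  ∣-∣-refl {ε} p = subst (_< ε) (cong ∣_∣ (sym (ℚ.+-inverseʳ p)))

  p≤∣p∣ : ∀ p → p ≤ ∣ p ∣
  p≤∣p∣ p with ℚ.≤-total 0ℚ p
  ... | inj₁ 0≤p = ℚ.≤-reflexive (sym (ℚ.0≤p⇒∣p∣≡p 0≤p))
  ... | inj₂ p≤0 = ℚ.≤-trans p≤0 (ℚ.0≤∣p∣ p)

  ∣-∣-sum : ∀ {δ ε} p q {r} → r ≡ p + q → ∣ p ∣ < δ → ∣ q ∣ < ε → ∣ r ∣ < δ + ε
  ∣-∣-sum p q refl p<δ q<ε = ℚ.≤-<-trans (ℚ.∣p+q∣≤∣p∣+∣q∣ p q) (ℚ.+-mono-< p<δ q<ε)

  ∣-∣-sum½ : ∀ {ε} p q {r} → r ≡ p + q → ∣ p ∣ < ½ * ε → ∣ q ∣ < ½ * ε → ∣ r ∣ < ε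
  ∣-∣-sum½ {ε} p q eq p<δ q<ε = subst (∣ _ ∣ <_) (half ε) (∣-∣-sum p q eq p<δ q<ε)

  ∣-∣-trans : ∀ {ε} p q r → ∣ p - q ∣ < ½ * ε → ∣ q - r ∣ < ½ * ε → ∣ p - r ∣ < ε
  ∣-∣-trans p q r = ∣-∣-sum½ (p - q) (q - r) (telescope p q r)
    where
    open +-*-Solver
    telescope : ∀ p q r → p - r ≡ (p - q) + (q - r)
    telescope = solve 3 (λ p q r → p :- r := (p :- q) :+ (q :- r)) refl

  ∣-∣-+ : ∀ {ε} p q p′ q′ → ∣ p - p′ ∣ < ½ * ε → ∣ q - q′ ∣ < ½ * ε →
          ∣ (p + q) - (p′ + q′) ∣ < ε
  ∣-∣-+ p q p′ q′ = ∣-∣-sum½ (p - p′) (q - q′) (regroup p q p′ q′)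
    where
    open +-*-Solver
    regroup : ∀ p q p′ q′ → (p + q) - (p′ + q′) ≡ (p - p′) + (q - q′)
    regroup = solve 4 (λ p q p′ q′ → (p :+ q) :- (p′ :+ q′) := (p :- p′) :+ (q :- q′)) refl

  ∣-∣-neg : ∀ p q → ∣ (- p) - (- q) ∣ ≡ ∣ p - q ∣
  ∣-∣-neg p q = trans (cong ∣_∣ (flip p q)) (∣-∣-sym q p)
    where
    open +-*-Solver
    flip : ∀ p q → (- p) - (- q) ≡ q - p
    flip = solve 2 (λ p q → (:- p) :- (:- q) := q :- p) refl

  shrink : ∀ B ε → 0ℚ < B → 0ℚ < ε → ∃[ δ ] 0ℚ < δ × B * δ ≡ ½ * ε
  shrink B ε 0<B 0<ε = ½ * ε * 1/B , *-pos (0<½* 0<ε) 0<1/B , (begin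
    B * (½ * ε * 1/B)   ≡⟨ swap B (½ * ε) 1/B ⟩
    ½ * ε * (B * 1/B)   ≡⟨ cong (½ * ε *_) (ℚ.*-inverseʳ B) ⟩
    ½ * ε * 1ℚ          ≡⟨ ℚ.*-identityʳ _ ⟩
    ½ * ε               ∎)
    where
    open ≡-Reasoning
    open +-*-Solver
    instance _ = ℚ.pos⇒nonZero B {{ℚ.positive 0<B}}
    1/B = 1/ B
    0<1/B : 0ℚ < 1/B
    0<1/B = ℚ.positive⁻¹ _ {{ℚ.1/pos⇒pos B {{ℚ.positive 0<B}}}}
    swap : ∀ b e c → b * (e * c) ≡ e * (b * c)
    swap = solve 3 (λ b e c → b :* (e :* c) := e :* (b :* c)) refl

  ∣*∣-bound : ∀ {B δ ε} → 0ℚ < B → B * δ ≡ ½ * ε → ∀ p q → ∣ p ∣ < B → ∣ q ∣ < δ →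
              ∣ p * q ∣ < ½ * ε
  ∣*∣-bound {B} {δ} {ε} 0<B Bδ≡½ε p q p<B q<δ = begin-strict
    ∣ p * q ∣           ≡⟨ ℚ.∣p*q∣≡∣p∣*∣q∣ p q ⟩
    ∣ p ∣ * ∣ q ∣       ≤⟨ ℚ.*-monoʳ-≤-nonNeg ∣ q ∣ {{ℚ.∣-∣-nonNeg q}} (ℚ.<⇒≤ p<B) ⟩
    B * ∣ q ∣           <⟨ ℚ.*-monoʳ-<-pos B {{ℚ.positive 0<B}} q<δ ⟩
    B * δ               ≡⟨ Bδ≡½ε ⟩
    ½ * ε               ∎
    where open ℚ.≤-Reasoning

  ∣-∣-* : ∀ {ε B C δ η} → 0ℚ < B → 0ℚ < C → C * δ ≡ ½ * ε → B * η ≡ ½ * ε → ∀ p q p′ q′ →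
          ∣ p ∣ < B → ∣ q′ ∣ < C → ∣ p - p′ ∣ < δ → ∣ q - q′ ∣ < η →
          ∣ p * q - p′ * q′ ∣ < ε
  ∣-∣-* {ε} 0<B 0<C Cδ Bη p q p′ q′ p<B q′<C p-p′ q-q′ =
    ∣-∣-sum½ (p * (q - q′)) (q′ * (p - p′)) (split p q p′ q′)
      (∣*∣-bound {ε = ε} 0<B Bη p (q - q′) p<B q-q′) (∣*∣-bound {ε = ε} 0<C Cδ q′ (p - p′) q′<C p-p′)
    where
    open +-*-Solver
    split : ∀ p q p′ q′ → p * q - p′ * q′ ≡ p * (q - q′) + q′ * (p - p′)
    split = solve 4 (λ p q p′ q′ → p :* q :- p′ :* q′ := p :* (q :- q′) :+ q′ :* (p :- p′)) refl

Eventually : (ℕ → Set) → Set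
Eventually P = ∃[ N ] (∀ n → N ℕ.≤ n → P n)

IsCauchy : (ℕ → ℚ) → Set
IsCauchy x = ∀ ε → 0ℚ < ε → ∃[ N ] (∀ m n → N ℕ.≤ m → N ℕ.≤ n → ∣ x m - x n ∣ < ε)

-- ∃ is a Σ-type, so a real number carries a modulus of convergence.
record ℝ : Set where
  constructor mkℝ
  field
    seq    : ℕ → ℚ
    cauchy : IsCauchy seq

open ℝ public

infix 4 _≈ℝ_ _≤ℝ_

_≈ℝ_ : ℝ → ℝ → Set
x ≈ℝ y = ∀ ε → 0ℚ < ε → Eventually (λ n → ∣ seq x n - seq y n ∣ < ε)

-- The slack ε makes this the non-strict order on limits.
_≤ℝ_ : ℝ → ℝ → Set
x ≤ℝ y = ∀ ε → 0ℚ < ε → Eventually (λ n → seq x n < seq y n + ε)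

ℚ⇒ℝ : ℚ → ℝ
ℚ⇒ℝ q = mkℝ (λ _ → q) (λ ε 0<ε → 0 , λ _ _ _ _ → ∣-∣-refl q 0<ε)

ℤ⇒ℝ : ℤ → ℝ
ℤ⇒ℝ z = ℚ⇒ℝ (z / 1)

private

  ⊔-left : ∀ M N {n} → M ℕ.⊔ N ℕ.≤ n → M ℕ.≤ n
  ⊔-left M N = ℕ.m⊔n≤o⇒m≤o M N

  ⊔-right : ∀ M N {n} → M ℕ.⊔ N ℕ.≤ n → N ℕ.≤ n
  ⊔-right M N = ℕ.m⊔n≤o⇒n≤o M N

  both : ∀ {P Q R : ℕ → Set} → (∀ n → P n → Q n → R n) → Eventually P → Eventually Q → Eventually R
  both f (M , p) (N , q) = M ℕ.⊔ N , λ n h →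
    f n (p n (⊔-left M N h)) (q n (⊔-right M N h))

  bounded : ∀ x → ∃[ B ] (0ℚ < B) × Eventually (λ n → ∣ seq x n ∣ < B)
  bounded x with cauchy x 1ℚ (ℚ.positive⁻¹ 1ℚ)
  ... | N , close = ∣ seq x N ∣ + 1ℚ , 0<B , N , λ n N≤n →
    subst (∣ seq x n ∣ <_) (ℚ.+-comm 1ℚ ∣ seq x N ∣) (ℚ.≤-<-trans
      (subst (λ p → ∣ p ∣ ≤ ∣ seq x n - seq x N ∣ + ∣ seq x N ∣) (cancel (seq x n) (seq x N))
        (ℚ.∣p+q∣≤∣p∣+∣q∣ (seq x n - seq x N) (seq x N)))
      (ℚ.+-monoˡ-< ∣ seq x N ∣ (close n N N≤n ℕ.≤-refl)))
    where
    open +-*-Solver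
    cancel : ∀ p q → (p - q) + q ≡ p
    cancel = solve 2 (λ p q → (p :- q) :+ q := p) refl
    0<B : 0ℚ < ∣ seq x N ∣ + 1ℚ
    0<B = ℚ.+-mono-≤-< (ℚ.0≤∣p∣ (seq x N)) (ℚ.positive⁻¹ 1ℚ)

infixl 6 _+ℝ_
infixl 7 _*ℝ_
infix  8 -ℝ_

_+ℝ_ : ℝ → ℝ → ℝ
x +ℝ y = mkℝ (λ n → seq x n + seq y n) prf
  where
  prf : IsCauchy (λ n → seq x n + seq y n)
  prf ε 0<ε with cauchy x (½ * ε) (0<½* 0<ε) | cauchy y (½ * ε) (0<½* 0<ε)
  ... | M , p | N , q = M ℕ.⊔ N , λ m n hm hn →
    ∣-∣-+ (seq x m) (seq y m) (seq x n) (seq y n)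
      (p m n (⊔-left M N hm) (⊔-left M N hn))
      (q m n (⊔-right M N hm) (⊔-right M N hn))

-ℝ_ : ℝ → ℝ
-ℝ x = mkℝ (λ n → - seq x n) λ ε 0<ε → let N , p = cauchy x ε 0<ε in
  N , λ m n hm hn → subst (_< ε) (sym (∣-∣-neg (seq x m) (seq x n))) (p m n hm hn)

private

  *-isCauchy : ∀ x y → IsCauchy (λ n → seq x n * seq y n)
  *-isCauchy x y ε 0<ε =
    let B , 0<B , K , x<B = bounded x
        C , 0<C , L , y<C = bounded y
        δ , 0<δ , Cδ = shrink C ε 0<C 0<ε
        η , 0<η , Bη = shrink B ε 0<B 0<ε
        M , p = cauchy x δ 0<δ
        N , q = cauchy y η 0<η
        left  : ∀ {n} → (K ℕ.⊔ L) ℕ.⊔ (M ℕ.⊔ N) ℕ.≤ n → K ℕ.⊔ L ℕ.≤ n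
        left  = ⊔-left (K ℕ.⊔ L) (M ℕ.⊔ N)
        right : ∀ {n} → (K ℕ.⊔ L) ℕ.⊔ (M ℕ.⊔ N) ℕ.≤ n → M ℕ.⊔ N ℕ.≤ n
        right = ⊔-right (K ℕ.⊔ L) (M ℕ.⊔ N)
    in (K ℕ.⊔ L) ℕ.⊔ (M ℕ.⊔ N) , λ m n hm hn →
    ∣-∣-* {ε} 0<B 0<C Cδ Bη (seq x m) (seq y m) (seq x n) (seq y n)
      (x<B m (⊔-left K L (left hm))) (y<C n (⊔-right K L (left hn)))
      (p m n (⊔-left M N (right hm)) (⊔-left M N (right hn)))
      (q m n (⊔-right M N (right hm)) (⊔-right M N (right hn)))

_*ℝ_ : ℝ → ℝ → ℝ
x *ℝ y = mkℝ (λ n → seq x n * seq y n) (*-isCauchy x y)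

0ℝ 1ℝ : ℝ
0ℝ = ℚ⇒ℝ 0ℚ
1ℝ = ℚ⇒ℝ 1ℚ

pointwise : ∀ {x y} → (∀ n → seq x n ≡ seq y n) → x ≈ℝ y
pointwise {x} {y} eq ε 0<ε = 0 , λ n _ →
  subst (λ q → ∣ seq x n - q ∣ < ε) (eq n) (∣-∣-refl (seq x n) 0<ε)

≈ℝ-sym : ∀ {x y} → x ≈ℝ y → y ≈ℝ x
≈ℝ-sym {x} {y} x≈y ε 0<ε = let N , p = x≈y ε 0<ε in
  N , λ n h → subst (_< ε) (∣-∣-sym (seq x n) (seq y n)) (p n h)

≈ℝ-trans : ∀ {x y z} → x ≈ℝ y → y ≈ℝ z → x ≈ℝ z
≈ℝ-trans {x} {y} {z} x≈y y≈z ε 0<ε =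
  both (λ n → ∣-∣-trans (seq x n) (seq y n) (seq z n))
    (x≈y (½ * ε) (0<½* 0<ε)) (y≈z (½ * ε) (0<½* 0<ε))

+ℝ-cong : ∀ {x x′ y y′} → x ≈ℝ x′ → y ≈ℝ y′ → x +ℝ y ≈ℝ x′ +ℝ y′
+ℝ-cong {x} {x′} {y} {y′} p q ε 0<ε =
  both (λ n → ∣-∣-+ (seq x n) (seq y n) (seq x′ n) (seq y′ n))
    (p (½ * ε) (0<½* 0<ε)) (q (½ * ε) (0<½* 0<ε))

-ℝ-cong : ∀ {x y} → x ≈ℝ y → -ℝ x ≈ℝ -ℝ y
-ℝ-cong {x} {y} x≈y ε 0<ε = let N , p = x≈y ε 0<ε in
  N , λ n h → subst (_< ε) (sym (∣-∣-neg (seq x n) (seq y n))) (p n h)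

*ℝ-cong : ∀ {x x′ y y′} → x ≈ℝ x′ → y ≈ℝ y′ → x *ℝ y ≈ℝ x′ *ℝ y′
*ℝ-cong {x} {x′} {y} {y′} p q ε 0<ε =
  let B , 0<B , x<B  = bounded x
      C , 0<C , y′<C = bounded y′
      δ , 0<δ , Cδ = shrink C ε 0<C 0<ε
      η , 0<η , Bη = shrink B ε 0<B 0<ε
  in both
    (λ n (a , b) (c , d) →
      ∣-∣-* {ε} 0<B 0<C Cδ Bη (seq x n) (seq y n) (seq x′ n) (seq y′ n) a b c d)
    (both (λ _ → _,_) x<B y′<C)
    (both (λ _ → _,_) (p δ 0<δ) (q η 0<η))

ℝ-commutativeRing : CommutativeRing 0ℓ 0ℓ
ℝ-commutativeRing = record
  { Carrier = ℝ ; _≈_ = _≈ℝ_ ; _+_ = _+ℝ_ ; _*_ = _*ℝ_ ; -_ = -ℝ_ ; 0# = 0ℝ ; 1# = 1ℝ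
  ; isCommutativeRing = record
    { isRing = record
      { +-isAbelianGroup = record
        { isGroup = record
          { isMonoid = record
            { isSemigroup = record
              { isMagma = record
                { isEquivalence = record
                  { refl  = λ {x} → pointwise {x} {x} λ _ → refl
                  ; sym   = λ {x} {y} → ≈ℝ-sym {x} {y}
                  ; trans = λ {x} {y} {z} → ≈ℝ-trans {x} {y} {z}
                  }
                ; ∙-cong = λ {x} {x′} {y} {y′} → +ℝ-cong {x} {x′} {y} {y′}
                }
              ; assoc = λ x y z → pointwise {(x +ℝ y) +ℝ z} {x +ℝ (y +ℝ z)}
                  λ n → ℚ.+-assoc (seq x n) (seq y n) (seq z n)
              }
            ; identity = (λ x → pointwise {0ℝ +ℝ x} {x} λ n → ℚ.+-identityˡ (seq x n))
                       , (λ x → pointwise {x +ℝ 0ℝ} {x} λ n → ℚ.+-identityʳ (seq x n))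
            }
          ; inverse = (λ x → pointwise {(-ℝ x) +ℝ x} {0ℝ} λ n → ℚ.+-inverseˡ (seq x n))
                    , (λ x → pointwise {x +ℝ (-ℝ x)} {0ℝ} λ n → ℚ.+-inverseʳ (seq x n))
          ; ⁻¹-cong = λ {x} {y} → -ℝ-cong {x} {y}
          }
        ; comm = λ x y → pointwise {x +ℝ y} {y +ℝ x} λ n → ℚ.+-comm (seq x n) (seq y n)
        }
      ; *-cong = λ {x} {x′} {y} {y′} → *ℝ-cong {x} {x′} {y} {y′}
      ; *-assoc = λ x y z → pointwise {(x *ℝ y) *ℝ z} {x *ℝ (y *ℝ z)}
          λ n → ℚ.*-assoc (seq x n) (seq y n) (seq z n)
      ; *-identity = (λ x → pointwise {1ℝ *ℝ x} {x} λ n → ℚ.*-identityˡ (seq x n))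
                   , (λ x → pointwise {x *ℝ 1ℝ} {x} λ n → ℚ.*-identityʳ (seq x n))
      ; distrib =
          (λ x y z → pointwise {x *ℝ (y +ℝ z)} {x *ℝ y +ℝ x *ℝ z}
            λ n → ℚ.*-distribˡ-+ (seq x n) (seq y n) (seq z n))
        , (λ x y z → pointwise {(y +ℝ z) *ℝ x} {y *ℝ x +ℝ z *ℝ x}
            λ n → ℚ.*-distribʳ-+ (seq x n) (seq y n) (seq z n))
      }
    ; *-comm = λ x y → pointwise {x *ℝ y} {y *ℝ x} λ n → ℚ.*-comm (seq x n) (seq y n)
    }
  }

private

  archimedean : ∀ c → ∃[ k ] c < (ℤ.+ k) / 1
  archimedean c@(ℚ.mkℚ i d _) = k , ℚ.toℚᵘ-cancel-< (ℚᵘ.<-respʳ-≃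
    (ℚᵘ.≃-sym (ℚ.toℚᵘ-fromℚᵘ (ℚᵘ.mkℚᵘ (ℤ.+ k) 0)))
    (ℚᵘ.*<* (begin-strict
      i ℤ.* ℤ.+ 1            ≡⟨ ℤ.*-identityʳ i ⟩
      i                      ≤⟨ i≤∣i∣ i ⟩
      ℤ.+ ℤ.∣ i ∣            <⟨ ℤ.+<+ ℕ.≤-refl ⟩
      ℤ.+ k                  ≤⟨ ℤ.+≤+ (ℕ.m≤m*n k (suc d)) ⟩
      ℤ.+ (k ℕ.* suc d)      ≡⟨ ℤ.pos-* k (suc d) ⟩
      ℤ.+ k ℤ.* ℤ.+ suc d    ∎)))
    where
    open ℤ.≤-Reasoning
    k = suc ℤ.∣ i ∣
    i≤∣i∣ : ∀ i → i ℤ.≤ ℤ.+ ℤ.∣ i ∣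
    i≤∣i∣ (ℤ.+ n)    = ℤ.≤-refl
    i≤∣i∣ ℤ.-[1+ n ] = ℤ.-≤+

  suc/1 : ∀ k → (ℤ.+ suc k) / 1 ≡ (ℤ.+ k) / 1 + 1ℚ
  suc/1 k = ℚ.toℚᵘ-injective (begin
    ℚ.toℚᵘ ((ℤ.+ suc k) / 1)               ≈⟨ ℚ.toℚᵘ-fromℚᵘ (ℚᵘ.mkℚᵘ (ℤ.+ suc k) 0) ⟩
    ℚᵘ.mkℚᵘ (ℤ.+ suc k) 0                  ≈⟨ ℚᵘ.*≡* (cong (ℤ._* ℤ.+ 1) step) ⟩
    ℚᵘ.mkℚᵘ (ℤ.+ k) 0 ℚᵘ.+ ℚᵘ.1ℚᵘ          ≈⟨ ℚᵘ.+-congˡ ℚᵘ.1ℚᵘ (ℚᵘ.≃-sym (ℚ.toℚᵘ-fromℚᵘ (ℚᵘ.mkℚᵘ (ℤ.+ k) 0))) ⟩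
    ℚ.toℚᵘ ((ℤ.+ k) / 1) ℚᵘ.+ ℚᵘ.1ℚᵘ       ≈⟨ ℚᵘ.≃-sym (ℚ.toℚᵘ-homo-+ ((ℤ.+ k) / 1) 1ℚ) ⟩
    ℚ.toℚᵘ ((ℤ.+ k) / 1 + 1ℚ)              ∎)
    where
    open ℚᵘ.≃-Reasoning
    step : ℤ.+ suc k ≡ ℤ.+ k ℤ.* ℤ.+ 1 ℤ.+ ℤ.+ 1
    step = trans (cong ℤ.+_ (ℕ.+-comm 1 k)) (cong (ℤ._+ ℤ.+ 1) (sym (ℤ.*-identityʳ (ℤ.+ k))))

  mesh : ℕ → ℚ
  mesh n = (ℤ.+ 1) / suc n

  mesh-pos : ∀ n → 0ℚ < mesh n
  mesh-pos n = ℚ.positive⁻¹ (mesh n) {{ℚ.normalize-pos 1 (suc n)}}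

  mesh-small : ∀ ε → 0ℚ < ε → Eventually (λ n → mesh n < ε)
  mesh-small ε@(ℚ.mkℚ ℤ.+[1+ k ] d _) 0<ε = suc d , λ n d<n → ℚ.toℚᵘ-cancel-< (ℚᵘ.<-respˡ-≃
    (ℚᵘ.≃-sym (ℚ.toℚᵘ-fromℚᵘ (ℚᵘ.mkℚᵘ (ℤ.+ 1) n)))
    (ℚᵘ.*<* (subst₂ ℤ._<_ (sym (ℤ.*-identityˡ (ℤ.+ suc d))) (ℤ.pos-* (suc k) (suc n))
      (ℤ.+<+ (ℕ.<-≤-trans (ℕ.s≤s d<n) (ℕ.m≤n*m (suc n) (suc k)))))))
  mesh-small (ℚ.mkℚ ℤ.+0 d _) 0<ε = contradiction (ℚ.drop-*<* 0<ε) λ { (ℤ.+<+ ()) }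
  mesh-small (ℚ.mkℚ ℤ.-[1+ k ] d _) 0<ε = contradiction (ℚ.drop-*<* 0<ε) λ ()

  sq-mono-≤ : ∀ {p q} → 0ℚ ≤ p → p ≤ q → p * p ≤ q * q
  sq-mono-≤ {p} {q} 0≤p p≤q = ℚ.≤-trans
    (ℚ.*-monoˡ-≤-nonNeg p {{ℚ.nonNegative 0≤p}} p≤q)
    (ℚ.*-monoʳ-≤-nonNeg q {{ℚ.nonNegative (ℚ.≤-trans 0≤p p≤q)}} p≤q)

  ∣-∣-< : ∀ {p q ε} → p < q + ε → q < p + ε → ∣ p - q ∣ < ε
  ∣-∣-< {p} {q} {ε} p<q+ε q<p+ε with ℚ.∣p∣≡p∨∣p∣≡-p (p - q)
  ... | inj₁ eq = subst₂ _<_ (sym eq) (cancel q ε) (ℚ.+-monoˡ-< (- q) p<q+ε)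
    where
    open +-*-Solver
    cancel : ∀ q e → (q + e) - q ≡ e
    cancel = solve 2 (λ q e → (q :+ e) :- q := e) refl
  ... | inj₂ eq = subst₂ _<_ (trans (flip p q) (sym eq)) (cancel p ε) (ℚ.+-monoˡ-< (- p) q<p+ε)
    where
    open +-*-Solver
    cancel : ∀ q e → (q + e) - q ≡ e
    cancel = solve 2 (λ q e → (q :+ e) :- q := e) refl
    flip : ∀ p q → q - p ≡ - (p - q)
    flip = solve 2 (λ p q → q :- p := :- (p :- q)) refl

  LowerRoot : (h a s : ℚ) → Set
  LowerRoot h a s = 0ℚ ≤ s × s * s ≤ a × a < (s + h) * (s + h)

  module _ (h : ℚ) (0<h : 0ℚ < h) (a : ℚ) (0≤a : 0ℚ ≤ a) where

    step : ℕ → ℚ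
    step k = fold 0ℚ (_+ h) k

    step-nonNeg : ∀ k → 0ℚ ≤ step k
    step-nonNeg zero    = ℚ.≤-refl
    step-nonNeg (suc k) = ℚ.+-mono-≤ (step-nonNeg k) (ℚ.<⇒≤ 0<h)

    step-* : ∀ k → step k ≡ (ℤ.+ k) / 1 * h
    step-* zero    = sym (ℚ.*-zeroˡ h)
    step-* (suc k) = begin
      step k + h                   ≡⟨ cong (_+ h) (step-* k) ⟩
      (ℤ.+ k) / 1 * h + h          ≡⟨ distrib ((ℤ.+ k) / 1) h ⟩
      ((ℤ.+ k) / 1 + 1ℚ) * h       ≡⟨ cong (_* h) (sym (suc/1 k)) ⟩
      (ℤ.+ suc k) / 1 * h          ∎
      where
      open ≡-Reasoning
      open +-*-Solver
      distrib : ∀ p h → p * h + h ≡ (p + 1ℚ) * h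
      distrib = solve 2 (λ p h → p :* h :+ h := (p :+ con 1ℚ) :* h) refl

    step-large : ∃[ k ] a < step k * step k
    step-large = k , (begin-strict
      a                    ≡⟨ ℚ.+-identityʳ a ⟨
      a + 0ℚ               <⟨ ℚ.+-monoʳ-< a (ℚ.positive⁻¹ 1ℚ) ⟩
      a + 1ℚ               ≡⟨ ℚ.*-identityʳ (a + 1ℚ) ⟨
      (a + 1ℚ) * 1ℚ        ≤⟨ ℚ.*-monoˡ-≤-nonNeg (a + 1ℚ) {{ℚ.nonNegative 0≤a+1}} 1≤a+1 ⟩
      (a + 1ℚ) * (a + 1ℚ)  ≤⟨ sq-mono-≤ 0≤a+1 (ℚ.<⇒≤ a+1<step) ⟩
      step k * step k      ∎)
      where
      open ℚ.≤-Reasoning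
      instance _ = ℚ.pos⇒nonZero h {{ℚ.positive 0<h}}
      c = (a + 1ℚ) * 1/ h
      k = proj₁ (archimedean c)
      1≤a+1 : 1ℚ ≤ a + 1ℚ
      1≤a+1 = ℚ.+-monoˡ-≤ 1ℚ 0≤a
      0≤a+1 : 0ℚ ≤ a + 1ℚ
      0≤a+1 = ℚ.≤-trans (ℚ.<⇒≤ (ℚ.positive⁻¹ 1ℚ)) 1≤a+1
      a+1<step : a + 1ℚ < step k
      a+1<step = begin-strict
        a + 1ℚ                 ≡⟨ ℚ.*-identityʳ (a + 1ℚ) ⟨
        (a + 1ℚ) * 1ℚ          ≡⟨ cong ((a + 1ℚ) *_) (ℚ.*-inverseˡ h) ⟨
        (a + 1ℚ) * (1/ h * h)  ≡⟨ ℚ.*-assoc (a + 1ℚ) (1/ h) h ⟨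
        c * h                  <⟨ ℚ.*-monoˡ-<-pos h {{ℚ.positive 0<h}} (proj₂ (archimedean c)) ⟩
        (ℤ.+ k) / 1 * h        ≡⟨ step-* k ⟨
        step k                 ∎

    search : ∀ k → a < step k * step k → ∃ (LowerRoot h a)
    search zero    a<0 = contradiction (ℚ.≤-<-trans 0≤a a<0) (ℚ.<-irrefl refl)
    search (suc k) a<sk² with step k * step k ℚ.≤? a
    ... | yes k²≤a = step k , step-nonNeg k , k²≤a , a<sk²
    ... | no  k²≰a = search k (ℚ.≰⇒> k²≰a)

    lowerRoot : ∃ (LowerRoot h a)
    lowerRoot = search (proj₁ step-large) (proj₂ step-large)

  root : ∀ n a → ∃ (LowerRoot (mesh n) ∣ a ∣)
  root n a = lowerRoot (mesh n) (mesh-pos n) ∣ a ∣ (ℚ.0≤∣p∣ a)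

  roots-close : ∀ {h a b s ε} t → 0ℚ < h → h < ½ * ε → 0ℚ < ε → 0ℚ ≤ s →
                a < (s + h) * (s + h) → t * t ≤ b → b - a < (½ * ε) * (½ * ε) → t < s + ε
  roots-close {h} {a} {b} {s} {ε} t 0<h h<½ε 0<ε 0≤s a<[s+h]² t²≤b b-a<[½ε]² =
    ℚ.≰⇒> λ s+ε≤t → ℚ.<-irrefl refl (begin-strict
      b                                                     ≡⟨ cancel a b ⟨
      a + (b - a)                                           <⟨ ℚ.+-mono-< a<[s+h]² b-a<[½ε]² ⟩
      (s + h) * (s + h) + (½ * ε) * (½ * ε)                 ≤⟨ ℚ.+-monoˡ-≤ _ (sq-mono-≤ 0≤s+h s+h≤s+½ε) ⟩
      (s + ½ * ε) * (s + ½ * ε) + (½ * ε) * (½ * ε)         ≡⟨ ℚ.+-identityʳ _ ⟨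
      (s + ½ * ε) * (s + ½ * ε) + (½ * ε) * (½ * ε) + 0ℚ    ≤⟨ ℚ.+-monoʳ-≤ ((s + ½ * ε) * (s + ½ * ε) + (½ * ε) * (½ * ε)) 0≤rest ⟩
      (s + ½ * ε) * (s + ½ * ε) + (½ * ε) * (½ * ε) + rest  ≡⟨ expand s ε ⟨
      (s + ε) * (s + ε)                                     ≤⟨ sq-mono-≤ 0≤s+ε s+ε≤t ⟩
      t * t                                                 ≤⟨ t²≤b ⟩
      b                                                     ∎)
    where
    open ℚ.≤-Reasoning
    open +-*-Solver
    rest = s * ε + ½ * ε * ε
    cancel : ∀ a b → a + (b - a) ≡ b
    cancel = solve 2 (λ a b → a :+ (b :- a) := b) refl
    expand : ∀ s e → (s + e) * (s + e) ≡
      (s + ½ * e) * (s + ½ * e) + (½ * e) * (½ * e) + (s * e + ½ * e * e)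
    expand = solve 2 (λ s e → (s :+ e) :* (s :+ e) :=
      (s :+ con ½ :* e) :* (s :+ con ½ :* e) :+ (con ½ :* e) :* (con ½ :* e)
        :+ (s :* e :+ con ½ :* e :* e)) refl
    0≤s+h : 0ℚ ≤ s + h
    0≤s+h = ℚ.+-mono-≤ 0≤s (ℚ.<⇒≤ 0<h)
    0≤s+ε : 0ℚ ≤ s + ε
    0≤s+ε = ℚ.+-mono-≤ 0≤s (ℚ.<⇒≤ 0<ε)
    s+h≤s+½ε : s + h ≤ s + ½ * ε
    s+h≤s+½ε = ℚ.+-monoʳ-≤ s (ℚ.<⇒≤ h<½ε)
    0≤rest : 0ℚ ≤ rest
    0≤rest = ℚ.+-mono-≤
      (ℚ.≤-trans (ℚ.≤-reflexive (sym (ℚ.*-zeroˡ ε)))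
        (ℚ.*-monoʳ-≤-nonNeg ε {{ℚ.nonNegative (ℚ.<⇒≤ 0<ε)}} 0≤s))
      (ℚ.<⇒≤ (*-pos (0<½* 0<ε) 0<ε))

  ∣∣-∣∣ : ∀ {η} p q → ∣ p - q ∣ < η → ∣ p ∣ - ∣ q ∣ < η
  ∣∣-∣∣ {η} p q p-q<η = ℚ.≤-<-trans
    (subst₂ _≤_ (cong (_- ∣ q ∣) (cong ∣_∣ (cancel₁ p q))) (cancel₂ ∣ p - q ∣ ∣ q ∣)
      (ℚ.+-monoˡ-≤ (- ∣ q ∣) (ℚ.∣p+q∣≤∣p∣+∣q∣ (p - q) q))) p-q<η
    where
    open +-*-Solver
    cancel₁ : ∀ p q → (p - q) + q ≡ p
    cancel₁ = solve 2 (λ p q → (p :- q) :+ q := p) refl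
    cancel₂ : ∀ p q → (p + q) - q ≡ p
    cancel₂ = solve 2 (λ p q → (p :+ q) :- q := p) refl

  root-isCauchy : ∀ x → IsCauchy (λ n → proj₁ (root n (seq x n)))
  root-isCauchy x ε 0<ε =
    let M , p = cauchy x ((½ * ε) * (½ * ε)) (*-pos (0<½* 0<ε) (0<½* 0<ε))
        N , q = mesh-small (½ * ε) (0<½* 0<ε)
        below : ∀ m n → M ℕ.⊔ N ℕ.≤ m → M ℕ.⊔ N ℕ.≤ n →
                proj₁ (root m (seq x m)) < proj₁ (root n (seq x n)) + ε
        below m n hm hn =
          let s , 0≤s , _ , a<[s+h]² = root n (seq x n)
              t , _ , t²≤b , _ = root m (seq x m)
          in roots-close t (mesh-pos n) (q n (⊔-right M N hn)) 0<ε 0≤s a<[s+h]² t²≤b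
               (∣∣-∣∣ (seq x m) (seq x n) (p m n (⊔-left M N hm) (⊔-left M N hn)))
    in M ℕ.⊔ N , λ m n hm hn → ∣-∣-< (below m n hm hn) (below n m hn hm)

-- √ x is the square root of the absolute value of x; its n-th term is the largest multiple of
-- 1/(n+1) whose square is at most ∣ xₙ ∣.
√ : ℝ → ℝ
√ x = mkℝ (λ n → proj₁ (root n (seq x n))) (root-isCauchy x)

√-nonNeg : ∀ x → 0ℝ ≤ℝ √ x
√-nonNeg x ε 0<ε = 0 , λ n _ → ℚ.+-mono-≤-< (proj₁ (proj₂ (root n (seq x n)))) 0<ε

private

  ∣x∣-x : ∀ {δ} x → 0ℚ < δ → 0ℚ < x + ½ * δ → ∣ ∣ x ∣ - x ∣ < δ
  ∣x∣-x {δ} x 0<δ 0<x+½δ with ℚ.≤-total 0ℚ x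
  ... | inj₁ 0≤x = subst (λ y → ∣ y - x ∣ < δ) (sym (ℚ.0≤p⇒∣p∣≡p 0≤x)) (∣-∣-refl x 0<δ)
  ... | inj₂ x≤0 = ∣-∣-< ∣x∣<x+δ (ℚ.≤-<-trans (p≤∣p∣ x)
      (subst (_< ∣ x ∣ + δ) (ℚ.+-identityʳ ∣ x ∣) (ℚ.+-monoʳ-< ∣ x ∣ 0<δ)))
    where
    open ℚ.≤-Reasoning
    open +-*-Solver
    shift : ∀ x d → - x + ((x + ½ * d) + (x + ½ * d)) ≡ x + d
    shift = solve 2 (λ x d → :- x :+ ((x :+ con ½ :* d) :+ (x :+ con ½ :* d)) := x :+ d) refl
    ∣x∣≡-x : ∣ x ∣ ≡ - x
    ∣x∣≡-x = trans (sym (ℚ.∣-p∣≡∣p∣ x)) (ℚ.0≤p⇒∣p∣≡p (ℚ.neg-antimono-≤ x≤0))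
    ∣x∣<x+δ : ∣ x ∣ < x + δ
    ∣x∣<x+δ = begin-strict
      ∣ x ∣                                    ≡⟨ ∣x∣≡-x ⟩
      - x                                      ≡⟨ ℚ.+-identityʳ (- x) ⟨
      - x + 0ℚ                                 <⟨ ℚ.+-monoʳ-< (- x) (ℚ.+-mono-< 0<x+½δ 0<x+½δ) ⟩
      - x + ((x + ½ * δ) + (x + ½ * δ))        ≡⟨ shift x δ ⟩
      x + δ                                    ∎

  root-error : ∀ {h a s B δ ε} → 0ℚ < ε → 0ℚ < h → h < 1ℚ → h < δ → 0ℚ < B → ∣ s ∣ < B →
               (B + B + 1ℚ) * δ ≡ ½ * ε → s * s ≤ a → a < (s + h) * (s + h) →
               ∣ s * s - a ∣ < ½ * ε
  root-error {h} {a} {s} {B} {δ} {ε} 0<ε 0<h h<1 h<δ 0<B s<B Cδ s²≤a a<[s+h]² =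
    ∣-∣-< (ℚ.≤-<-trans s²≤a (subst (_< a + ½ * ε) (ℚ.+-identityʳ a) (ℚ.+-monoʳ-< a (0<½* 0<ε))))
      (begin-strict
      a                              <⟨ a<[s+h]² ⟩
      (s + h) * (s + h)              ≡⟨ expand s h ⟩
      s * s + (s + s + h) * h        ≤⟨ ℚ.+-monoʳ-≤ (s * s) (p≤∣p∣ ((s + s + h) * h)) ⟩
      s * s + ∣ (s + s + h) * h ∣    <⟨ ℚ.+-monoʳ-< (s * s) (∣*∣-bound {ε = ε} 0<C Cδ (s + s + h) h
                                          (∣-∣-sum (s + s) h refl (∣-∣-sum s s refl s<B s<B)
                                            (∣h∣< h<1)) (∣h∣< h<δ)) ⟩
      s * s + ½ * ε                  ∎)
    where
    open ℚ.≤-Reasoning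
    open +-*-Solver
    expand : ∀ s h → (s + h) * (s + h) ≡ s * s + (s + s + h) * h
    expand = solve 2 (λ s h → (s :+ h) :* (s :+ h) := s :* s :+ (s :+ s :+ h) :* h) refl
    ∣h∣< : ∀ {c} → h < c → ∣ h ∣ < c
    ∣h∣< {c} = subst (_< c) (sym (ℚ.0≤p⇒∣p∣≡p (ℚ.<⇒≤ 0<h)))
    0<C : 0ℚ < B + B + 1ℚ
    0<C = ℚ.+-mono-< (ℚ.+-mono-< 0<B 0<B) (ℚ.positive⁻¹ 1ℚ)

√-square : ∀ x → 0ℝ ≤ℝ x → √ x *ℝ √ x ≈ℝ x
√-square x 0≤x ε 0<ε =
  let B , 0<B , s<B = bounded (√ x)
      0<C = ℚ.+-mono-< (ℚ.+-mono-< 0<B 0<B) (ℚ.positive⁻¹ 1ℚ)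
      δ , 0<δ , Cδ = shrink (B + B + 1ℚ) ε 0<C 0<ε
  in both
    (λ n s<B (h<δ , h<1 , 0<x+) →
      let s , _ , s²≤a , a<[s+h]² = root n (seq x n) in
      ∣-∣-trans (s * s) ∣ seq x n ∣ (seq x n)
        (root-error {ε = ε} 0<ε (mesh-pos n) h<1 h<δ 0<B s<B Cδ s²≤a a<[s+h]²)
        (∣x∣-x (seq x n) (0<½* 0<ε) 0<x+))
    s<B
    (both (λ _ → _,_) (mesh-small δ 0<δ)
      (both (λ _ → _,_) (mesh-small 1ℚ (ℚ.positive⁻¹ 1ℚ)) (0≤x (½ * (½ * ε)) (0<½* (0<½* 0<ε)))))

open RawMonoidOps (CommutativeRing.+-rawMonoid ℝ-commutativeRing) using () renaming (sum to ∑ℝ)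

ℝ^ : ℕ → Set
ℝ^ n = Vector ℝ n

infix 4 _≈ᵥ_

_≈ᵥ_ : ∀ {n} → ℝ^ n → ℝ^ n → Set
u ≈ᵥ v = ∀ j → u j ≈ℝ v j

0ᵥ : ∀ {n} → ℝ^ n
0ᵥ _ = 0ℝ

-- ‖_‖² is computed without the square root; √-square shows that it is the square of ‖_‖.
‖_‖² : ∀ {n} → ℝ^ n → ℝ
‖ v ‖² = ∑ℝ (λ j → v j *ℝ v j)

‖_‖ : ∀ {n} → ℝ^ n → ℝ
‖ v ‖ = √ ‖ v ‖²

linearCombination : ∀ {r n} → (Fin r → ℝ) → (Fin r → ℝ^ n) → ℝ^ n
linearCombination a b j = ∑ℝ (λ i → a i *ℝ b i j)

LinearlyIndependent : ∀ {r n} → (Fin r → ℝ^ n) → Set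
LinearlyIndependent b = ∀ a → linearCombination a b ≈ᵥ 0ᵥ → ∀ i → a i ≈ℝ 0ℝ

ℤSpan : ∀ {r n} → (Fin r → ℝ^ n) → Pred (ℝ^ n) 0ℓ
ℤSpan {r} b v = Σ[ k ∈ (Fin r → ℤ) ] v ≈ᵥ linearCombination (λ i → ℤ⇒ℝ (k i)) b

IsLatticeOfRank : ∀ {n a} → ℕ → Pred (ℝ^ n) a → Set a
IsLatticeOfRank {n} r L = Σ[ b ∈ (Fin r → ℝ^ n) ] LinearlyIndependent b × L ≐ ℤSpan b

IsShortestIn : ∀ {n a} → ℝ^ n → Pred (ℝ^ n) a → Set a
IsShortestIn u L = u ∈ L × ¬ (u ≈ᵥ 0ᵥ) × (∀ v → v ∈ L → ¬ (v ≈ᵥ 0ᵥ) → ‖ u ‖ ≤ℝ ‖ v ‖)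

-- t = min { ‖v‖² : 0 ≠ v ∈ L }
IsMinimumNorm² : ∀ {n a} → Pred (ℝ^ n) a → ℝ → Set a
IsMinimumNorm² L t =
  (∃[ v ] v ∈ L × ¬ (v ≈ᵥ 0ᵥ) × ‖ v ‖² ≈ℝ t) ×
  (∀ v → v ∈ L → ¬ (v ≈ᵥ 0ᵥ) → t ≤ℝ ‖ v ‖²)

MinimalVectors : ∀ {n a} → Pred (ℝ^ n) a → Pred (ℝ^ n) a
MinimalVectors L v = v ∈ L × (∃[ t ] IsMinimumNorm² L t × ‖ v ‖² ≈ℝ t)

IsWellRounded : ∀ {n a} → Pred (ℝ^ n) a → Set a
IsWellRounded {n} L =
  IsLatticeOfRank n L ×
  (Σ[ b ∈ (Fin n → ℝ^ n) ] LinearlyIndependent b × (∀ i → b i ∈ MinimalVectors L))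

-- A field extension of ℚ of the given degree, the degree being witnessed by a ℚ-basis. The
-- homomorphism ℚ⇒K is injective because 1≉0.
record NumberField (c ℓ : Level) (degree : ℕ) : Set (lsuc (c ⊔ ℓ)) where
  field
    commutativeRing : CommutativeRing c ℓ

  open CommutativeRing commutativeRing public
    using (Carrier; _≈_; 0#; 1#; rawRing; semiring; +-rawMonoid)
    renaming (_+_ to _+K_; _*_ to _*K_; -_ to -K_)

  open RawMonoidOps +-rawMonoid public using () renaming (sum to ∑K)
  open RawSemiringOps (Semiring.rawSemiring semiring) public using () renaming (_^_ to _^K_)

  field
    1≉0                 : ¬ (1# ≈ 0#)
    inverse             : ∀ x → ¬ (x ≈ 0#) → ∃[ y ] x *K y ≈ 1#
    ℚ⇒K                 : ℚ → Carrier
    ℚ⇒K-isHomomorphism  : IsRingHomomorphism ℚ.+-*-rawRing rawRing ℚ⇒K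
    basis               : Fin degree → Carrier
    basis-spans         : ∀ x → Σ[ q ∈ (Fin degree → ℚ) ] x ≈ ∑K (λ i → ℚ⇒K (q i) *K basis i)
    basis-independent   : ∀ (q : Fin degree → ℚ) → ∑K (λ i → ℚ⇒K (q i) *K basis i) ≈ 0# →
                          ∀ i → q i ≡ 0ℚ

  ℤ⇒K : ℤ → Carrier
  ℤ⇒K z = ℚ⇒K (z / 1)

module _ {c ℓ : Level} {d : ℕ} (K : NumberField c ℓ d) where

  open NumberField K

  -- regards K as a subfield of ℝ
  record RealEmbedding : Set (c ⊔ ℓ) where
    field
      ι                  : Carrier → ℝ
      ι-isMonomorphism   : IsRingMonomorphism rawRing (CommutativeRing.rawRing ℝ-commutativeRing) ι

  -- elements of Aut(K/ℚ), which is Gal(K/ℚ) when K/ℚ is Galois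
  record Automorphism : Set (c ⊔ ℓ) where
    field
      map            : Carrier → Carrier
      isIsomorphism  : IsRingIsomorphism rawRing rawRing map
      fixesℚ         : ∀ q → map (ℚ⇒K q) ≈ ℚ⇒K q

  iterate : Automorphism → ℕ → Carrier → Carrier
  iterate φ n x = fold x (Automorphism.map φ) n

  -- A finite extension is Galois when the fixed field of its automorphism group is the base field.
  IsGalois : Set (c ⊔ ℓ)
  IsGalois = ∀ x → (∀ (φ : Automorphism) → Automorphism.map φ x ≈ x) → ∃[ q ] x ≈ ℚ⇒K q

  -- order and minimal together say that θ has order exactly n.
  record IsCyclicOfOrder (n : ℕ) (θ : Automorphism) : Set (c ⊔ ℓ) where
    field
      generates  : ∀ (φ : Automorphism) → ∃[ k ] (∀ x → Automorphism.map φ x ≈ iterate θ k x)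
      order      : ∀ x → iterate θ n x ≈ x
      minimal    : ∀ k → 0 ℕ.< k → k ℕ.< n → ¬ (∀ x → iterate θ k x ≈ x)

  -- x is a root of the monic integer polynomial Xⁿ + Σ_{i<n} aᵢ Xⁱ
  𝓞 : Pred Carrier ℓ
  𝓞 x = ∃[ n ] Σ[ a ∈ (Fin n → ℤ) ] (x ^K n) +K ∑K (λ i → ℤ⇒K (a i) *K (x ^K toℕ i)) ≈ 0#

  IsRationalInteger : Pred Carrier ℓ
  IsRationalInteger x = ∃[ z ] x ≈ ℤ⇒K z

  record IsℤSubmodule {m} (M : Pred Carrier m) : Set (c ⊔ ℓ ⊔ m) where
    field
      resp-≈    : ∀ {x y} → x ≈ y → x ∈ M → y ∈ M
      0-closed  : 0# ∈ M
      +-closed  : ∀ {x y} → x ∈ M → y ∈ M → (x +K y) ∈ M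
      ·-closed  : ∀ z {x} → x ∈ M → (ℤ⇒K z *K x) ∈ M

  Trace : Automorphism → Carrier → Carrier
  Trace θ x = ∑K {d} (λ i → iterate θ (toℕ i) x)

  -- θ, not an enumeration of embeddings, fixes the order of the coordinates.
  canonicalEmbedding : RealEmbedding → Automorphism → Carrier → ℝ^ d
  canonicalEmbedding R θ x i = RealEmbedding.ι R (iterate θ (toℕ i) x)

  Image : ∀ {m} → (Carrier → ℝ^ d) → Pred Carrier m → Pred (ℝ^ d) (c ⊔ m)
  Image σ M v = ∃[ x ] x ∈ M × v ≈ᵥ σ x

{-# OPTIONS --safe #-}

-- If Tr α = 0, the p integer coordinate vectors of a lattice basis of the span of B, together with
-- (1,…,1), satisfy an integer relation, which contradicts the independence of the basis because
-- the conjugates of α add up to 0.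
--
-- If Tr α ≠ 0, let Q n = ∑ⱼ θʲ(α) θʲ⁺ⁿ(α). These traces are rational, so D Q n = u n for integers
-- D ≠ 0 and u n. Since ∑ (θʲ⁺¹(α) − θʲ(α))² = 2 (Q 0 − Q 1) and α is not rational, u is not constant;
-- and ∑ u = D (Tr α)² ≠ 0. The point is that an integer sequence f of period p which annihilates u,
-- ∑ᵢ f i · u (n + i) = 0 for all n, is constant; as ∑ u ≠ 0 it is then 0, so the Hankel matrix
-- (u (n + i)) is invertible over ℚ, and so the conjugates of σ(α) are independent over ℝ.
--
-- This point is the irreducibility of 1 + X + ⋯ + Xᵖ⁻¹, in the following form. Let v = Δu ≠ 0 and
-- h = Δf, so that h annihilates v and ∑ h = 0. The partial sums of h annihilate v too; their sum over
-- a period is divisible by p, since otherwise v = 0 by a descent modulo p; after subtraction of a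
-- constant they satisfy the same hypotheses as h. Iterating, h = Δᵖ g, and Δᵖ ≡ 0 modulo p on
-- sequences of period p. Hence h is divisible by p, and h / p again satisfies the hypotheses: h = 0.
--
-- The conjugates of σ(α) all have the norm of σ(α), which is minimal in Λ and a fortiori in the
-- span of B.
module Submission where

open import Defs
open import Algebra.Bundles using (CommutativeRing; Semiring)
import Algebra.Definitions.RawSemiring as RawSemiringOperations
import Algebra.Morphism.Construct.Composition as Composition
import Algebra.Morphism.Construct.Identity as Identity
open import Algebra.Morphism.Structures using (IsRingHomomorphism; IsRingMonomorphism; IsRingIsomorphism)
import Algebra.Properties.Group as GroupProperties
import Algebra.Properties.Ring as RingProperties
import Algebra.Properties.Semiring.Sum as SemiringSum
import Algebra.Solver.Ring.NaturalCoefficients.Default as SemiringSolver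
open import Data.Empty using (⊥)
open import Data.Fin.Base as Fin using (Fin; zero; suc; toℕ; punchIn; punchOut)
import Data.Fin.Properties as Fin
import Level
open import Data.Integer.Base as ℤ using (ℤ; +_; -[1+_]; 0ℤ; 1ℤ)
open import Data.Integer.Divisibility.Signed using
  (_∣_; divides; _∣?_; ∣ᵤ⇒∣; ∣⇒∣ᵤ; ∣m∣n⇒∣m+n; ∣m⇒∣-m; ∣n⇒∣m*n; ∣m⇒∣m*n)
import Data.Integer.Properties as ℤ
open import Data.Integer.Tactic.RingSolver using (solve-∀)
open import Data.Nat.Base as ℕ using (ℕ; zero; suc; NonZero; _<_)
open import Data.Nat.Combinatorics using (_C_; nCn≡1; nCk≡nC[n∸k]; k>n⇒nCk≡0; nCk+nC[k+1]≡[n+1]C[k+1])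
import Data.Nat.Coprimality as Coprimality
import Data.Nat.Divisibility as ℕ
open import Data.Nat.DivMod using (_divMod_; module DivMod; _mod_; m<n⇒m%n≡m; [m+n]%n≡m%n)
open import Data.Nat.Primality using (Prime; euclidsLemma; prime⇒nonZero; prime⇒nonTrivial)
import Data.Nat.Properties as ℕ
open import Data.Product.Base using (∃-syntax; Σ-syntax; _×_; _,_; proj₁; proj₂)
open import Data.Rational.Base as ℚ using (ℚ; mkℚ; 0ℚ; 1ℚ; ½)
import Data.Rational.Properties as ℚ
open import Data.Rational.Solver using (module +-*-Solver)
open import Data.Rational.Unnormalised.Base as ℚᵘ using (mkℚᵘ)
import Data.Rational.Unnormalised.Properties as ℚᵘ
open import Data.Sum.Base using (inj₁; inj₂; [_,_]′)
open import Function.Base using (_∘_; id)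
open import Function.Bundles using (_⇔_; mk⇔)
open import Relation.Binary.PropositionalEquality as ≡ using (_≡_; cong; cong₂; subst; _≗_)
open import Relation.Nullary using (¬_; ¬?; yes; no; contradiction; decidable-stable)
open import Relation.Unary using (Pred; _∈_; _∉_; _⊆_)

-- Finite sums and periodic sequences in a commutative ring.

module PeriodicSums {c ℓ} (S : CommutativeRing c ℓ) where

  open CommutativeRing S
  open SemiringSum semiring public
  open RingProperties ring using (+-cancelˡ)
  open import Relation.Binary.Reasoning.Setoid setoid

  ∑< : ℕ → (ℕ → Carrier) → Carrier
  ∑< n f = sum {n} (λ i → f (toℕ i))

  Periodic : ℕ → (ℕ → Carrier) → Set ℓ
  Periodic p f = ∀ n → f (n ℕ.+ p) ≈ f n

  ∑<-cong : ∀ n {f g} → (∀ i → f i ≈ g i) → ∑< n f ≈ ∑< n g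
  ∑<-cong n f≈g = sum-cong-≋ {n} (λ i → f≈g (toℕ i))

  sum-0 : ∀ {n} {f : Fin n → Carrier} → (∀ i → f i ≈ 0#) → sum f ≈ 0#
  sum-0 {n} f≈0 = trans (sum-cong-≋ {n} f≈0) (sum-replicate-zero n)

  ∑<-last : ∀ n f → ∑< (suc n) f ≈ ∑< n f + f n
  ∑<-last zero    f = trans (+-identityʳ _) (sym (+-identityˡ _))
  ∑<-last (suc n) f = trans (+-congˡ (∑<-last n (f ∘ suc))) (sym (+-assoc _ _ _))

  ∑<-rotate : ∀ p f → f p ≈ f 0 → ∑< p (f ∘ suc) ≈ ∑< p f
  ∑<-rotate p f fp≈f0 = +-cancelˡ (f 0) _ _ (begin
    f 0 + ∑< p (f ∘ suc)  ≈⟨ ∑<-last p f ⟩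
    ∑< p f + f p          ≈⟨ +-congˡ fp≈f0 ⟩
    ∑< p f + f 0          ≈⟨ +-comm _ _ ⟩
    f 0 + ∑< p f          ∎)

  ∑<-shift : ∀ p k f → Periodic p f → ∑< p (λ i → f (k ℕ.+ i)) ≈ ∑< p f
  ∑<-shift p zero    f per = refl
  ∑<-shift p (suc k) f per = trans (∑<-shift p k (f ∘ suc) (per ∘ suc)) (∑<-rotate p f (per 0))

  periodic-* : ∀ p {f} → Periodic p f → ∀ k n → f (n ℕ.+ k ℕ.* p) ≈ f n
  periodic-* p {f} per zero    n = reflexive (cong f (ℕ.+-identityʳ n))
  periodic-* p {f} per (suc k) n = begin
    f (n ℕ.+ (p ℕ.+ k ℕ.* p))  ≡⟨ cong f (ℕ.+-assoc n p _) ⟨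
    f (n ℕ.+ p ℕ.+ k ℕ.* p)    ≈⟨ periodic-* p per k (n ℕ.+ p) ⟩
    f (n ℕ.+ p)                ≈⟨ per n ⟩
    f n                        ∎

  periodic-mod : ∀ p .{{_ : NonZero p}} {f} → Periodic p f → ∀ n → f n ≈ f (toℕ (DivMod.remainder (n divMod p)))
  periodic-mod p {f} per n = begin
    f n                                            ≡⟨ cong f (DivMod.property d) ⟩
    f (toℕ (DivMod.remainder d) ℕ.+ DivMod.quotient d ℕ.* p)  ≈⟨ periodic-* p per (DivMod.quotient d) _ ⟩
    f (toℕ (DivMod.remainder d))                   ∎
    where d = n divMod p

module _ {c ℓ c′ ℓ′} (R : CommutativeRing c ℓ) (S : CommutativeRing c′ ℓ′)
  {f : CommutativeRing.Carrier R → CommutativeRing.Carrier S}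
  (f-hom : IsRingHomomorphism (CommutativeRing.rawRing R) (CommutativeRing.rawRing S) f) where

  open IsRingHomomorphism f-hom
  private
    module R = CommutativeRing R
    module S = CommutativeRing S
    module R∑ = PeriodicSums R
    module S∑ = PeriodicSums S

  hom-sum : ∀ {n} (t : Fin n → R.Carrier) → f (R∑.sum t) S.≈ S∑.sum (f ∘ t)
  hom-sum {zero}  t = 0#-homo
  hom-sum {suc n} t = S.trans (+-homo (t zero) (R∑.sum (t ∘ suc))) (S.+-congˡ (hom-sum (t ∘ suc)))

-- Differences of integer sequences and binomial coefficients.

module IntegerSequences where

  Seq : Set
  Seq = ℕ → ℤ

  open PeriodicSums ℤ.+-*-commutativeRing using
    ( sum; sum-cong-≗; sum-0; ∑-distrib-+; ∑-comm; *-distribˡ-sum; *-distribʳ-sum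
    ; ∑<; ∑<-cong; ∑<-last; ∑<-rotate; ∑<-shift; Periodic; periodic-mod)

  ∣-∑< : ∀ {d} n {f} → (∀ i → i ℕ.< n → d ∣ f i) → d ∣ ∑< n f
  ∣-∑< zero    d∣f = divides 0ℤ ≡.refl
  ∣-∑< (suc n) d∣f = ∣m∣n⇒∣m+n (d∣f 0 ℕ.z<s) (∣-∑< n (λ i i<n → d∣f (suc i) (ℕ.s<s i<n)))

  ∑<-const : ∀ n c → ∑< n (λ _ → c) ≡ + n ℤ.* c
  ∑<-const zero    c = ≡.sym (ℤ.*-zeroˡ c)
  ∑<-const (suc n) c = ≡.trans (cong (λ z → c ℤ.+ z) (∑<-const n c)) (≡.sym (ℤ.suc-* (+ n) c))

  sum-sub : ∀ {n} (f g : Fin n → ℤ) → sum (λ i → f i ℤ.- g i) ≡ sum f ℤ.- sum g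
  sum-sub {zero}  f g = ≡.refl
  sum-sub {suc n} f g = ≡.trans (cong (λ z → (f zero ℤ.- g zero) ℤ.+ z) (sum-sub (f ∘ suc) (g ∘ suc)))
    (regroup (f zero) (g zero) (sum (f ∘ suc)) (sum (g ∘ suc)))
    where
    regroup : ∀ a b c d → (a ℤ.- b) ℤ.+ (c ℤ.- d) ≡ (a ℤ.+ c) ℤ.- (b ℤ.+ d)
    regroup = solve-∀

  ∑<-sub : ∀ n f g → ∑< n (λ i → f i ℤ.- g i) ≡ ∑< n f ℤ.- ∑< n g
  ∑<-sub n f g = sum-sub {n} (f ∘ toℕ) (g ∘ toℕ)

  Δ : Seq → Seq
  Δ w n = w (suc n) ℤ.- w n

  Δ^ : ℕ → Seq → Seq
  Δ^ zero    w = w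
  Δ^ (suc k) w = Δ (Δ^ k w)

  Δ-cong : ∀ {v w} → v ≗ w → Δ v ≗ Δ w
  Δ-cong v≗w n = cong₂ ℤ._-_ (v≗w (suc n)) (v≗w n)

  Δ-periodic : ∀ {p w} → Periodic p w → Periodic p (Δ w)
  Δ-periodic per n = cong₂ ℤ._-_ (per (suc n)) (per n)

  ∑<-Δ : ∀ {p w} → Periodic p w → ∑< p (Δ w) ≡ 0ℤ
  ∑<-Δ {p} {w} per = begin
    ∑< p (Δ w)                    ≡⟨ ∑<-sub p (w ∘ suc) w ⟩
    ∑< p (w ∘ suc) ℤ.- ∑< p w     ≡⟨ cong (ℤ._- ∑< p w) (∑<-rotate p w (per 0)) ⟩
    ∑< p w ℤ.- ∑< p w             ≡⟨ ℤ.+-inverseʳ (∑< p w) ⟩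
    0ℤ                            ∎
    where open ≡.≡-Reasoning

  nC0≡1 : ∀ n → n C 0 ≡ 1
  nC0≡1 n = ≡.trans (nCk≡nC[n∸k] {0} {n} ℕ.z≤n) (nCn≡1 n)

  -- Newton's forward difference formula: the shift by `m` is the `m`-th power of `1 + Δ`. The
  -- induction splits one more factor `1 + Δ` off and merges neighbouring coefficients by Pascal's
  -- rule.
  newton : ∀ m w n → w (n ℕ.+ m) ≡ ∑< (suc m) (λ k → + (m C k) ℤ.* Δ^ k w n)
  newton zero    w n = begin
    w (n ℕ.+ 0)                          ≡⟨ cong w (ℕ.+-identityʳ n) ⟩
    w n                                  ≡⟨ unit (w n) ⟩
    1ℤ ℤ.* w n ℤ.+ 0ℤ                    ≡⟨ cong (λ c → + c ℤ.* w n ℤ.+ 0ℤ) (nC0≡1 0) ⟨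
    + (0 C 0) ℤ.* w n ℤ.+ 0ℤ             ∎
    where
    open ≡.≡-Reasoning
    unit : ∀ a → a ≡ 1ℤ ℤ.* a ℤ.+ 0ℤ
    unit = solve-∀
  newton (suc m) w n = begin
    w (n ℕ.+ suc m)                                            ≡⟨ cong w (ℕ.+-suc n m) ⟩
    w (suc n ℕ.+ m)                                            ≡⟨ newton m w (suc n) ⟩
    ∑< (suc m) (λ k → + (m C k) ℤ.* Δ^ k w (suc n))            ≡⟨ ∑<-cong (suc m) split ⟩
    ∑< (suc m) (λ k → a k ℤ.+ b k)                             ≡⟨ ∑-distrib-+ {suc m} (a ∘ toℕ) (b ∘ toℕ) ⟩
    ∑< (suc m) a ℤ.+ ∑< (suc m) b
      ≡⟨ cong (ℤ._+ ∑< (suc m) b) (ℤ.+-identityʳ (∑< (suc m) a)) ⟨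
    ∑< (suc m) a ℤ.+ 0ℤ ℤ.+ ∑< (suc m) b                       ≡⟨ cong (λ z → ∑< (suc m) a ℤ.+ z ℤ.+ ∑< (suc m) b) top ⟨
    ∑< (suc m) a ℤ.+ a (suc m) ℤ.+ ∑< (suc m) b                ≡⟨ cong (ℤ._+ ∑< (suc m) b) (∑<-last (suc m) a) ⟨
    a 0 ℤ.+ ∑< (suc m) (a ∘ suc) ℤ.+ ∑< (suc m) b              ≡⟨ swap (a 0) (∑< (suc m) (a ∘ suc)) (∑< (suc m) b) ⟩
    a 0 ℤ.+ (∑< (suc m) b ℤ.+ ∑< (suc m) (a ∘ suc))
      ≡⟨ cong₂ ℤ._+_ (cong (λ c → + c ℤ.* w n) (≡.trans (nC0≡1 m) (≡.sym (nC0≡1 (suc m)))))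
                                                                    (≡.sym (∑-distrib-+ {suc m} (b ∘ toℕ) (a ∘ suc ∘ toℕ))) ⟩
    t 0 ℤ.+ ∑< (suc m) (λ k → b k ℤ.+ a (suc k))               ≡⟨ cong (ℤ._+_ (t 0)) (∑<-cong (suc m) pascal) ⟩
    ∑< (suc (suc m)) t                                         ∎
    where
    open ≡.≡-Reasoning
    a b t : Seq
    a k = + (m C k) ℤ.* Δ^ k w n
    b k = + (m C k) ℤ.* Δ^ (suc k) w n
    t k = + (suc m C k) ℤ.* Δ^ k w n
    split : ∀ k → + (m C k) ℤ.* Δ^ k w (suc n) ≡ a k ℤ.+ b k
    split k = lemma (+ (m C k)) (Δ^ k w (suc n)) (Δ^ k w n)
      where
      lemma : ∀ c x y → c ℤ.* x ≡ c ℤ.* y ℤ.+ c ℤ.* (x ℤ.- y)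
      lemma = solve-∀
    -- This vanishing term extends the sum of `a` to the index `suc m`, so that its first term can
    -- be split off and the rest paired with `b`.
    top : a (suc m) ≡ 0ℤ
    top = ≡.trans (cong (λ c → + c ℤ.* Δ^ (suc m) w n) (k>n⇒nCk≡0 {m} {suc m} (ℕ.n<1+n m))) (ℤ.*-zeroˡ (Δ^ (suc m) w n))
    swap : ∀ x y z → x ℤ.+ y ℤ.+ z ≡ x ℤ.+ (z ℤ.+ y)
    swap = solve-∀
    pascal : ∀ k → b k ℤ.+ a (suc k) ≡ t (suc k)
    pascal k = ≡.trans (≡.sym (ℤ.*-distribʳ-+ (Δ^ (suc k) w n) (+ (m C k)) (+ (m C suc k))))
      (cong (λ c → + c ℤ.* Δ^ (suc k) w n) (nCk+nC[k+1]≡[n+1]C[k+1] m k))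

  -- The absorption identity, by induction with Pascal's rule. For prime `suc n` its right side
  -- shows a factor that Euclid's lemma can move into the binomial coefficient.
  absorption : ∀ n k → suc k ℕ.* (suc n C suc k) ≡ suc n ℕ.* (n C k)
  absorption zero zero = cong (ℕ._+ 0) (≡.trans (nCn≡1 1) (≡.sym (nCn≡1 0)))
  absorption zero (suc k) = begin
    suc (suc k) ℕ.* (1 C suc (suc k))  ≡⟨ cong (suc (suc k) ℕ.*_) (k>n⇒nCk≡0 {1} {suc (suc k)} (ℕ.s<s ℕ.z<s)) ⟩
    suc (suc k) ℕ.* 0                  ≡⟨ ℕ.*-zeroʳ (suc (suc k)) ⟩
    0                                  ≡⟨ cong (ℕ._+ 0) (k>n⇒nCk≡0 {0} {suc k} ℕ.z<s) ⟨
    1 ℕ.* (0 C suc k)                  ∎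
    where open ≡.≡-Reasoning
  absorption (suc n) zero = begin
    1 ℕ.* (suc (suc n) C 1)                       ≡⟨ cong (1 ℕ.*_) (nCk+nC[k+1]≡[n+1]C[k+1] (suc n) 0) ⟨
    1 ℕ.* (suc n C 0 ℕ.+ suc n C 1)               ≡⟨ ℕ.*-distribˡ-+ 1 (suc n C 0) (suc n C 1) ⟩
    1 ℕ.* (suc n C 0) ℕ.+ 1 ℕ.* (suc n C 1)       ≡⟨ cong₂ ℕ._+_ (ℕ.*-identityˡ (suc n C 0)) (absorption n 0) ⟩
    suc n C 0 ℕ.+ suc n ℕ.* (n C 0)
      ≡⟨ cong (λ c → suc n C 0 ℕ.+ suc n ℕ.* c) (≡.trans (nC0≡1 n) (≡.sym (nC0≡1 (suc n)))) ⟩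
    suc (suc n) ℕ.* (suc n C 0)                   ∎
    where open ≡.≡-Reasoning
  absorption (suc n) (suc k) = begin
    suc (suc k) ℕ.* (suc (suc n) C suc (suc k))
      ≡⟨ cong (suc (suc k) ℕ.*_) (nCk+nC[k+1]≡[n+1]C[k+1] (suc n) (suc k)) ⟨
    suc (suc k) ℕ.* (x ℕ.+ suc n C suc (suc k))                    ≡⟨ ℕ.*-distribˡ-+ (suc (suc k)) x _ ⟩
    (x ℕ.+ suc k ℕ.* x) ℕ.+ suc (suc k) ℕ.* (suc n C suc (suc k))
      ≡⟨ cong₂ (λ y z → (x ℕ.+ y) ℕ.+ z) (absorption n k) (absorption n (suc k)) ⟩
    (x ℕ.+ suc n ℕ.* (n C k)) ℕ.+ suc n ℕ.* (n C suc k)            ≡⟨ ℕ.+-assoc x _ _ ⟩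
    x ℕ.+ (suc n ℕ.* (n C k) ℕ.+ suc n ℕ.* (n C suc k))
      ≡⟨ cong (x ℕ.+_) (ℕ.*-distribˡ-+ (suc n) (n C k) (n C suc k)) ⟨
    x ℕ.+ suc n ℕ.* (n C k ℕ.+ n C suc k)
      ≡⟨ cong (λ y → x ℕ.+ suc n ℕ.* y) (nCk+nC[k+1]≡[n+1]C[k+1] n k) ⟩
    suc (suc n) ℕ.* (suc n C suc k)                                ∎
    where
    open ≡.≡-Reasoning
    x = suc n C suc k

  -- By `absorption`, `p` divides the product of `suc k` and the coefficient, and `suc k` is too
  -- small to be a multiple of `p`.
  prime∣binomial : ∀ {p k} → Prime p → suc k ℕ.< p → p ℕ.∣ p C suc k
  prime∣binomial {suc n} {k} pp k<p with euclidsLemma (suc k) (suc n C suc k) pp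
    (subst (suc n ℕ.∣_) (≡.sym (absorption n k)) (ℕ.m∣m*n (n C k)))
  ... | inj₁ p∣k = contradiction (ℕ.∣⇒≤ p∣k) (ℕ.<⇒≱ k<p)
  ... | inj₂ p∣C = p∣C

  module _ {p : ℕ} (pp : Prime p) where

    private instance _ = prime⇒nonZero pp

    -- (1 + Δ)ᵖ is the shift by p, and the inner binomial coefficients vanish modulo p.
    p∣Δ^p : ∀ {w} → Periodic p w → ∀ n → + p ∣ Δ^ p w n
    p∣Δ^p = go p ≡.refl
      where
      go : ∀ q → q ≡ p → ∀ {w} → Periodic p w → ∀ n → + p ∣ Δ^ q w n
      go zero    eq = contradiction (≡.sym eq) (ℕ.≢-nonZero⁻¹ p)
      go (suc m) ≡.refl {w} per n = subst (+ p ∣_) (≡.sym Δ^p≡) (∣m⇒∣-m (∣-∑< m inner))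
        where
        open ≡.≡-Reasoning
        t : Seq
        t k = + (p C k) ℤ.* Δ^ k w n
        inner : ∀ i → i ℕ.< m → + p ∣ t (suc i)
        inner i i<m = ∣m⇒∣m*n {m = + (p C suc i)} (Δ^ (suc i) w n) (∣ᵤ⇒∣ (prime∣binomial pp (ℕ.s<s i<m)))
        solved : ∀ x s y → x ≡ 1ℤ ℤ.* x ℤ.+ (s ℤ.+ 1ℤ ℤ.* y) → y ≡ ℤ.- s
        solved x s y eq = ≡.trans (i₁ x s y) (≡.trans (cong (λ z → z ℤ.- x ℤ.- s) (≡.sym eq)) (i₂ x s))
          where
          i₁ : ∀ x s y → y ≡ (1ℤ ℤ.* x ℤ.+ (s ℤ.+ 1ℤ ℤ.* y)) ℤ.- x ℤ.- s
          i₁ = solve-∀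
          i₂ : ∀ x s → x ℤ.- x ℤ.- s ≡ ℤ.- s
          i₂ = solve-∀
        -- Both outer coefficients are 1: periodicity cancels the term of index 0 against
        -- `w (n + p)`, and the term of index `p` is the one solved for.
        Δ^p≡ : Δ^ p w n ≡ ℤ.- ∑< m (t ∘ suc)
        Δ^p≡ = solved (w n) _ _ (begin
          w n                                                         ≡⟨ per n ⟨
          w (n ℕ.+ p)                                                 ≡⟨ newton p w n ⟩
          t 0 ℤ.+ ∑< p (t ∘ suc)                                      ≡⟨ cong (λ z → t 0 ℤ.+ z) (∑<-last m (t ∘ suc)) ⟩
          t 0 ℤ.+ (∑< m (t ∘ suc) ℤ.+ t p)
            ≡⟨ cong₂ (λ a b → + a ℤ.* w n ℤ.+ (∑< m (t ∘ suc) ℤ.+ + b ℤ.* Δ^ p w n)) (nC0≡1 p) (nCn≡1 p) ⟩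
          1ℤ ℤ.* w n ℤ.+ (∑< m (t ∘ suc) ℤ.+ 1ℤ ℤ.* Δ^ p w n)         ∎)

  -- Correlations over a period of prime length, and descent by division by the prime.

  module _ {p : ℕ} (pp : Prime p) where

    private instance _ = prime⇒nonZero pp

    -- Cyclic cross-correlation, or the Hankel matrix with entries `u (n + i)` applied to the vector
    -- of the `f i`; annihilators are its kernel.
    correlation : Seq → Seq → Seq
    correlation f u n = ∑< p (λ i → f i ℤ.* u (n ℕ.+ i))

    Annihilates : Seq → Seq → Set
    Annihilates f u = ∀ n → correlation f u n ≡ 0ℤ

    correlation-const : ∀ c {v} → Periodic p v → ∀ n → correlation (λ _ → c) v n ≡ c ℤ.* ∑< p v
    correlation-const c {v} per n = ≡.trans (≡.sym (*-distribˡ-sum {p} c (λ i → v (n ℕ.+ toℕ i)))) (cong (c ℤ.*_) (∑<-shift p n v per))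

    correlation-Δʳ : ∀ f u n → correlation f (Δ u) n ≡ correlation f u (suc n) ℤ.- correlation f u n
    correlation-Δʳ f u n = ≡.trans (∑<-cong p (λ i → distrib (f i) (u (suc n ℕ.+ i)) (u (n ℕ.+ i))))
      (∑<-sub p (λ i → f i ℤ.* u (suc n ℕ.+ i)) (λ i → f i ℤ.* u (n ℕ.+ i)))
      where
      distrib : ∀ a b c → a ℤ.* (b ℤ.- c) ≡ a ℤ.* b ℤ.- a ℤ.* c
      distrib = solve-∀

    annihilates-Δʳ : ∀ {f u} → Annihilates f u → Annihilates f (Δ u)
    annihilates-Δʳ {f} {u} f⋆u n = ≡.trans (correlation-Δʳ f u n) (cong₂ ℤ._-_ (f⋆u (suc n)) (f⋆u n))

    -- Shifting both sequences by one only rotates the summands over the period.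
    correlation-sucˡ : ∀ f {u} → Periodic p f → Periodic p u → ∀ n →
                       correlation (f ∘ suc) u (suc n) ≡ correlation f u n
    correlation-sucˡ f {u} perf peru n = ≡.trans
      (∑<-cong p (λ i → cong (λ k → f (suc i) ℤ.* u k) (≡.sym (ℕ.+-suc n i))))
      (∑<-rotate p (λ i → f i ℤ.* u (n ℕ.+ i)) (cong₂ ℤ._*_ (perf 0) (≡.trans (peru n) (cong u (≡.sym (ℕ.+-identityʳ n))))))

    correlation-subˡ : ∀ f g u n → correlation (λ i → f i ℤ.- g i) u n ≡ correlation f u n ℤ.- correlation g u n
    correlation-subˡ f g u n = ≡.trans (∑<-cong p (λ i → distrib (f i) (g i) (u (n ℕ.+ i))))
      (∑<-sub p (λ i → f i ℤ.* u (n ℕ.+ i)) (λ i → g i ℤ.* u (n ℕ.+ i)))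
      where
      distrib : ∀ a b c → (a ℤ.- b) ℤ.* c ≡ a ℤ.* c ℤ.- b ℤ.* c
      distrib = solve-∀

    correlation-periodic : ∀ f {u} → Periodic p u → Periodic p (correlation f u)
    correlation-periodic f {u} per n = ∑<-cong p λ i → cong (f i ℤ.*_) (≡.trans (cong u (assoc n i)) (per (n ℕ.+ i)))
      where
      assoc : ∀ n i → (n ℕ.+ p) ℕ.+ i ≡ (n ℕ.+ i) ℕ.+ p
      assoc n i = ≡.trans (ℕ.+-assoc n p i) (≡.trans (cong (n ℕ.+_) (ℕ.+-comm p i)) (≡.sym (ℕ.+-assoc n i p)))

    annihilates-Δˡ : ∀ {f u} → Periodic p f → Periodic p u → Annihilates f u → Annihilates (Δ f) u
    annihilates-Δˡ {f} {u} perf peru f⋆u n = go p ≡.refl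
      where
      after : ∀ n → correlation (Δ f) u (suc n) ≡ 0ℤ
      after n = ≡.trans (correlation-subˡ (f ∘ suc) f u (suc n))
        (cong₂ ℤ._-_ (≡.trans (correlation-sucˡ f perf peru n) (f⋆u n)) (f⋆u (suc n)))
      -- The shift identity reaches successor positions only. Position `n` has the same value as
      -- `n + p`, which is a successor because `p` is one; `q` makes this visible.
      go : ∀ q → q ≡ p → correlation (Δ f) u n ≡ 0ℤ
      go zero    eq = contradiction (≡.sym eq) (ℕ.≢-nonZero⁻¹ p)
      go (suc m) eq = ≡.trans (≡.sym (correlation-periodic (Δ f) peru n))
        (≡.trans (cong (correlation (Δ f) u) (≡.trans (cong (n ℕ.+_) (≡.sym eq)) (ℕ.+-suc n m))) (after (n ℕ.+ m)))

    euclid : ∀ a b → + p ∣ a ℤ.* b → ¬ (+ p ∣ a) → + p ∣ b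
    euclid a b p∣ab p∤a with euclidsLemma ℤ.∣ a ∣ ℤ.∣ b ∣ pp (subst (p ℕ.∣_) (ℤ.abs-* a b) (∣⇒∣ᵤ p∣ab))
    ... | inj₁ p∣a = contradiction (∣ᵤ⇒∣ p∣a) p∤a
    ... | inj₂ p∣b = ∣ᵤ⇒∣ p∣b

    cancel-p : ∀ {a} → a ℤ.* + p ≡ 0ℤ → a ≡ 0ℤ
    cancel-p {a} eq with ℤ.i*j≡0⇒i≡0∨j≡0 a eq
    ... | inj₁ a≡0 = a≡0
    ... | inj₂ p≡0 = contradiction (ℤ.+-injective p≡0) (ℕ.≢-nonZero⁻¹ p)

    -- Since `p > 1`, passing from `h n` to a nonzero quotient `h′ n` lowers the absolute value, so
    -- a bound on it serves for the induction.
    infinite-descent : ∀ {a} (P : Seq → Set a) → (∀ h → P h → ∃[ h′ ] P h′ × (∀ n → h n ≡ h′ n ℤ.* + p)) →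
                       ∀ h → P h → ∀ n → h n ≡ 0ℤ
    infinite-descent P step h ph n = go ℤ.∣ h n ∣ h ph ℕ.≤-refl
      where
      open ℕ.≤-Reasoning
      smaller : ∀ {a b} k → a ≡ b ℤ.* + p → ¬ (b ≡ 0ℤ) → ℤ.∣ a ∣ ℕ.≤ suc k → ℤ.∣ b ∣ ℕ.≤ k
      smaller {a} {b} k eq b≢0 a≤ = ℕ.≤-pred (begin-strict
        ℤ.∣ b ∣
          <⟨ ℕ.m<m*n ℤ.∣ b ∣ p {{ℕ.≢-nonZero (b≢0 ∘ ℤ.∣i∣≡0⇒i≡0)}} (ℕ.nonTrivial⇒n>1 p {{prime⇒nonTrivial pp}}) ⟩
        ℤ.∣ b ∣ ℕ.* p    ≡⟨ ℤ.abs-* b (+ p) ⟨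
        ℤ.∣ b ℤ.* + p ∣  ≡⟨ cong ℤ.∣_∣ eq ⟨
        ℤ.∣ a ∣          ≤⟨ a≤ ⟩
        suc k            ∎)
      go : ∀ k h → P h → ℤ.∣ h n ∣ ℕ.≤ k → h n ≡ 0ℤ
      go zero    h ph h≤0 = ℤ.∣i∣≡0⇒i≡0 (ℕ.n≤0⇒n≡0 h≤0)
      go (suc k) h ph h≤k with step h ph
      ... | h′ , ph′ , eq with h′ n ℤ.≟ 0ℤ
      ...   | yes h′≡0 = ≡.trans (eq n) (cong (ℤ._* + p) h′≡0)
      ...   | no  h′≢0 = ≡.trans (eq n) (cong (ℤ._* + p) (go k h′ ph′ (smaller {b = h′ n} k (eq n) h′≢0 h≤k)))

    -- If p ∣ Δᵏ⁺¹ u, then Δᵏ u is constant modulo p, so (∑ f) Δᵏ u ≡ f ⋆ Δᵏ u = 0 and p ∣ Δᵏ u; start from k = p.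
    unit-augmentation : ∀ f u → ¬ (+ p ∣ ∑< p f) → Periodic p u → Annihilates f u → ∀ n → u n ≡ 0ℤ
    unit-augmentation f u p∤εf per f⋆u = infinite-descent P divide u (per , f⋆u)
      where
      open ≡.≡-Reasoning
      P : Seq → Set
      P w = Periodic p w × Annihilates f w

      constant-mod : ∀ {w} → (∀ n → + p ∣ Δ w n) → ∀ n i → + p ∣ w (n ℕ.+ i) ℤ.- w n
      constant-mod {w} p∣Δ n zero    = divides 0ℤ (≡.trans (cong (λ k → w k ℤ.- w n) (ℕ.+-identityʳ n)) (ℤ.+-inverseʳ (w n)))
      constant-mod {w} p∣Δ n (suc i) = subst (+ p ∣_) (≡.trans (telescope (w (suc (n ℕ.+ i))) (w (n ℕ.+ i)) (w n)) (cong (λ k → w k ℤ.- w n) (≡.sym (ℕ.+-suc n i))))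
        (∣m∣n⇒∣m+n (p∣Δ (n ℕ.+ i)) (constant-mod {w} p∣Δ n i))
        where
        telescope : ∀ a b c → (a ℤ.- b) ℤ.+ (b ℤ.- c) ≡ a ℤ.- c
        telescope = solve-∀

      undo-Δ : ∀ {w} → Annihilates f w → (∀ n → + p ∣ Δ w n) → ∀ n → + p ∣ w n
      undo-Δ {w} f⋆w p∣Δ n = euclid (∑< p f) (w n) (subst (+ p ∣_) eq (∣m⇒∣-m (∣-∑< p λ i _ → ∣n⇒∣m*n (f i) (constant-mod {w} p∣Δ n i)))) p∤εf
        where
        neg-sub : ∀ x → ℤ.- (0ℤ ℤ.- x) ≡ x
        neg-sub = solve-∀
        distrib : ∀ a b c → a ℤ.* (b ℤ.- c) ≡ a ℤ.* b ℤ.- a ℤ.* c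
        distrib = solve-∀
        eq : ℤ.- ∑< p (λ i → f i ℤ.* (w (n ℕ.+ i) ℤ.- w n)) ≡ ∑< p f ℤ.* w n
        eq = begin
          ℤ.- ∑< p (λ i → f i ℤ.* (w (n ℕ.+ i) ℤ.- w n))
            ≡⟨ cong ℤ.-_ (∑<-cong p λ i → distrib (f i) (w (n ℕ.+ i)) (w n)) ⟩
          ℤ.- ∑< p (λ i → f i ℤ.* w (n ℕ.+ i) ℤ.- f i ℤ.* w n)
            ≡⟨ cong ℤ.-_ (∑<-sub p (λ i → f i ℤ.* w (n ℕ.+ i)) (λ i → f i ℤ.* w n)) ⟩
          ℤ.- (correlation f w n ℤ.- ∑< p (λ i → f i ℤ.* w n))
            ≡⟨ cong (λ z → ℤ.- (z ℤ.- ∑< p (λ i → f i ℤ.* w n))) (f⋆w n) ⟩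
          ℤ.- (0ℤ ℤ.- ∑< p (λ i → f i ℤ.* w n))                     ≡⟨ neg-sub _ ⟩
          ∑< p (λ i → f i ℤ.* w n)                                  ≡⟨ *-distribʳ-sum {p} (w n) (f ∘ toℕ) ⟨
          ∑< p f ℤ.* w n                                            ∎

      P-Δ^ : ∀ k {w} → P w → P (Δ^ k w)
      P-Δ^ zero    pw = pw
      P-Δ^ (suc k) {w} pw with P-Δ^ k {w} pw
      ... | per , f⋆w = Δ-periodic {w = Δ^ k w} per , annihilates-Δʳ {f} {Δ^ k w} f⋆w

      undo-Δ^ : ∀ k {w} → P w → (∀ n → + p ∣ Δ^ k w n) → ∀ n → + p ∣ w n
      undo-Δ^ zero    pw p∣w = p∣w
      undo-Δ^ (suc k) {w} pw p∣Δ = undo-Δ^ k {w} pw (undo-Δ {Δ^ k w} (proj₂ (P-Δ^ k {w} pw)) p∣Δ)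

      divide : ∀ w → P w → ∃[ w′ ] P w′ × (∀ n → w n ≡ w′ n ℤ.* + p)
      divide w pw@(perw , f⋆w) = w′ , (per′ , f⋆w′) , w≡
        where
        p∣w : ∀ n → + p ∣ w n
        p∣w = undo-Δ^ p {w} pw (p∣Δ^p pp {w} perw)
        w′ : Seq
        w′ n = _∣_.quotient (p∣w n)
        w≡ : ∀ n → w n ≡ w′ n ℤ.* + p
        w≡ n = _∣_.equality (p∣w n)
        per′ : Periodic p w′
        per′ n = ℤ.*-cancelʳ-≡ (w′ (n ℕ.+ p)) (w′ n) (+ p) {{ℤ.≢-nonZero (ℕ.≢-nonZero⁻¹ p ∘ ℤ.+-injective)}}
          (≡.trans (≡.sym (w≡ (n ℕ.+ p))) (≡.trans (perw n) (w≡ n)))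
        f⋆w′ : Annihilates f w′
        f⋆w′ n = cancel-p (begin
          correlation f w′ n ℤ.* + p
            ≡⟨ *-distribʳ-sum {p} (+ p) (λ i → f (toℕ i) ℤ.* w′ (n ℕ.+ toℕ i)) ⟩
          ∑< p (λ i → f i ℤ.* w′ (n ℕ.+ i) ℤ.* + p)
            ≡⟨ ∑<-cong p (λ i → ≡.trans (ℤ.*-assoc (f i) (w′ (n ℕ.+ i)) (+ p)) (cong (f i ℤ.*_) (≡.sym (w≡ (n ℕ.+ i))))) ⟩
          correlation f w n                                   ≡⟨ f⋆w n ⟩
          0ℤ                                                  ∎)

    -- Annihilators of a nonzero sequence whose sum over a period is zero.

    module _ {v : Seq} (per-v : Periodic p v) (∑v≡0 : ∑< p v ≡ 0ℤ) (v≢0 : ¬ (∀ n → v n ≡ 0ℤ)) where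

      open ≡.≡-Reasoning

      -- Annihilators of `v` with augmentation zero. The vanishing sum makes their partial sums
      -- periodic, so that antidifferences can be taken.
      Annihilator₀ : Seq → Set
      Annihilator₀ h = Periodic p h × ∑< p h ≡ 0ℤ × Annihilates h v

      private
        module Antidifference {h} (per : Periodic p h) (∑h≡0 : ∑< p h ≡ 0ℤ) (h⋆v : Annihilates h v) where

          H : Seq
          H n = ∑< n h

          H-suc : ∀ n → H (suc n) ≡ H n ℤ.+ h n
          H-suc n = ∑<-last n h

          H-periodic : Periodic p H
          H-periodic zero    = ∑h≡0
          H-periodic (suc n) = begin
            H (suc n ℕ.+ p)             ≡⟨ H-suc (n ℕ.+ p) ⟩
            H (n ℕ.+ p) ℤ.+ h (n ℕ.+ p) ≡⟨ cong₂ ℤ._+_ (H-periodic n) (per n) ⟩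
            H n ℤ.+ h n                 ≡⟨ H-suc n ⟨
            H (suc n)                   ∎

          -- As `h` is the difference of `H`, one step changes the correlation of `H` by a
          -- correlation of `h`, which vanishes.
          H⋆v-suc : ∀ n → correlation H v n ≡ correlation H v (suc n)
          H⋆v-suc n = begin
            correlation H v n                                        ≡⟨ correlation-sucˡ H H-periodic per-v n ⟨
            correlation (H ∘ suc) v (suc n)
              ≡⟨ ∑<-cong p (λ i → ≡.trans (cong (ℤ._* v (suc n ℕ.+ i)) (H-suc i)) (ℤ.*-distribʳ-+ (v (suc n ℕ.+ i)) (H i) (h i))) ⟩
            ∑< p (λ i → H i ℤ.* v (suc n ℕ.+ i) ℤ.+ h i ℤ.* v (suc n ℕ.+ i))
              ≡⟨ ∑-distrib-+ {p} (λ i → H (toℕ i) ℤ.* v (suc n ℕ.+ toℕ i)) (λ i → h (toℕ i) ℤ.* v (suc n ℕ.+ toℕ i)) ⟩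
            correlation H v (suc n) ℤ.+ correlation h v (suc n)
              ≡⟨ cong (λ z → correlation H v (suc n) ℤ.+ z) (h⋆v (suc n)) ⟩
            correlation H v (suc n) ℤ.+ 0ℤ                           ≡⟨ ℤ.+-identityʳ _ ⟩
            correlation H v (suc n)                                  ∎

          H⋆v-const : ∀ n → correlation H v n ≡ correlation H v 0
          H⋆v-const zero    = ≡.refl
          H⋆v-const (suc n) = ≡.trans (≡.sym (H⋆v-suc n)) (H⋆v-const n)

          -- Multiplied by `p`, the constant value becomes the sum over all positions. With the
          -- order of summation exchanged, this is a combination of copies of `∑< p v`, hence zero.
          H⋆v : Annihilates H v
          H⋆v n = ≡.trans (H⋆v-const n) (cancel-p (begin
            correlation H v 0 ℤ.* + p                          ≡⟨ ℤ.*-comm (correlation H v 0) (+ p) ⟩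
            + p ℤ.* correlation H v 0                          ≡⟨ ∑<-const p (correlation H v 0) ⟨
            ∑< p (λ _ → correlation H v 0)                     ≡⟨ ∑<-cong p (λ n → ≡.sym (H⋆v-const n)) ⟩
            ∑< p (correlation H v)
              ≡⟨ ∑-comm {p} {p} (λ n i → H (toℕ i) ℤ.* v (toℕ n ℕ.+ toℕ i)) ⟩
            ∑< p (λ i → ∑< p (λ n → H i ℤ.* v (n ℕ.+ i)))
              ≡⟨ ∑<-cong p (λ i → ≡.trans (∑<-cong p (λ n → cong (λ k → H i ℤ.* v k) (ℕ.+-comm n i))) (correlation-const (H i) per-v i)) ⟩
            ∑< p (λ i → H i ℤ.* ∑< p v)
              ≡⟨ ∑<-cong p (λ i → ≡.trans (cong (H i ℤ.*_) ∑v≡0) (ℤ.*-zeroʳ (H i))) ⟩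
            ∑< p (λ _ → 0ℤ)                                    ≡⟨ ∑<-const p 0ℤ ⟩
            + p ℤ.* 0ℤ                                         ≡⟨ ℤ.*-zeroʳ (+ p) ⟩
            0ℤ                                                 ∎))

          p∣∑H : + p ∣ ∑< p H
          p∣∑H with + p ∣? ∑< p H
          ... | yes p∣ = p∣
          ... | no  p∤ = contradiction (unit-augmentation H v p∤ per-v H⋆v) v≢0

      -- The mean `q` of the partial sums over a period is an integer by `p∣∑H`. Subtracting it
      -- restores the sum zero, and annihilation survives because constants annihilate `v`.
      antidifference : ∀ {h} → Annihilator₀ h → ∃[ g ] Annihilator₀ g × h ≗ Δ g
      antidifference {h} (per , ∑h≡0 , h⋆v) with Antidifference.p∣∑H per ∑h≡0 h⋆v
      ... | divides q ∑H≡qp = (λ n → H n ℤ.- q) , ((λ n → cong (ℤ._- q) (H-periodic n)) , sum≡0 , g⋆v) , λ n → ≡.trans (difference (H n) (h n) q) (cong (λ x → x ℤ.- q ℤ.- (H n ℤ.- q)) (≡.sym (H-suc n)))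
        where
        open Antidifference per ∑h≡0 h⋆v
        difference : ∀ a b q → b ≡ a ℤ.+ b ℤ.- q ℤ.- (a ℤ.- q)
        difference = solve-∀
        sum≡0 : ∑< p (λ n → H n ℤ.- q) ≡ 0ℤ
        sum≡0 = ≡.trans (∑<-sub p H (λ _ → q)) (≡.trans (cong₂ ℤ._-_ ∑H≡qp (≡.trans (∑<-const p q) (ℤ.*-comm (+ p) q))) (ℤ.+-inverseʳ (q ℤ.* + p)))
        g⋆v : Annihilates (λ n → H n ℤ.- q) v
        g⋆v n = ≡.trans (correlation-subˡ H (λ _ → q) v n)
          (cong₂ ℤ._-_ (H⋆v n) (≡.trans (correlation-const q per-v n) (≡.trans (cong (q ℤ.*_) ∑v≡0) (ℤ.*-zeroʳ q))))

      antidifferences : ∀ k {h} → Annihilator₀ h → ∃[ g ] Annihilator₀ g × h ≗ Δ^ k g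
      antidifferences zero    {h} ah = h , ah , λ _ → ≡.refl
      antidifferences (suc k) {h} ah =
        let g  , ag  , h≗ = antidifference {h} ah
            g′ , ag′ , g≗ = antidifferences k {g} ag
        in g′ , ag′ , λ n → ≡.trans (h≗ n) (Δ-cong {v = g} g≗ n)

      annihilator₀-zero : ∀ h → Annihilator₀ h → ∀ n → h n ≡ 0ℤ
      annihilator₀-zero = infinite-descent Annihilator₀ divide
        where
        divide : ∀ h → Annihilator₀ h → ∃[ h′ ] Annihilator₀ h′ × (∀ n → h n ≡ h′ n ℤ.* + p)
        -- Exactly `p` antidifferences are taken: for this number `p∣Δ^p` makes `h` divisible by
        -- `p`.
        divide h ah@(per , ∑h≡0 , h⋆v) with antidifferences p {h} ah
        ... | g , (perg , _) , h≗ = h′ , (per′ , ∑h′≡0 , h′⋆v) , h≡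
          where
          p∣h : ∀ n → + p ∣ h n
          p∣h n = subst (+ p ∣_) (≡.sym (h≗ n)) (p∣Δ^p pp {g} perg n)
          h′ : Seq
          h′ n = _∣_.quotient (p∣h n)
          h≡ : ∀ n → h n ≡ h′ n ℤ.* + p
          h≡ n = _∣_.equality (p∣h n)
          per′ : Periodic p h′
          per′ n = ℤ.*-cancelʳ-≡ (h′ (n ℕ.+ p)) (h′ n) (+ p) {{ℤ.≢-nonZero (ℕ.≢-nonZero⁻¹ p ∘ ℤ.+-injective)}}
            (≡.trans (≡.sym (h≡ (n ℕ.+ p))) (≡.trans (per n) (h≡ n)))
          ∑h′≡0 : ∑< p h′ ≡ 0ℤ
          ∑h′≡0 = cancel-p (≡.trans (*-distribʳ-sum {p} (+ p) (h′ ∘ toℕ)) (≡.trans (∑<-cong p (≡.sym ∘ h≡)) ∑h≡0))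
          h′⋆v : Annihilates h′ v
          h′⋆v n = cancel-p (begin
            correlation h′ v n ℤ.* + p
              ≡⟨ *-distribʳ-sum {p} (+ p) (λ i → h′ (toℕ i) ℤ.* v (n ℕ.+ toℕ i)) ⟩
            ∑< p (λ i → h′ i ℤ.* v (n ℕ.+ i) ℤ.* + p)
              ≡⟨ ∑<-cong p (λ i → ≡.trans (swap (h′ i) (v (n ℕ.+ i)) (+ p)) (cong (ℤ._* v (n ℕ.+ i)) (≡.sym (h≡ i)))) ⟩
            correlation h v n                                   ≡⟨ h⋆v n ⟩
            0ℤ                                                  ∎)
            where
            swap : ∀ a b c → a ℤ.* b ℤ.* c ≡ a ℤ.* c ℤ.* b
            swap = solve-∀

    -- Differences have sum zero over a period, so `Δ f` is an annihilator of `Δ u` of the kind just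
    -- excluded unless it is zero.
    annihilator-constant : ∀ {f u} → Periodic p f → Periodic p u → ¬ (∀ n → Δ u n ≡ 0ℤ) → Annihilates f u → ∀ n → f n ≡ f 0
    annihilator-constant {f} {u} perf peru Δu≢0 f⋆u = constant
      where
      Δf≡0 : ∀ n → Δ f n ≡ 0ℤ
      Δf≡0 = annihilator₀-zero {v = Δ u} (Δ-periodic {w = u} peru) (∑<-Δ peru) Δu≢0 (Δ f)
        ( Δ-periodic {w = f} perf , ∑<-Δ perf
        , annihilates-Δˡ {f} {Δ u} perf (Δ-periodic {w = u} peru) (annihilates-Δʳ {f} {u} f⋆u))
      constant : ∀ n → f n ≡ f 0
      constant zero    = ≡.refl
      constant (suc n) = ≡.trans (ℤ.i-j≡0⇒i≡j (f (suc n)) (f n) (Δf≡0 n)) (constant n)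

  -- Integer linear algebra and the Hankel matrix of a periodic sequence.

  nonzero-cancelˡ : ∀ {a b} → ¬ (a ≡ 0ℤ) → a ℤ.* b ≡ 0ℤ → b ≡ 0ℤ
  nonzero-cancelˡ {a} a≢0 ab≡0 = [ (λ a≡0 → contradiction a≡0 a≢0) , id ]′ (ℤ.i*j≡0⇒i≡0∨j≡0 a ab≡0)

  -- Elimination with the pivot v₀ⱼ, without division.
  linear-dependence : ∀ n (v : Fin (suc n) → Fin n → ℤ) →
    Σ[ c ∈ (Fin (suc n) → ℤ) ] ¬ (∀ i → c i ≡ 0ℤ) × (∀ j → sum (λ i → c i ℤ.* v i j) ≡ 0ℤ)
  linear-dependence zero    v = (λ _ → 1ℤ) , (λ c≡0 → contradiction (c≡0 zero) λ ()) , λ ()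
  linear-dependence (suc n) v with Fin.any? (λ j → ¬? (v zero j ℤ.≟ 0ℤ))
  -- The first row is zero, so the first unit vector already is a relation.
  ... | no  v₀≡0 = e , (λ e≡0 → contradiction (e≡0 zero) λ ()) , λ j →
        cong₂ ℤ._+_ (≡.trans (ℤ.*-identityˡ (v zero j)) (decidable-stable (v zero j ℤ.≟ 0ℤ) (λ v₀j≢0 → v₀≡0 (j , v₀j≢0))))
          (sum-0 (λ i → ℤ.*-zeroˡ (v (suc i) j)))
    where
    e : Fin (suc (suc n)) → ℤ
    e zero    = 1ℤ
    e (suc _) = 0ℤ
  ... | yes (j₀ , a≢0) with linear-dependence n (λ i k → v zero j₀ ℤ.* v (suc i) (punchIn j₀ k) ℤ.- v (suc i) j₀ ℤ.* v zero (punchIn j₀ k))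
  ...   | c , c≢0 , c⊥ = coeff , (λ coeff≡0 → c≢0 λ i → nonzero-cancelˡ a≢0 (coeff≡0 (suc i))) , λ j → ≡.trans (eliminate j) (W⊥ j)
    where
    open ≡.≡-Reasoning
    a = v zero j₀
    -- The reduced rows are `a` times a row minus a multiple of the first row. Hence the factor `a`
    -- on `c i`, and all the subtracted multiples collected at index `zero`.
    coeff : Fin (suc (suc n)) → ℤ
    coeff zero    = ℤ.- sum (λ i → c i ℤ.* v (suc i) j₀)
    coeff (suc i) = a ℤ.* c i
    W : Fin (suc n) → Fin (suc n) → ℤ
    W i j = a ℤ.* v (suc i) j ℤ.- v (suc i) j₀ ℤ.* v zero j
    -- The pivot column of `W` vanishes identically; every other column belongs to the smaller
    -- matrix under `punchIn`.
    W⊥ : ∀ j → sum (λ i → c i ℤ.* W i j) ≡ 0ℤ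
    W⊥ j with j₀ Fin.≟ j
    ... | yes ≡.refl = sum-0 {f = λ i → c i ℤ.* W i j} (λ i → commutes (c i) a (v (suc i) j₀))
      where
      commutes : ∀ c a x → c ℤ.* (a ℤ.* x ℤ.- x ℤ.* a) ≡ 0ℤ
      commutes = solve-∀
    ... | no  j₀≢j = subst (λ j → sum (λ i → c i ℤ.* W i j) ≡ 0ℤ) (Fin.punchIn-punchOut j₀≢j) (c⊥ (punchOut j₀≢j))
    eliminate : ∀ j → sum (λ i → coeff i ℤ.* v i j) ≡ sum (λ i → c i ℤ.* W i j)
    eliminate j = begin
      ℤ.- sum (λ i → c i ℤ.* v (suc i) j₀) ℤ.* v zero j ℤ.+ sum (λ i → a ℤ.* c i ℤ.* v (suc i) j)
        ≡⟨ rearrange (sum (λ i → c i ℤ.* v (suc i) j₀)) (v zero j) _ ⟩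
      sum (λ i → a ℤ.* c i ℤ.* v (suc i) j) ℤ.- sum (λ i → c i ℤ.* v (suc i) j₀) ℤ.* v zero j
        ≡⟨ cong (λ z → sum (λ i → a ℤ.* c i ℤ.* v (suc i) j) ℤ.- z) (*-distribʳ-sum (v zero j) (λ i → c i ℤ.* v (suc i) j₀)) ⟩
      sum (λ i → a ℤ.* c i ℤ.* v (suc i) j) ℤ.- sum (λ i → c i ℤ.* v (suc i) j₀ ℤ.* v zero j)
        ≡⟨ sum-sub (λ i → a ℤ.* c i ℤ.* v (suc i) j) (λ i → c i ℤ.* v (suc i) j₀ ℤ.* v zero j) ⟨
      sum (λ i → a ℤ.* c i ℤ.* v (suc i) j ℤ.- c i ℤ.* v (suc i) j₀ ℤ.* v zero j)
        ≡⟨ sum-cong-≗ (λ i → factor a (c i) (v (suc i) j) (v (suc i) j₀) (v zero j)) ⟩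
      sum (λ i → c i ℤ.* W i j) ∎
      where
      rearrange : ∀ s b t → ℤ.- s ℤ.* b ℤ.+ t ≡ t ℤ.- s ℤ.* b
      rearrange = solve-∀
      factor : ∀ a c y x b → a ℤ.* c ℤ.* y ℤ.- c ℤ.* x ℤ.* b ≡ c ℤ.* (a ℤ.* y ℤ.- x ℤ.* b)
      factor = solve-∀

  δ : ∀ {n} → Fin n → Fin n → ℤ
  δ zero    zero    = 1ℤ
  δ zero    (suc _) = 0ℤ
  δ (suc _) zero    = 0ℤ
  δ (suc i) (suc j) = δ i j

  module _ {p : ℕ} (pp : Prime p) {u : Seq} (peru : Periodic p u) (Δu≢0 : ¬ (∀ n → Δ u n ≡ 0ℤ)) (∑u≢0 : ¬ (∑< p u ≡ 0ℤ)) where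

    private instance _ = prime⇒nonZero pp

    -- As the matrix is symmetric, a relation between its rows, extended with period `p`,
    -- annihilates `u` and is constant by `annihilator-constant`. The constant times the nonzero sum
    -- of `u` is zero.
    hankel-independent : ∀ (c : Fin p → ℤ) → (∀ (i : Fin p) → sum (λ n → c n ℤ.* u (toℕ n ℕ.+ toℕ i)) ≡ 0ℤ) → ∀ n → c n ≡ 0ℤ
    hankel-independent c c⊥ n = ≡.trans (≡.sym (F-toℕ n)) (F≡0 (toℕ n))
      where
      open ≡.≡-Reasoning
      F : Seq
      F n = c (n mod p)
      F-toℕ : ∀ n → F (toℕ n) ≡ c n
      F-toℕ n = cong c (Fin.toℕ-injective (≡.trans (Fin.toℕ-fromℕ< _) (m<n⇒m%n≡m (Fin.toℕ<n n))))
      perC : Periodic p F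
      perC n = cong c (Fin.toℕ-injective (≡.trans (Fin.toℕ-fromℕ< _) (≡.trans ([m+n]%n≡m%n n p) (≡.sym (Fin.toℕ-fromℕ< _)))))
      F⋆u-toℕ : ∀ (i : Fin p) → correlation pp F u (toℕ i) ≡ 0ℤ
      F⋆u-toℕ i = ≡.trans (sum-cong-≗ {p} (λ n → cong₂ ℤ._*_ (F-toℕ n) (cong u (ℕ.+-comm (toℕ i) (toℕ n))))) (c⊥ i)
      F⋆u : Annihilates pp F u
      F⋆u m = ≡.trans (periodic-mod p {correlation pp F u} (correlation-periodic pp F peru) m) (F⋆u-toℕ _)
      F-const : ∀ n → F n ≡ F 0
      F-const = annihilator-constant pp perC peru Δu≢0 F⋆u
      F0≡0 : F 0 ≡ 0ℤ
      F0≡0 = nonzero-cancelˡ ∑u≢0 (begin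
        ∑< p u ℤ.* F 0                                   ≡⟨ ℤ.*-comm (∑< p u) (F 0) ⟩
        F 0 ℤ.* ∑< p u                                   ≡⟨ correlation-const pp (F 0) peru 0 ⟨
        correlation pp (λ _ → F 0) u 0                   ≡⟨ ∑<-cong p (λ i → cong (ℤ._* u i) (≡.sym (F-const i))) ⟩
        correlation pp F u 0                             ≡⟨ F⋆u 0 ⟩
        0ℤ                                               ∎)
      F≡0 : ∀ n → F n ≡ 0ℤ
      F≡0 n = ≡.trans (F-const n) F0≡0

    -- A unit vector and the `p` rows are `p + 1` vectors of length `p`, hence related. The
    -- coefficient `d` of the unit vector is not zero, since the rows alone are independent. This is
    -- row `k` of the inverse matrix, up to sign and with the denominator `d` cleared.
    hankel-invertible : ∀ (k : Fin p) → ∃[ d ] Σ[ c ∈ (Fin p → ℤ) ] ¬ (d ≡ 0ℤ) ×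
      (∀ (i : Fin p) → d ℤ.* δ k i ℤ.+ sum (λ n → c n ℤ.* u (toℕ n ℕ.+ toℕ i)) ≡ 0ℤ)
    hankel-invertible k with linear-dependence p rows
      where
      rows : Fin (suc p) → Fin p → ℤ
      rows zero    i = δ k i
      rows (suc n) i = u (toℕ n ℕ.+ toℕ i)
    ... | c , c≢0 , c⊥ = c zero , c ∘ suc , (λ c₀≡0 → c≢0 λ where
        zero    → c₀≡0
        (suc n) → hankel-independent (c ∘ suc) (λ i → ≡.trans (drop c₀≡0 (δ k i) (sum (λ n → c (suc n) ℤ.* u (toℕ n ℕ.+ toℕ i)))) (c⊥ i)) n) , c⊥
      where
      drop : ∀ {a} → a ≡ 0ℤ → ∀ b s → s ≡ a ℤ.* b ℤ.+ s
      drop ≡.refl b s = ≡.trans (≡.sym (ℤ.+-identityˡ s)) (cong (ℤ._+ s) (≡.sym (ℤ.*-zeroˡ b)))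

open IntegerSequences

private
  module ℤ∑ = PeriodicSums ℤ.+-*-commutativeRing

-- Integers mapped into a commutative ring, and integer relations in torsion-free rings.

module FromIntegers {c ℓ} (S : CommutativeRing c ℓ) where

  open CommutativeRing S hiding (zero)
  open PeriodicSums S
  open GroupProperties +-group using () renaming (x≈y⇒x∙y⁻¹≈ε to x≈y⇒x-y≈0; x∙y⁻¹≈ε⇒x≈y to x-y≈0⇒x≈y)
  open import Relation.Binary.Reasoning.Setoid setoid

  IsHom : (ℤ → Carrier) → Set _
  IsHom = IsRingHomomorphism ℤ.+-*-rawRing rawRing

  -- Initiality of ℤ. It identifies the integers of a number field, seen through an embedding, with
  -- those of the target ring.
  hom-unique : ∀ {φ ψ} → IsHom φ → IsHom ψ → ∀ z → φ z ≈ ψ z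
  hom-unique {φ} {ψ} φ-hom ψ-hom = go
    where
    module φ = IsRingHomomorphism φ-hom
    module ψ = IsRingHomomorphism ψ-hom
    nat : ∀ n → φ (+ n) ≈ ψ (+ n)
    nat zero    = trans φ.0#-homo (sym ψ.0#-homo)
    nat (suc n) = begin
      φ (1ℤ ℤ.+ + n)     ≈⟨ φ.+-homo 1ℤ (+ n) ⟩
      φ 1ℤ + φ (+ n)     ≈⟨ +-cong (trans φ.1#-homo (sym ψ.1#-homo)) (nat n) ⟩
      ψ 1ℤ + ψ (+ n)     ≈⟨ ψ.+-homo 1ℤ (+ n) ⟨
      ψ (1ℤ ℤ.+ + n)     ∎
    go : ∀ z → φ z ≈ ψ z
    go (+ n)    = nat n
    go -[1+ n ] = trans (φ.-‿homo (+ suc n)) (trans (-‿cong (nat (suc n))) (sym (ψ.-‿homo (+ suc n))))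

  module Embedding {φ : ℤ → Carrier} (φ-hom : IsHom φ) where

    open IsRingHomomorphism φ-hom public

    sum-homo : ∀ {n} (f : Fin n → ℤ) → φ (ℤ∑.sum f) ≈ sum (φ ∘ f)
    sum-homo = hom-sum ℤ.+-*-commutativeRing S φ-hom

    sum-δ : ∀ {n} (b : Fin n → Carrier) k → sum (λ i → b i * φ (δ k i)) ≈ b k
    sum-δ b zero    = trans (+-cong (trans (*-congˡ 1#-homo) (*-identityʳ (b zero)))
      (sum-0 (λ i → trans (*-congˡ 0#-homo) (zeroʳ (b (suc i)))))) (+-identityʳ (b zero))
    sum-δ b (suc k) = trans (+-cong (trans (*-congˡ 0#-homo) (zeroʳ (b zero))) (sum-δ (b ∘ suc) k)) (+-identityˡ (b (suc k)))

    δ-combination : ∀ {n} (b : Fin n → Carrier) k → b k ≈ sum (λ i → φ (δ k i) * b i)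
    δ-combination b k = trans (sym (sum-δ b k)) (sum-cong-≋ λ i → *-comm (b i) (φ (δ k i)))

    module Torsionfree (1≉0 : ¬ (1# ≈ 0#)) (torsionfree : ∀ d {x} → ¬ (d ≡ 0ℤ) → φ d * x ≈ 0# → x ≈ 0#) where

      -- A nonzero `d` would make 1 a torsion element. The indirect argument is legitimate because
      -- equality of integers is decidable.
      φ≈0⇒≡0 : ∀ {d} → φ d ≈ 0# → d ≡ 0ℤ
      φ≈0⇒≡0 {d} φd≈0 = decidable-stable (d ℤ.≟ 0ℤ) λ d≢0 →
        1≉0 (torsionfree d d≢0 (trans (*-identityʳ (φ d)) φd≈0))

      φ-injective : ∀ {a b} → φ a ≈ φ b → a ≡ b
      φ-injective {a} {b} φa≈φb = ℤ.i-j≡0⇒i≡j a b (φ≈0⇒≡0 (begin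
        φ (a ℤ.- b)       ≈⟨ +-homo a (ℤ.- b) ⟩
        φ a + φ (ℤ.- b)   ≈⟨ +-congˡ (-‿homo b) ⟩
        φ a - φ b         ≈⟨ x≈y⇒x-y≈0 φa≈φb ⟩
        0#                ∎))

      torsionfree-cancel : ∀ d {x y} → ¬ (d ≡ 0ℤ) → φ d * x ≈ φ d * y → x ≈ y
      torsionfree-cancel d {x} {y} d≢0 eq = x-y≈0⇒x≈y x y (torsionfree d d≢0 (begin
        φ d * (x - y)          ≈⟨ distribˡ (φ d) x (- y) ⟩
        φ d * x + φ d * (- y)  ≈⟨ +-congˡ (RingProperties.-‿distribʳ-* ring (φ d) y) ⟨
        φ d * x - φ d * y      ≈⟨ x≈y⇒x-y≈0 eq ⟩
        0#                     ∎))

      -- The case of trace zero in abstract form: `B` stands for the embedded conjugates, `b` for a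
      -- lattice basis with integer coordinates `k`.
      dependent-span : ∀ {p} .{{_ : NonZero p}} {B b : Fin p → Fin p → Carrier} (k : Fin p → Fin p → ℤ) →
        (∀ l j → b l j ≈ sum (λ i → φ (k l i) * B i j)) → (∀ j → sum (λ i → B i j) ≈ 0#) →
        (∀ a → (∀ j → sum (λ l → a l * b l j) ≈ 0#) → ∀ l → a l ≈ 0#) → ⊥
      dependent-span {p} {B} {b} k b≈kB ∑B≈0 b-independent with linear-dependence p rows
        where
        rows : Fin (suc p) → Fin p → ℤ
        rows zero    _ = 1ℤ
        rows (suc l) i = k l i
      ... | c , c≢0 , c⊥ = c≢0 λ where
          zero    → c₀≡0 p ≡.refl
          (suc l) → a≡0 l
        where
        a : Fin p → ℤ
        a = c ∘ suc
        -- The second summand is the contribution of the row `(1, …, 1)`: applied to `B` this row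
        -- gives the column sum, which is zero.
        colsum : ∀ j → sum (λ l → φ (a l) * b l j) + φ (c zero) * 0# ≈ 0#
        colsum j = begin
          sum (λ l → φ (a l) * b l j) + φ (c zero) * 0#
            ≈⟨ +-cong (sum-cong-≋ {p} (λ l → trans (*-congˡ (b≈kB l j)) (*-distribˡ-sum {p} (φ (a l)) (λ i → φ (k l i) * B i j)))) (*-congˡ (sym (∑B≈0 j))) ⟩
          sum (λ l → sum (λ i → φ (a l) * (φ (k l i) * B i j))) + φ (c zero) * sum (λ i → B i j)
            ≈⟨ +-cong (∑-comm {p} {p} (λ l i → φ (a l) * (φ (k l i) * B i j))) (*-distribˡ-sum {p} (φ (c zero)) (λ i → B i j)) ⟩
          sum (λ i → sum (λ l → φ (a l) * (φ (k l i) * B i j))) + sum (λ i → φ (c zero) * B i j)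
            ≈⟨ ∑-distrib-+ {p} (λ i → sum (λ l → φ (a l) * (φ (k l i) * B i j))) (λ i → φ (c zero) * B i j) ⟨
          sum (λ i → sum (λ l → φ (a l) * (φ (k l i) * B i j)) + φ (c zero) * B i j)
            ≈⟨ sum-0 {p} (λ i → collect i) ⟩
          0# ∎
          where
          collect : ∀ i → sum (λ l → φ (a l) * (φ (k l i) * B i j)) + φ (c zero) * B i j ≈ 0#
          collect i = begin
            sum (λ l → φ (a l) * (φ (k l i) * B i j)) + φ (c zero) * B i j
              ≈⟨ +-cong (sum-cong-≋ {p} (λ l → trans (sym (*-assoc _ _ _)) (*-congʳ (sym (*-homo (a l) (k l i))))))
                   (*-congʳ (reflexive (cong φ (≡.sym (ℤ.*-identityʳ (c zero)))))) ⟩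
            sum (λ l → φ (a l ℤ.* k l i) * B i j) + φ (c zero ℤ.* 1ℤ) * B i j
              ≈⟨ +-congʳ (trans (*-congʳ (sum-homo (λ l → a l ℤ.* k l i))) (*-distribʳ-sum {p} (B i j) (λ l → φ (a l ℤ.* k l i)))) ⟨
            φ (ℤ∑.sum (λ l → a l ℤ.* k l i)) * B i j + φ (c zero ℤ.* 1ℤ) * B i j
              ≈⟨ trans (+-comm _ _) (sym (distribʳ (B i j) _ _)) ⟩
            (φ (c zero ℤ.* 1ℤ) + φ (ℤ∑.sum (λ l → a l ℤ.* k l i))) * B i j
              ≈⟨ *-congʳ (trans (sym (+-homo (c zero ℤ.* 1ℤ) (ℤ∑.sum (λ l → a l ℤ.* k l i)))) (trans (reflexive (cong φ (c⊥ i))) 0#-homo)) ⟩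
            0# * B i j
              ≈⟨ zeroˡ _ ⟩
            0# ∎
        a≡0 : ∀ l → a l ≡ 0ℤ
        a≡0 l = φ≈0⇒≡0 (b-independent (φ ∘ a) (λ j → trans (sym (+-identityʳ _)) (trans (+-congˡ (sym (zeroʳ (φ (c zero))))) (colsum j))) l)
        -- With the other coefficients zero, any single column of the relation reads
        -- `c zero * 1 ≡ 0`; the first one exists because `p` is a successor.
        c₀≡0 : ∀ q → q ≡ p → c zero ≡ 0ℤ
        c₀≡0 zero    eq     = contradiction (≡.sym eq) (ℕ.≢-nonZero⁻¹ p)
        c₀≡0 (suc _) ≡.refl = ≡.trans (≡.sym (ℤ.+-identityʳ (c zero))) (≡.trans (cong₂ ℤ._+_ (≡.sym (ℤ.*-identityʳ (c zero)))
          (≡.sym (ℤ∑.sum-0 (λ l → cong (ℤ._* k l zero) (a≡0 l))))) (c⊥ zero))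

      -- Independence of the shifts of a periodic sequence with integral autocorrelation.

      module Autocorrelation
        (formally-real : ∀ {n} (x : Fin n → Carrier) → sum (λ i → x i * x i) ≈ 0# → ∀ i → x i ≈ 0#)
        {p : ℕ} (pp : Prime p) {r : ℕ → Carrier} (per : Periodic p r)
        (r₁≉r₀ : ¬ (r 1 ≈ r 0)) (∑r≉0 : ¬ (∑< p r ≈ 0#))
        {u : Seq} {D : ℤ} (D≢0 : ¬ (D ≡ 0ℤ))
        (u-spec : ∀ n → φ (u n) ≈ φ D * ∑< p (λ j → r j * r (j ℕ.+ n))) where

        private instance _ = prime⇒nonZero pp

        Q : ℕ → Carrier
        Q n = ∑< p (λ j → r j * r (j ℕ.+ n))

        per-u : ℤ∑.Periodic p u
        per-u n = φ-injective (begin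
          φ (u (n ℕ.+ p))      ≈⟨ u-spec (n ℕ.+ p) ⟩
          φ D * Q (n ℕ.+ p)
            ≈⟨ *-congˡ (∑<-cong p (λ j → *-congˡ {r j} (trans (reflexive (cong r (≡.sym (ℕ.+-assoc j n p)))) (per (j ℕ.+ n))))) ⟩
          φ D * Q n            ≈⟨ u-spec n ⟨
          φ (u n)              ∎)

        u₁≢u₀ : ¬ (u 1 ≡ u 0)
        u₁≢u₀ u₁≡u₀ = r₁≉r₀ (x-y≈0⇒x≈y (r 1) (r 0) (first p ≡.refl))
          where
          open SemiringSolver commutativeSemiring
          d : ℕ → Carrier
          d j = r (suc j) - r j
          r-suc : ∀ j → r (suc j) ≈ r j + d j
          r-suc j = begin
            r (suc j)                  ≈⟨ +-identityʳ _ ⟨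
            r (suc j) + 0#             ≈⟨ +-congˡ (-‿inverseˡ (r j)) ⟨
            r (suc j) + (- r j + r j)  ≈⟨ +-assoc _ _ _ ⟨
            d j + r j                  ≈⟨ +-comm _ _ ⟩
            r j + d j                  ∎
          Q₁≈Q₀ : Q 1 ≈ Q 0
          Q₁≈Q₀ = torsionfree-cancel D D≢0 (trans (sym (u-spec 1)) (trans (reflexive (cong φ u₁≡u₀)) (u-spec 0)))
          r[j+1] : ∀ j → r (j ℕ.+ 1) ≈ r j + d j
          r[j+1] j = trans (reflexive (cong r (ℕ.+-comm j 1))) (r-suc j)
          r[j+0] : ∀ j → r (j ℕ.+ 0) ≈ r j
          r[j+0] j = reflexive (cong r (ℕ.+-identityʳ j))
          ∑-split : ∀ f g → ∑< p (λ j → f j + g j) ≈ ∑< p f + ∑< p g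
          ∑-split f g = ∑-distrib-+ {p} (f ∘ toℕ) (g ∘ toℕ)
          -- The identity behind `∑ d² = 2 (Q 0 − Q 1)`, arranged without subtraction for the
          -- semiring solver. The indices `+ 0` make the right side a summand of `Q 0` together with
          -- its successor.
          expand : ∀ j → d j * d j + (r j * r (j ℕ.+ 1) + r j * r (j ℕ.+ 1)) ≈ r (suc j) * r (suc j ℕ.+ 0) + r j * r (j ℕ.+ 0)
          expand j = begin
            d j * d j + (r j * r (j ℕ.+ 1) + r j * r (j ℕ.+ 1))
              ≈⟨ +-congˡ (+-cong (*-congˡ (r[j+1] j)) (*-congˡ (r[j+1] j))) ⟩
            d j * d j + (r j * (r j + d j) + r j * (r j + d j))
              ≈⟨ solve 2 (λ y d → d :* d :+ (y :* (y :+ d) :+ y :* (y :+ d)) := (y :+ d) :* (y :+ d) :+ y :* y) refl (r j) (d j) ⟩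
            (r j + d j) * (r j + d j) + r j * r j
              ≈⟨ +-cong (*-cong (r-suc j) (trans (r[j+0] (suc j)) (r-suc j))) (*-congˡ (r[j+0] j)) ⟨
            r (suc j) * r (suc j ℕ.+ 0) + r j * r (j ℕ.+ 0)              ∎
          ∑d² : ∑< p (λ j → d j * d j) + (Q 0 + Q 0) ≈ Q 0 + Q 0
          ∑d² = begin
            ∑< p (λ j → d j * d j) + (Q 0 + Q 0)                     ≈⟨ +-congˡ (+-cong Q₁≈Q₀ Q₁≈Q₀) ⟨
            ∑< p (λ j → d j * d j) + (Q 1 + Q 1)
              ≈⟨ +-congˡ (∑-split (λ j → r j * r (j ℕ.+ 1)) (λ j → r j * r (j ℕ.+ 1))) ⟨
            ∑< p (λ j → d j * d j) + ∑< p (λ j → r j * r (j ℕ.+ 1) + r j * r (j ℕ.+ 1))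
              ≈⟨ ∑-split (λ j → d j * d j) (λ j → r j * r (j ℕ.+ 1) + r j * r (j ℕ.+ 1)) ⟨
            ∑< p (λ j → d j * d j + (r j * r (j ℕ.+ 1) + r j * r (j ℕ.+ 1)))  ≈⟨ ∑<-cong p expand ⟩
            ∑< p (λ j → r (suc j) * r (suc j ℕ.+ 0) + r j * r (j ℕ.+ 0))
              ≈⟨ ∑-split (λ j → r (suc j) * r (suc j ℕ.+ 0)) (λ j → r j * r (j ℕ.+ 0)) ⟩
            ∑< p (λ j → r (suc j) * r (suc j ℕ.+ 0)) + Q 0
              ≈⟨ +-congʳ (∑<-rotate p (λ j → r j * r (j ℕ.+ 0)) (*-cong (per 0) (trans (r[j+0] p) (per 0)))) ⟩
            Q 0 + Q 0                                                ∎
          d≈0 : ∀ (i : Fin p) → d (toℕ i) ≈ 0#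
          d≈0 = formally-real (d ∘ toℕ) (RingProperties.+-cancelʳ ring (Q 0 + Q 0) _ _ (trans ∑d² (sym (+-identityˡ (Q 0 + Q 0)))))
          first : ∀ q → q ≡ p → d 0 ≈ 0#
          first zero    eq     = contradiction (≡.sym eq) (ℕ.≢-nonZero⁻¹ p)
          first (suc m) ≡.refl = d≈0 zero

        Δu≢0 : ¬ (∀ n → Δ u n ≡ 0ℤ)
        Δu≢0 Δu≡0 = u₁≢u₀ (ℤ.i-j≡0⇒i≡j (u 1) (u 0) (Δu≡0 0))

        -- The autocorrelations over a period add up to the square of `∑< p r`. Formal reality with
        -- a single summand excludes that this square is zero.
        ∑u≢0 : ¬ (ℤ∑.∑< p u ≡ 0ℤ)
        ∑u≢0 ∑u≡0 = ∑r≉0 (formally-real {1} (λ _ → T) (trans (+-identityʳ (T * T)) T²≈0) zero)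
          where
          T = ∑< p r
          T²≈0 : T * T ≈ 0#
          T²≈0 = torsionfree D D≢0 (begin
            φ D * (T * T)                                 ≈⟨ *-congˡ (*-distribʳ-sum {p} T (r ∘ toℕ)) ⟩
            φ D * ∑< p (λ j → r j * T)
              ≈⟨ *-congˡ (∑<-cong p λ j → *-congˡ {r j} (∑<-shift p j r per)) ⟨
            φ D * ∑< p (λ j → r j * ∑< p (λ n → r (j ℕ.+ n)))
              ≈⟨ *-congˡ (∑<-cong p λ j → *-distribˡ-sum {p} (r j) (λ n → r (j ℕ.+ toℕ n))) ⟩
            φ D * ∑< p (λ j → ∑< p (λ n → r j * r (j ℕ.+ n)))
              ≈⟨ *-congˡ (∑-comm {p} {p} (λ j n → r (toℕ j) * r (toℕ j ℕ.+ toℕ n))) ⟩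
            φ D * ∑< p Q                                  ≈⟨ *-distribˡ-sum {p} (φ D) (Q ∘ toℕ) ⟩
            ∑< p (λ n → φ D * Q n)                        ≈⟨ ∑<-cong p u-spec ⟨
            ∑< p (λ n → φ (u n))                          ≈⟨ sum-homo {p} (u ∘ toℕ) ⟨
            φ (ℤ∑.∑< p u)                                 ≈⟨ reflexive (cong φ ∑u≡0) ⟩
            φ 0ℤ                                          ≈⟨ 0#-homo ⟩
            0#                                            ∎)

        -- A relation `a` between the shifts of `r` holds for the rows of the Hankel matrix of `u`
        -- too, because `Q` is a combination of shifts of `r`. Although `a` has coefficients in the
        -- ring, the integral inverse from `hankel-invertible` isolates `φ d * a k`.
        rows-independent : ∀ (a : Fin p → Carrier) → (∀ (j : Fin p) → sum (λ i → a i * r (toℕ j ℕ.+ toℕ i)) ≈ 0#) → ∀ k → a k ≈ 0#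
        rows-independent a a⊥ k = torsionfree d d≢0 (begin
          φ d * a k                                               ≈⟨ *-congˡ (sum-δ a k) ⟨
          φ d * sum (λ i → a i * φ (δ k i))                       ≈⟨ *-distribˡ-sum (φ d) (λ i → a i * φ (δ k i)) ⟩
          sum (λ i → φ d * (a i * φ (δ k i)))
            ≈⟨ sum-cong-≋ {p} (λ i → trans (swap (φ d) (a i) (φ (δ k i))) (*-congˡ (sym (*-homo d (δ k i))))) ⟩
          sum (λ i → a i * φ (d ℤ.* δ k i))                       ≈⟨ +-identityʳ _ ⟨
          sum (λ i → a i * φ (d ℤ.* δ k i)) + 0#                  ≈⟨ +-congˡ second≈0 ⟨
          sum (λ i → a i * φ (d ℤ.* δ k i)) + sum (λ i → a i * φ (H i))
            ≈⟨ ∑-distrib-+ (λ i → a i * φ (d ℤ.* δ k i)) (λ i → a i * φ (H i)) ⟨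
          sum (λ i → a i * φ (d ℤ.* δ k i) + a i * φ (H i))
            ≈⟨ sum-0 (λ i → trans (sym (distribˡ (a i) _ _)) (trans (*-congˡ (trans (sym (+-homo (d ℤ.* δ k i) (H i))) (trans (reflexive (cong φ (orth i))) 0#-homo))) (zeroʳ (a i)))) ⟩
          0#                                                      ∎)
          where
          inv = hankel-invertible pp per-u Δu≢0 ∑u≢0 k
          d = proj₁ inv
          cs = proj₁ (proj₂ inv)
          d≢0 = proj₁ (proj₂ (proj₂ inv))
          orth = proj₂ (proj₂ (proj₂ inv))
          H : Fin p → ℤ
          H i = ℤ∑.sum (λ n → cs n ℤ.* u (toℕ n ℕ.+ toℕ i))
          swap : ∀ x y z → x * (y * z) ≈ y * (x * z)
          swap x y z = trans (sym (*-assoc x y z)) (trans (*-congʳ (*-comm x y)) (*-assoc y x z))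
          row : ℕ → Carrier
          row m = sum (λ i → a i * r (m ℕ.+ toℕ i))
          row-periodic : Periodic p row
          row-periodic m = sum-cong-≋ {p} λ i → *-congˡ (trans (reflexive (cong r (shuffle m (toℕ i)))) (per (m ℕ.+ toℕ i)))
            where
            shuffle : ∀ m i → (m ℕ.+ p) ℕ.+ i ≡ (m ℕ.+ i) ℕ.+ p
            shuffle m i = ≡.trans (ℕ.+-assoc m p i) (≡.trans (cong (m ℕ.+_) (ℕ.+-comm p i)) (≡.sym (ℕ.+-assoc m i p)))
          row≈0 : ∀ m → row m ≈ 0#
          row≈0 m = trans (periodic-mod p row-periodic m) (a⊥ _)
          au≈0 : ∀ n → sum (λ i → a i * φ (u (n ℕ.+ toℕ i))) ≈ 0#
          au≈0 n = begin
            sum (λ i → a i * φ (u (n ℕ.+ toℕ i)))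
              ≈⟨ sum-cong-≋ {p} (λ i → trans (*-congˡ (u-spec (n ℕ.+ toℕ i))) (swap (a i) (φ D) _)) ⟩
            sum (λ i → φ D * (a i * Q (n ℕ.+ toℕ i)))
              ≈⟨ *-distribˡ-sum {p} (φ D) (λ i → a i * Q (n ℕ.+ toℕ i)) ⟨
            φ D * sum (λ i → a i * Q (n ℕ.+ toℕ i))
              ≈⟨ *-congˡ (sum-cong-≋ {p} (λ i → *-distribˡ-sum {p} (a i) (λ j → r (toℕ j) * r (toℕ j ℕ.+ (n ℕ.+ toℕ i))))) ⟩
            φ D * sum (λ i → ∑< p (λ j → a i * (r j * r (j ℕ.+ (n ℕ.+ toℕ i)))))
              ≈⟨ *-congˡ (∑-comm {p} {p} (λ i j → a i * (r (toℕ j) * r (toℕ j ℕ.+ (n ℕ.+ toℕ i))))) ⟩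
            φ D * ∑< p (λ j → sum (λ i → a i * (r j * r (j ℕ.+ (n ℕ.+ toℕ i)))))
              ≈⟨ *-congˡ (∑<-cong p λ j → sum-cong-≋ {p} (λ i → trans (swap (a i) (r j) _) (*-congˡ (*-congˡ (reflexive (cong r (≡.sym (ℕ.+-assoc j n (toℕ i))))))))) ⟩
            φ D * ∑< p (λ j → sum (λ i → r j * (a i * r (j ℕ.+ n ℕ.+ toℕ i))))
              ≈⟨ *-congˡ (∑<-cong p λ j → *-distribˡ-sum {p} (r j) (λ i → a i * r (j ℕ.+ n ℕ.+ toℕ i))) ⟨
            φ D * ∑< p (λ j → r j * row (j ℕ.+ n))
              ≈⟨ *-congˡ (sum-0 {p} (λ j → trans (*-congˡ (row≈0 (toℕ j ℕ.+ n))) (zeroʳ _))) ⟩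
            φ D * 0#                                                  ≈⟨ zeroʳ (φ D) ⟩
            0#                                                        ∎
          second≈0 : sum (λ i → a i * φ (H i)) ≈ 0#
          second≈0 = begin
            sum (λ i → a i * φ (H i))
              ≈⟨ sum-cong-≋ {p} (λ i → *-congˡ (trans (sum-homo (λ n → cs n ℤ.* u (toℕ n ℕ.+ toℕ i))) (sum-cong-≋ {p} λ n → *-homo (cs n) (u (toℕ n ℕ.+ toℕ i))))) ⟩
            sum (λ i → a i * sum (λ n → φ (cs n) * φ (u (toℕ n ℕ.+ toℕ i))))
              ≈⟨ sum-cong-≋ {p} (λ i → *-distribˡ-sum {p} (a i) (λ n → φ (cs n) * φ (u (toℕ n ℕ.+ toℕ i)))) ⟩
            sum (λ i → sum (λ n → a i * (φ (cs n) * φ (u (toℕ n ℕ.+ toℕ i)))))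
              ≈⟨ ∑-comm {p} {p} (λ i n → a i * (φ (cs n) * φ (u (toℕ n ℕ.+ toℕ i)))) ⟩
            sum (λ n → sum (λ i → a i * (φ (cs n) * φ (u (toℕ n ℕ.+ toℕ i)))))
              ≈⟨ sum-cong-≋ {p} (λ n → sum-cong-≋ {p} (λ i → swap (a i) (φ (cs n)) _)) ⟩
            sum (λ n → sum (λ i → φ (cs n) * (a i * φ (u (toℕ n ℕ.+ toℕ i)))))
              ≈⟨ sum-cong-≋ {p} (λ n → *-distribˡ-sum {p} (φ (cs n)) (λ i → a i * φ (u (toℕ n ℕ.+ toℕ i)))) ⟨
            sum (λ n → φ (cs n) * sum (λ i → a i * φ (u (toℕ n ℕ.+ toℕ i))))
              ≈⟨ sum-0 {p} (λ n → trans (*-congˡ (au≈0 (toℕ n))) (zeroʳ (φ (cs n)))) ⟩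
            0#                                                                       ∎

-- Rational numbers in a commutative ring: denominators and rational roots.

private
  toℚᵘ-/1 : ∀ z → ℚ.toℚᵘ (z ℚ./ 1) ℚᵘ.≃ mkℚᵘ z 0
  toℚᵘ-/1 z = ℚ.toℚᵘ-fromℚᵘ (mkℚᵘ z 0)

/1-injective : ∀ {a b} → a ℚ./ 1 ≡ b ℚ./ 1 → a ≡ b
/1-injective {a} {b} eq with ℚᵘ.≃-trans (ℚᵘ.≃-sym (toℚᵘ-/1 a)) (ℚᵘ.≃-trans (ℚᵘ.≃-reflexive (cong ℚ.toℚᵘ eq)) (toℚᵘ-/1 b))
... | ℚᵘ.*≡* a*1≡b*1 = ℤ.*-cancelʳ-≡ a b 1ℤ a*1≡b*1

/1-isRingHomomorphism : IsRingHomomorphism ℤ.+-*-rawRing ℚ.+-*-rawRing (ℚ._/ 1)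
/1-isRingHomomorphism = record
  { isSemiringHomomorphism = record
    { isNearSemiringHomomorphism = record
      { +-isMonoidHomomorphism = record
        { isMagmaHomomorphism = record
          { isRelHomomorphism = record { cong = cong (ℚ._/ 1) }
          ; homo = λ a b → ℚ.toℚᵘ-injective (begin
              ℚ.toℚᵘ ((a ℤ.+ b) ℚ./ 1)                      ≈⟨ toℚᵘ-/1 (a ℤ.+ b) ⟩
              mkℚᵘ (a ℤ.+ b) 0                              ≈⟨ ℚᵘ.*≡* (sum-identity a b) ⟩
              mkℚᵘ a 0 ℚᵘ.+ mkℚᵘ b 0                        ≈⟨ ℚᵘ.+-cong (toℚᵘ-/1 a) (toℚᵘ-/1 b) ⟨
              ℚ.toℚᵘ (a ℚ./ 1) ℚᵘ.+ ℚ.toℚᵘ (b ℚ./ 1)        ≈⟨ ℚ.toℚᵘ-homo-+ (a ℚ./ 1) (b ℚ./ 1) ⟨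
              ℚ.toℚᵘ ((a ℚ./ 1) ℚ.+ (b ℚ./ 1))                  ∎)
          }
        ; ε-homo = ≡.refl
        }
      ; *-homo = λ a b → ℚ.toℚᵘ-injective (begin
          ℚ.toℚᵘ ((a ℤ.* b) ℚ./ 1)                          ≈⟨ toℚᵘ-/1 (a ℤ.* b) ⟩
          mkℚᵘ a 0 ℚᵘ.* mkℚᵘ b 0                            ≈⟨ ℚᵘ.*-cong (toℚᵘ-/1 a) (toℚᵘ-/1 b) ⟨
          ℚ.toℚᵘ (a ℚ./ 1) ℚᵘ.* ℚ.toℚᵘ (b ℚ./ 1)            ≈⟨ ℚ.toℚᵘ-homo-* (a ℚ./ 1) (b ℚ./ 1) ⟨
          ℚ.toℚᵘ ((a ℚ./ 1) ℚ.* (b ℚ./ 1))                      ∎)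
      }
    ; 1#-homo = ≡.refl
    }
  ; -‿homo = λ a → ℚ.toℚᵘ-injective (begin
      ℚ.toℚᵘ ((ℤ.- a) ℚ./ 1)       ≈⟨ toℚᵘ-/1 (ℤ.- a) ⟩
      ℚᵘ.- mkℚᵘ a 0                ≈⟨ ℚᵘ.-‿cong (toℚᵘ-/1 a) ⟨
      ℚᵘ.- ℚ.toℚᵘ (a ℚ./ 1)        ≈⟨ ℚ.toℚᵘ-homo‿- (a ℚ./ 1) ⟨
      ℚ.toℚᵘ (ℚ.- (a ℚ./ 1))       ∎)
  }
  where
  open import Relation.Binary.Reasoning.Setoid ℚᵘ.≃-setoid
  sum-identity : ∀ a b → (a ℤ.+ b) ℤ.* 1ℤ ≡ (a ℤ.* 1ℤ ℤ.+ b ℤ.* 1ℤ) ℤ.* 1ℤ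
  sum-identity = solve-∀

denominator-* : ∀ q → (ℚ.↧ q ℚ./ 1) ℚ.* q ≡ ℚ.↥ q ℚ./ 1
denominator-* q@(mkℚ n d _) = ℚ.toℚᵘ-injective (begin
  ℚ.toℚᵘ ((+ suc d ℚ./ 1) ℚ.* q)           ≈⟨ ℚ.toℚᵘ-homo-* (+ suc d ℚ./ 1) q ⟩
  ℚ.toℚᵘ (+ suc d ℚ./ 1) ℚᵘ.* mkℚᵘ n d   ≈⟨ ℚᵘ.*-congʳ (toℚᵘ-/1 (+ suc d)) ⟩
  mkℚᵘ (+ suc d) 0 ℚᵘ.* mkℚᵘ n d
    ≈⟨ ℚᵘ.*≡* (≡.trans (identity (+ suc d) n) (cong (n ℤ.*_) (≡.sym (ℤ.*-identityˡ (+ suc d))))) ⟩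
  mkℚᵘ n 0                               ≈⟨ toℚᵘ-/1 n ⟨
  ℚ.toℚᵘ (n ℚ./ 1)                       ∎)
  where
  open import Relation.Binary.Reasoning.Setoid ℚᵘ.≃-setoid
  identity : ∀ d n → d ℤ.* n ℤ.* 1ℤ ≡ n ℤ.* d
  identity = solve-∀

module RationalAlgebra {c ℓ} (S : CommutativeRing c ℓ)
  {ψ : ℚ → CommutativeRing.Carrier S} (ψ-hom : IsRingHomomorphism ℚ.+-*-rawRing (CommutativeRing.rawRing S) ψ)
  {φ : ℤ → CommutativeRing.Carrier S} (φ-hom : FromIntegers.IsHom S φ)
  (φ≈ψ : ∀ z → CommutativeRing._≈_ S (φ z) (ψ (z ℚ./ 1))) where

  open CommutativeRing S hiding (zero)
  open FromIntegers S
  open PeriodicSums S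
  open import Relation.Binary.Reasoning.Setoid setoid
  private module ψ = IsRingHomomorphism ψ-hom

  open Embedding φ-hom public

  torsionfree : ∀ d {x} → ¬ (d ≡ 0ℤ) → φ d * x ≈ 0# → x ≈ 0#
  torsionfree d {x} d≢0 φd*x≈0 = begin
    x                          ≈⟨ *-identityˡ x ⟨
    1# * x                     ≈⟨ *-congʳ ψ.1#-homo ⟨
    ψ 1ℚ * x                   ≈⟨ *-congʳ (ψ.⟦⟧-cong (ℚ.*-inverseˡ (d ℚ./ 1))) ⟨
    ψ (1/d ℚ.* (d ℚ./ 1)) * x  ≈⟨ *-congʳ (ψ.*-homo 1/d (d ℚ./ 1)) ⟩
    ψ 1/d * ψ (d ℚ./ 1) * x    ≈⟨ *-congʳ (*-congˡ (φ≈ψ d)) ⟨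
    ψ 1/d * φ d * x            ≈⟨ *-assoc _ _ _ ⟩
    ψ 1/d * (φ d * x)          ≈⟨ *-congˡ φd*x≈0 ⟩
    ψ 1/d * 0#                 ≈⟨ zeroʳ _ ⟩
    0#                         ∎
    where
    instance
      d/1≢0 : ℚ.NonZero (d ℚ./ 1)
      d/1≢0 = ℚ.≢-nonZero (d≢0 ∘ /1-injective)
    1/d = ℚ.1/ (d ℚ./ 1)

  denominator-*ψ : ∀ q → φ (ℚ.↧ q) * ψ q ≈ φ (ℚ.↥ q)
  denominator-*ψ q = begin
    φ (ℚ.↧ q) * ψ q               ≈⟨ *-congʳ (φ≈ψ (ℚ.↧ q)) ⟩
    ψ (ℚ.↧ q ℚ./ 1) * ψ q         ≈⟨ ψ.*-homo (ℚ.↧ q ℚ./ 1) q ⟨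
    ψ ((ℚ.↧ q ℚ./ 1) ℚ.* q)       ≈⟨ ψ.⟦⟧-cong (denominator-* q) ⟩
    ψ (ℚ.↥ q ℚ./ 1)               ≈⟨ φ≈ψ (ℚ.↥ q) ⟨
    φ (ℚ.↥ q)                     ∎

  common-denominator : ∀ {n} (q : Fin n → ℚ) →
    ∃[ D ] Σ[ z ∈ (Fin n → ℤ) ] ¬ (D ≡ 0ℤ) × (∀ i → φ D * ψ (q i) ≈ φ (z i))
  common-denominator {zero}  q = 1ℤ , (λ ()) , (λ ()) , λ ()
  common-denominator {suc n} q with common-denominator (q ∘ suc)
  ... | D , z , D≢0 , z-spec = ℚ.↧ (q zero) ℤ.* D , z′ , D′≢0 , z′-spec
    where
    d = ℚ.↧ (q zero)
    D′≢0 : ¬ (d ℤ.* D ≡ 0ℤ)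
    -- The denominator of a rational is positive, so only the factor `D` could vanish.
    D′≢0 dD≡0 with ℤ.i*j≡0⇒i≡0∨j≡0 d dD≡0
    ... | inj₂ D≡0 = D≢0 D≡0
    z′ : Fin (suc n) → ℤ
    z′ zero    = D ℤ.* ℚ.↥ (q zero)
    z′ (suc i) = d ℤ.* z i
    z′-spec : ∀ i → φ (d ℤ.* D) * ψ (q i) ≈ φ (z′ i)
    z′-spec zero = begin
      φ (d ℤ.* D) * ψ (q zero)       ≈⟨ *-congʳ (trans (reflexive (cong φ (ℤ.*-comm d D))) (*-homo D d)) ⟩
      φ D * φ d * ψ (q zero)         ≈⟨ *-assoc _ _ _ ⟩
      φ D * (φ d * ψ (q zero))       ≈⟨ *-congˡ (denominator-*ψ (q zero)) ⟩
      φ D * φ (ℚ.↥ (q zero))         ≈⟨ *-homo D _ ⟨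
      φ (z′ zero)                    ∎
    z′-spec (suc i) = begin
      φ (d ℤ.* D) * ψ (q (suc i))    ≈⟨ *-congʳ (*-homo d D) ⟩
      φ d * φ D * ψ (q (suc i))      ≈⟨ *-assoc _ _ _ ⟩
      φ d * (φ D * ψ (q (suc i)))    ≈⟨ *-congˡ (z-spec i) ⟩
      φ d * φ (z i)                  ≈⟨ *-homo d (z i) ⟨
      φ (z′ (suc i))                 ∎

  open RawSemiringOperations (Semiring.rawSemiring semiring) using (_^_)

  module RationalRoot {d N : ℤ} {x : Carrier} (d*x≈N : φ d * x ≈ φ N) where

    open SemiringSolver commutativeSemiring

    power-numerator : ∀ n → φ (d ℤ.^ n) * x ^ n ≈ φ (N ℤ.^ n)
    power-numerator zero    = *-identityʳ (φ 1ℤ)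
    power-numerator (suc n) = begin
      φ (d ℤ.* d ℤ.^ n) * (x * x ^ n)      ≈⟨ *-congʳ (*-homo d (d ℤ.^ n)) ⟩
      φ d * φ (d ℤ.^ n) * (x * x ^ n)
        ≈⟨ solve 4 (λ d e x y → d :* e :* (x :* y) := d :* x :* (e :* y)) refl (φ d) (φ (d ℤ.^ n)) x (x ^ n) ⟩
      φ d * x * (φ (d ℤ.^ n) * x ^ n)      ≈⟨ *-cong d*x≈N (power-numerator n) ⟩
      φ N * φ (N ℤ.^ n)                    ≈⟨ *-homo N (N ℤ.^ n) ⟨
      φ (N ℤ.* N ℤ.^ n)                    ∎

    -- All powers of `x` here lie below `n`, so clearing denominators with the `n`-th power of `d`
    -- leaves a factor `d` over. The induction follows Horner's scheme.
    lower-terms : ∀ {n} (a : Fin n → ℤ) → ∃[ s ] φ (d ℤ.^ n) * sum (λ i → φ (a i) * x ^ toℕ i) ≈ φ (d ℤ.* s)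
    lower-terms {zero}  a = 0ℤ , trans (zeroʳ _) (sym (trans (reflexive (cong φ (ℤ.*-zeroʳ d))) 0#-homo))
    lower-terms {suc n} a with lower-terms (a ∘ suc)
    ... | s , s-spec = e ℤ.* a zero ℤ.+ N ℤ.* s , (begin
      φ (d ℤ.* e) * (φ (a zero) * 1# + sum (λ i → φ (a (suc i)) * (x * x ^ toℕ i)))
        ≈⟨ *-cong (*-homo d e) (+-congˡ (sum-cong-≋ {n} (λ i → swap (φ (a (suc i))) x (x ^ toℕ i)))) ⟩
      φ d * φ e * (φ (a zero) * 1# + sum (λ i → x * (φ (a (suc i)) * x ^ toℕ i)))
        ≈⟨ *-congˡ (+-cong (*-identityʳ (φ (a zero))) (sym (*-distribˡ-sum x (λ i → φ (a (suc i)) * x ^ toℕ i)))) ⟩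
      φ d * φ e * (φ (a zero) + x * T)
        ≈⟨ solve 5 (λ d e a x t → d :* e :* (a :+ x :* t) := d :* (e :* a) :+ d :* x :* (e :* t)) refl (φ d) (φ e) (φ (a zero)) x T ⟩
      φ d * (φ e * φ (a zero)) + φ d * x * (φ e * T)
        ≈⟨ +-cong (trans (*-congˡ (sym (*-homo e (a zero)))) (sym (*-homo d _))) (trans (*-cong d*x≈N s-spec) (sym (*-homo N _))) ⟩
      φ (d ℤ.* (e ℤ.* a zero)) + φ (N ℤ.* (d ℤ.* s))
        ≈⟨ +-homo (d ℤ.* (e ℤ.* a zero)) (N ℤ.* (d ℤ.* s)) ⟨
      φ (d ℤ.* (e ℤ.* a zero) ℤ.+ N ℤ.* (d ℤ.* s))
        ≡⟨ cong φ (collect d (e ℤ.* a zero) N s) ⟩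
      φ (d ℤ.* (e ℤ.* a zero ℤ.+ N ℤ.* s)) ∎)
      where
      e = d ℤ.^ n
      T = sum (λ i → φ (a (suc i)) * x ^ toℕ i)
      swap : ∀ a x y → a * (x * y) ≈ x * (a * y)
      swap a x y = solve 3 (λ a x y → a :* (x :* y) := x :* (a :* y)) refl a x y
      collect : ∀ d a n s → d ℤ.* a ℤ.+ n ℤ.* (d ℤ.* s) ≡ d ℤ.* (a ℤ.+ n ℤ.* s)
      collect = solve-∀

  coprime-∣-power : ∀ {d N} → Coprimality.Coprime ℤ.∣ N ∣ d → ∀ n → + d ∣ N ℤ.^ n → d ≡ 1
  coprime-∣-power c zero    d∣1 = ℕ.∣1⇒≡1 (∣⇒∣ᵤ d∣1)
  coprime-∣-power {d} {N} c (suc n) d∣N^ = coprime-∣-power {N = N} c n (∣ᵤ⇒∣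
    (Coprimality.coprime-divisor (Coprimality.sym c) (subst (d ℕ.∣_) (ℤ.abs-* N (N ℤ.^ n)) (∣⇒∣ᵤ d∣N^))))

  -- With `x = N / d` in lowest terms, clearing denominators in the monic equation shows that `d`
  -- divides a power of `N`. Coprimality then forces `d = 1`.
  rational-root-integral : ¬ (1# ≈ 0#) → ∀ q {x} → x ≈ ψ q → ∀ n (a : Fin n → ℤ) →
    x ^ n + sum (λ i → φ (a i) * x ^ toℕ i) ≈ 0# → ∃[ z ] x ≈ φ z
  rational-root-integral 1≉0 q@(mkℚ N d-1 c) {x} x≈q n a root = N , (begin
    x              ≈⟨ *-identityˡ x ⟨
    1# * x         ≈⟨ *-congʳ 1#-homo ⟨
    φ 1ℤ * x       ≡⟨ cong (λ k → φ (+ k) * x) d≡1 ⟨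
    φ d * x        ≈⟨ d*x≈N ⟩
    φ N            ∎)
    where
    open Torsionfree 1≉0 torsionfree using (φ≈0⇒≡0)
    d = + suc d-1
    d*x≈N : φ d * x ≈ φ N
    d*x≈N = trans (*-congˡ x≈q) (denominator-*ψ q)
    open RationalRoot {d} {N} d*x≈N
    s = proj₁ (lower-terms a)
    relation : N ℤ.^ n ℤ.+ d ℤ.* s ≡ 0ℤ
    relation = φ≈0⇒≡0 (begin
      φ (N ℤ.^ n ℤ.+ d ℤ.* s)                                                 ≈⟨ +-homo (N ℤ.^ n) (d ℤ.* s) ⟩
      φ (N ℤ.^ n) + φ (d ℤ.* s)
        ≈⟨ +-cong (power-numerator n) (proj₂ (lower-terms a)) ⟨
      φ (d ℤ.^ n) * x ^ n + φ (d ℤ.^ n) * sum (λ i → φ (a i) * x ^ toℕ i)     ≈⟨ distribˡ _ _ _ ⟨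
      φ (d ℤ.^ n) * (x ^ n + sum (λ i → φ (a i) * x ^ toℕ i))                 ≈⟨ *-congˡ root ⟩
      φ (d ℤ.^ n) * 0#                                                        ≈⟨ zeroʳ _ ⟩
      0#                                                                      ∎)
    d≡1 : suc d-1 ≡ 1
    d≡1 = coprime-∣-power {N = N} (Coprimality.recompute c) n (divides (ℤ.- s) (solved (N ℤ.^ n) d s relation))
      where
      solved : ∀ m d s → m ℤ.+ d ℤ.* s ≡ 0ℤ → m ≡ ℤ.- s ℤ.* d
      solved m d s eq = ≡.trans (move m d s) (≡.trans (cong (ℤ._+ ℤ.- s ℤ.* d) eq) (ℤ.+-identityˡ (ℤ.- s ℤ.* d)))
        where
        move : ∀ m d s → m ≡ m ℤ.+ d ℤ.* s ℤ.+ ℤ.- s ℤ.* d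
        move = solve-∀

-- Conjugates in a cyclic number field.

module Conjugates {c ℓ p} (K : NumberField c ℓ p) (θ : Automorphism K) where

  open NumberField K
  private
    module R = CommutativeRing commutativeRing
    module K∑ = PeriodicSums commutativeRing
    module θ = Automorphism θ
    module θ-iso = IsRingIsomorphism θ.isIsomorphism

  ℤ⇒K-isHomomorphism : FromIntegers.IsHom commutativeRing ℤ⇒K
  ℤ⇒K-isHomomorphism = Composition.isRingHomomorphism R.trans /1-isRingHomomorphism ℚ⇒K-isHomomorphism

  open RationalAlgebra commutativeRing ℚ⇒K-isHomomorphism ℤ⇒K-isHomomorphism (λ _ → R.refl)
  open import Relation.Binary.Reasoning.Setoid R.setoid

  conj : ℕ → Carrier → Carrier
  conj = iterate K θ

  conj-+ : ∀ m n x → conj (m ℕ.+ n) x ≡ conj m (conj n x)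
  conj-+ zero    n x = ≡.refl
  conj-+ (suc m) n x = cong θ.map (conj-+ m n x)

  conj-comm : ∀ m n x → conj m (conj n x) ≡ conj n (conj m x)
  conj-comm m n x = ≡.trans (≡.sym (conj-+ m n x)) (≡.trans (cong (λ k → conj k x) (ℕ.+-comm m n)) (conj-+ n m x))

  conj-isRingHomomorphism : ∀ n → IsRingHomomorphism rawRing rawRing (conj n)
  conj-isRingHomomorphism zero    = Identity.isRingHomomorphism rawRing R.refl
  conj-isRingHomomorphism (suc n) = Composition.isRingHomomorphism R.trans (conj-isRingHomomorphism n) θ-iso.isRingHomomorphism

  conj-fixesℚ : ∀ n q → conj n (ℚ⇒K q) ≈ ℚ⇒K q
  conj-fixesℚ zero    q = R.refl
  conj-fixesℚ (suc n) q = R.trans (θ-iso.⟦⟧-cong (conj-fixesℚ n q)) (θ.fixesℚ q)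

  conj-cong : ∀ n {x y} → x ≈ y → conj n x ≈ conj n y
  conj-cong n = IsRingHomomorphism.⟦⟧-cong (conj-isRingHomomorphism n)

  conj-fixed : ∀ {x} → θ.map x ≈ x → ∀ n → conj n x ≈ x
  conj-fixed θx≈x zero    = R.refl
  conj-fixed θx≈x (suc n) = R.trans (θ-iso.⟦⟧-cong (conj-fixed θx≈x n)) θx≈x

  module _ (galois : IsGalois K) (cyclic : IsCyclicOfOrder K p θ) where

    open IsCyclicOfOrder cyclic

    conj-periodic : ∀ x → K∑.Periodic p (λ n → conj n x)
    conj-periodic x n = R.trans (R.reflexive (conj-+ n p x)) (conj-cong n (order x))

    -- The powers of `θ` exhaust the automorphisms, so an element fixed by `θ` lies in the fixed
    -- field of the whole group.
    fixed-rational : ∀ x → θ.map x ≈ x → ∃[ q ] x ≈ ℚ⇒K q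
    fixed-rational x θx≈x = galois x λ φ →
      R.trans (proj₂ (generates φ) x) (conj-fixed θx≈x (proj₁ (generates φ)))

    -- The trace of the product of `α` and its `n`-th conjugate.
    autocorrelation : Carrier → ℕ → Carrier
    autocorrelation α n = K∑.∑< p (λ j → conj j α *K conj (j ℕ.+ n) α)

    autocorrelation-periodic : ∀ α → K∑.Periodic p (autocorrelation α)
    autocorrelation-periodic α n = K∑.∑<-cong p λ j → R.*-congˡ {conj j α}
      (R.trans (R.reflexive (cong (λ k → conj k α) (≡.sym (ℕ.+-assoc j n p)))) (conj-periodic α (j ℕ.+ n)))

    -- `θ` sends each summand to the next, which over a full period is a rotation.
    autocorrelation-fixed : ∀ α n → θ.map (autocorrelation α n) ≈ autocorrelation α n
    autocorrelation-fixed α n = begin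
      θ.map (autocorrelation α n)
        ≈⟨ hom-sum commutativeRing commutativeRing θ-iso.isRingHomomorphism {p} (λ j → conj (toℕ j) α *K conj (toℕ j ℕ.+ n) α) ⟩
      K∑.∑< p (λ j → θ.map (conj j α *K conj (j ℕ.+ n) α))
        ≈⟨ K∑.∑<-cong p (λ j → θ-iso.*-homo (conj j α) (conj (j ℕ.+ n) α)) ⟩
      K∑.∑< p (λ j → conj (suc j) α *K conj (suc j ℕ.+ n) α)
        ≈⟨ K∑.∑<-rotate p (λ j → conj j α *K conj (j ℕ.+ n) α)
             (R.*-cong (conj-periodic α 0) (R.trans (R.reflexive (cong (λ k → conj k α) (ℕ.+-comm p n))) (conj-periodic α n))) ⟩
      autocorrelation α n ∎

    -- Periodicity leaves only `p` rational values, so one denominator `D` serves for all `n`.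
    integral-autocorrelation : .{{_ : NonZero p}} → ∀ α →
      ∃[ D ] Σ[ u ∈ Seq ] ¬ (D ≡ 0ℤ) × (∀ n → ℤ⇒K (u n) ≈ ℤ⇒K D *K autocorrelation α n)
    integral-autocorrelation α =
      let D , z , D≢0 , z-spec = common-denominator {p} (λ i → proj₁ (rational (toℕ i)))
      in D , (λ n → z (DivMod.remainder (n divMod p))) , D≢0 , λ n → let i = DivMod.remainder (n divMod p) in begin
        ℤ⇒K (z i)                                  ≈⟨ z-spec i ⟨
        ℤ⇒K D *K ℚ⇒K (proj₁ (rational (toℕ i)))     ≈⟨ R.*-congˡ (proj₂ (rational (toℕ i))) ⟨
        ℤ⇒K D *K autocorrelation α (toℕ i)          ≈⟨ R.*-congˡ (K∑.periodic-mod p (autocorrelation-periodic α) n) ⟨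
        ℤ⇒K D *K autocorrelation α n                ∎
      where
      rational : ∀ n → ∃[ q ] autocorrelation α n ≈ ℚ⇒K q
      rational n = fixed-rational (autocorrelation α n) (autocorrelation-fixed α n)

    -- If `θ` fixed `α`, then `α` would be rational, and an integral rational element is a rational
    -- integer.
    nonrational-moved : ∀ {α} → α ∈ 𝓞 K → α ∉ IsRationalInteger K → ¬ (θ.map α ≈ α)
    nonrational-moved {α} (n , a , root) α∉ℤ θα≈α with fixed-rational α θα≈α
    ... | q , α≈q = α∉ℤ (rational-root-integral 1≉0 q α≈q n a root)

-- Conjugates of an element under an embedding of the field.

module EmbeddedConjugates {c ℓ p} (K : NumberField c ℓ p) (θ : Automorphism K)
  {c′ ℓ′} (S : CommutativeRing c′ ℓ′)
  {ι : NumberField.Carrier K → CommutativeRing.Carrier S}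
  (ι-hom : IsRingHomomorphism (NumberField.rawRing K) (CommutativeRing.rawRing S) ι)
  {ψ : ℚ → CommutativeRing.Carrier S} (ψ-hom : IsRingHomomorphism ℚ.+-*-rawRing (CommutativeRing.rawRing S) ψ)
  {φ : ℤ → CommutativeRing.Carrier S} (φ-hom : FromIntegers.IsHom S φ)
  (φ≈ψ : ∀ z → CommutativeRing._≈_ S (φ z) (ψ (z ℚ./ 1)))
  (1≉0S : ¬ (CommutativeRing._≈_ S (CommutativeRing.1# S) (CommutativeRing.0# S))) where

  open NumberField K
  private
    module S = CommutativeRing S
    module S∑ = PeriodicSums S
    module ι = IsRingHomomorphism ι-hom
    module R = CommutativeRing commutativeRing
  open Conjugates K θ
  open FromIntegers S using (hom-unique)
  open RationalAlgebra S ψ-hom φ-hom φ≈ψ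
  open Torsionfree 1≉0S torsionfree
  open import Relation.Binary.Reasoning.Setoid S.setoid

  ι-ℤ⇒K : ∀ z → ι (ℤ⇒K z) S.≈ φ z
  ι-ℤ⇒K = hom-unique (Composition.isRingHomomorphism S.trans ℤ⇒K-isHomomorphism ι-hom) φ-hom

  σ : ℕ → Carrier → S.Carrier
  σ j x = ι (conj j x)

  σ-hom : ∀ j → IsRingHomomorphism rawRing S.rawRing (σ j)
  σ-hom j = Composition.isRingHomomorphism S.trans (conj-isRingHomomorphism j) ι-hom

  σ-combination : ∀ {n} (k : Fin n → ℤ) (x : Fin n → Carrier) j (y : Fin n → S.Carrier) → (∀ i → y i S.≈ σ j (x i)) →
    S∑.sum (λ i → φ (k i) S.* y i) S.≈ σ j (∑K (λ i → ℤ⇒K (k i) *K x i))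
  σ-combination k x j y y≈ = S.sym (S.trans (hom-sum commutativeRing S (σ-hom j) (λ i → ℤ⇒K (k i) *K x i))
    (S∑.sum-cong-≋ λ i → S.trans (IsRingHomomorphism.*-homo (σ-hom j) (ℤ⇒K (k i)) (x i))
      (S.*-cong (S.trans (ι.⟦⟧-cong (conj-fixesℚ j (k i ℚ./ 1))) (ι-ℤ⇒K (k i))) (S.sym (y≈ i)))))

  σ-trace : ∀ x j → S∑.sum {p} (λ i → σ j (conj (toℕ i) x)) S.≈ σ j (Trace K θ x)
  σ-trace x j = S.sym (hom-sum commutativeRing S (σ-hom j) {p} (λ i → conj (toℕ i) x))

  module _ (galois : IsGalois K) (cyclic : IsCyclicOfOrder K p θ) where

    σ-periodic : ∀ x → S∑.Periodic p (λ n → σ n x)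
    σ-periodic x n = ι.⟦⟧-cong (conj-periodic galois cyclic x n)

    -- Applying the `k`-th power of `θ` rotates the coordinates of the canonical embedding.
    σ-norm²-invariant : ∀ k x (y z : Fin p → S.Carrier) →
      (∀ j → y j S.≈ σ (toℕ j) (conj k x)) → (∀ j → z j S.≈ σ (toℕ j) x) →
      S∑.sum (λ j → y j S.* y j) S.≈ S∑.sum (λ j → z j S.* z j)
    σ-norm²-invariant k x y z y≈ z≈ = begin
      S∑.sum (λ j → y j S.* y j)
        ≈⟨ S∑.sum-cong-≋ {p} (λ j → S.*-cong (rotated j) (rotated j)) ⟩
      S∑.∑< p (λ j → σ (k ℕ.+ j) x S.* σ (k ℕ.+ j) x)
        ≈⟨ S∑.∑<-shift p k (λ j → σ j x S.* σ j x) (λ n → S.*-cong (σ-periodic x n) (σ-periodic x n)) ⟩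
      S∑.∑< p (λ j → σ j x S.* σ j x)                       ≈⟨ S∑.sum-cong-≋ {p} (λ j → S.*-cong (z≈ j) (z≈ j)) ⟨
      S∑.sum (λ j → z j S.* z j)                            ∎
      where
      rotated : ∀ (j : Fin p) → y j S.≈ σ (k ℕ.+ toℕ j) x
      rotated j = S.trans (y≈ j) (S.reflexive (cong ι (≡.trans (conj-comm (toℕ j) k x) (≡.sym (conj-+ k (toℕ j) x)))))

    module _ (pp : Prime p) (ι-injective : ∀ {x y} → ι x S.≈ ι y → x ≈ y)
      (formally-real : ∀ {n} (x : Fin n → S.Carrier) → S∑.sum (λ i → x i S.* x i) S.≈ S.0# → ∀ i → x i S.≈ S.0#)
      {α : Carrier} (α∈𝓞 : α ∈ 𝓞 K) (α∉ℤ : α ∉ IsRationalInteger K) (Tr≉0 : ¬ (Trace K θ α ≈ 0#)) where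

      private instance _ = prime⇒nonZero pp

      -- `Autocorrelation` applies to the sequence of embedded conjugates of `α`: its first two
      -- terms differ because `θ` moves `α`, and its sum over a period is the embedded trace.
      conjugates-independent : ∀ (B : Fin p → Fin p → S.Carrier) → (∀ i j → B i j S.≈ σ (toℕ j) (conj (toℕ i) α)) →
        ∀ (a : Fin p → S.Carrier) → (∀ j → S∑.sum (λ i → a i S.* B i j) S.≈ S.0#) → ∀ k → a k S.≈ S.0#
      conjugates-independent B B≈ a a⊥ =
        let D , u , D≢0 , u-spec = integral-autocorrelation galois cyclic α
        in Autocorrelation.rows-independent formally-real pp {λ n → σ n α} (σ-periodic α)
          (λ σ₁≈σ₀ → nonrational-moved galois cyclic α∈𝓞 α∉ℤ (ι-injective σ₁≈σ₀))
          (λ ∑≈0 → Tr≉0 (ι-injective (S.trans (S.sym (σ-trace α 0)) (S.trans ∑≈0 (S.sym ι.0#-homo)))))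
          {u} {D} D≢0 (spec u D u-spec) a
          -- Coordinate `j` of the `i`-th conjugate is the term of index `j + i` of that sequence.
          (λ j → S.trans (S∑.sum-cong-≋ {p} (λ i → S.*-congˡ (S.trans (S.reflexive (cong ι (conj-+ (toℕ j) (toℕ i) α))) (S.sym (B≈ i j))))) (a⊥ j))
        where
        spec : ∀ u D → (∀ n → ℤ⇒K (u n) ≈ ℤ⇒K D *K autocorrelation galois cyclic α n) →
          ∀ n → φ (u n) S.≈ φ D S.* S∑.∑< p (λ j → σ j α S.* σ (j ℕ.+ n) α)
        spec u D u-spec n = begin
          φ (u n)                                              ≈⟨ ι-ℤ⇒K (u n) ⟨
          ι (ℤ⇒K (u n))                                        ≈⟨ ι.⟦⟧-cong (u-spec n) ⟩
          ι (ℤ⇒K D *K autocorrelation galois cyclic α n)       ≈⟨ ι.*-homo _ _ ⟩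
          ι (ℤ⇒K D) S.* ι (autocorrelation galois cyclic α n)
            ≈⟨ S.*-cong (ι-ℤ⇒K D) (S.trans (hom-sum commutativeRing S ι-hom {p} (λ j → conj (toℕ j) α *K conj (toℕ j ℕ.+ n) α))
                                                                    (S∑.∑<-cong p (λ j → ι.*-homo (conj j α) (conj (j ℕ.+ n) α)))) ⟩
          φ D S.* S∑.∑< p (λ j → σ j α S.* σ (j ℕ.+ n) α)      ∎

-- Order, squares and square roots of real numbers.

module ℝ∑ = PeriodicSums ℝ-commutativeRing

ℚ⇒ℝ-isRingHomomorphism : IsRingHomomorphism ℚ.+-*-rawRing (CommutativeRing.rawRing ℝ-commutativeRing) ℚ⇒ℝ
ℚ⇒ℝ-isRingHomomorphism = record
  { isSemiringHomomorphism = record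
    { isNearSemiringHomomorphism = record
      { +-isMonoidHomomorphism = record
        { isMagmaHomomorphism = record
          { isRelHomomorphism = record { cong = λ {a} {b} a≡b → pointwise {ℚ⇒ℝ a} {ℚ⇒ℝ b} λ _ → a≡b }
          ; homo = λ a b → pointwise {ℚ⇒ℝ (a ℚ.+ b)} {ℚ⇒ℝ a +ℝ ℚ⇒ℝ b} λ _ → ≡.refl
          }
        ; ε-homo = pointwise {0ℝ} {0ℝ} λ _ → ≡.refl
        }
      ; *-homo = λ a b → pointwise {ℚ⇒ℝ (a ℚ.* b)} {ℚ⇒ℝ a *ℝ ℚ⇒ℝ b} λ _ → ≡.refl
      }
    ; 1#-homo = pointwise {1ℝ} {1ℝ} λ _ → ≡.refl
    }
  ; -‿homo = λ a → pointwise {ℚ⇒ℝ (ℚ.- a)} { -ℝ ℚ⇒ℝ a} λ _ → ≡.refl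
  }

ℤ⇒ℝ-isRingHomomorphism : IsRingHomomorphism ℤ.+-*-rawRing (CommutativeRing.rawRing ℝ-commutativeRing) ℤ⇒ℝ
ℤ⇒ℝ-isRingHomomorphism = Composition.isRingHomomorphism (λ {x} {y} {z} → ≈ℝ-trans {x} {y} {z})
  /1-isRingHomomorphism ℚ⇒ℝ-isRingHomomorphism

0<1 : 0ℚ ℚ.< 1ℚ
0<1 = ℚ.positive⁻¹ 1ℚ

0<½* : ∀ {ε} → 0ℚ ℚ.< ε → 0ℚ ℚ.< ½ ℚ.* ε
0<½* {ε} 0<ε = ℚ.positive⁻¹ (½ ℚ.* ε) {{ℚ.pos*pos⇒pos ½ ε {{ℚ.positive 0<ε}}}}

½+½ : ∀ ε → ½ ℚ.* ε ℚ.+ ½ ℚ.* ε ≡ ε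
½+½ = solve 1 (λ e → con ½ :* e :+ con ½ :* e := e) ≡.refl
  where open +-*-Solver

1≉0ℝ : ¬ (1ℝ ≈ℝ 0ℝ)
1≉0ℝ 1≈0 = ℚ.<-irrefl ≡.refl (proj₂ (1≈0 1ℚ 0<1) _ ℕ.≤-refl)

module _ {P Q R : ℕ → Set} (f : ∀ n → P n → Q n → R n) where

  eventually-∧ : Eventually P → Eventually Q → Eventually R
  eventually-∧ (M , p) (N , q) = M ℕ.⊔ N , λ n h → f n (p n (ℕ.m⊔n≤o⇒m≤o M N h)) (q n (ℕ.m⊔n≤o⇒n≤o M N h))

*-mono-≤ : ∀ {a b} → 0ℚ ℚ.≤ a → a ℚ.≤ b → a ℚ.* a ℚ.≤ b ℚ.* b
*-mono-≤ {a} {b} 0≤a a≤b = ℚ.≤-trans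
  (ℚ.*-monoˡ-≤-nonNeg a {{ℚ.nonNegative 0≤a}} a≤b)
  (ℚ.*-monoʳ-≤-nonNeg b {{ℚ.nonNegative (ℚ.≤-trans 0≤a a≤b)}} a≤b)

square-∣∣ : ∀ a → a ℚ.* a ≡ ℚ.∣ a ∣ ℚ.* ℚ.∣ a ∣
square-∣∣ a with ℚ.∣p∣≡p∨∣p∣≡-p a
... | inj₁ eq = ≡.sym (cong₂ ℚ._*_ eq eq)
... | inj₂ eq = ≡.trans (solve 1 (λ a → a :* a := :- a :* :- a) ≡.refl a) (≡.sym (cong₂ ℚ._*_ eq eq))
  where open +-*-Solver

square-nonNeg : ∀ a → 0ℚ ℚ.≤ a ℚ.* a
square-nonNeg a = subst (0ℚ ℚ.≤_) (≡.sym (square-∣∣ a)) (*-mono-≤ ℚ.≤-refl (ℚ.0≤∣p∣ a))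

sumOfSquares : ∀ {n} → (Fin n → ℝ) → ℝ
sumOfSquares x = ℝ∑.sum (λ i → x i *ℝ x i)

sumOfSquares-nonNeg : ∀ {n} (x : Fin n → ℝ) m → 0ℚ ℚ.≤ seq (sumOfSquares x) m
sumOfSquares-nonNeg {zero}  x m = ℚ.≤-refl
sumOfSquares-nonNeg {suc n} x m = ℚ.+-mono-≤ (square-nonNeg (seq (x zero) m)) (sumOfSquares-nonNeg (x ∘ suc) m)

square≤sumOfSquares : ∀ {n} (x : Fin n → ℝ) i m → seq (x i) m ℚ.* seq (x i) m ℚ.≤ seq (sumOfSquares x) m
square≤sumOfSquares x zero    m = subst (ℚ._≤ seq (sumOfSquares x) m) (ℚ.+-identityʳ (seq (x zero) m ℚ.* seq (x zero) m))
  (ℚ.+-monoʳ-≤ (seq (x zero) m ℚ.* seq (x zero) m) (sumOfSquares-nonNeg (x ∘ suc) m))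
square≤sumOfSquares x (suc i) m = subst (ℚ._≤ seq (sumOfSquares x) m) (ℚ.+-identityˡ (seq (x (suc i)) m ℚ.* seq (x (suc i)) m))
  (ℚ.+-mono-≤ (square-nonNeg (seq (x zero) m)) (square≤sumOfSquares (x ∘ suc) i m))

-- The approximants are sums of rational squares, so each square is bounded by the sum at every
-- index.
ℝ-formallyReal : ∀ {n} (x : Fin n → ℝ) → sumOfSquares x ≈ℝ 0ℝ → ∀ i → x i ≈ℝ 0ℝ
ℝ-formallyReal x ∑≈0 i ε 0<ε = proj₁ small , λ m N≤m →
  subst (λ a → ℚ.∣ a ∣ ℚ.< ε) (≡.sym (ℚ.+-identityʳ (seq (x i) m))) (bound m (proj₂ small m N≤m))
  where
  -- Tolerance `ε * ε` for the sum gives `ε` for each entry.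
  small = ∑≈0 (ε ℚ.* ε) (ℚ.positive⁻¹ (ε ℚ.* ε) {{ℚ.pos*pos⇒pos ε {{ℚ.positive 0<ε}} ε {{ℚ.positive 0<ε}}}})
  open ℚ.≤-Reasoning
  bound : ∀ m → ℚ.∣ seq (sumOfSquares x) m ℚ.- 0ℚ ∣ ℚ.< ε ℚ.* ε → ℚ.∣ seq (x i) m ∣ ℚ.< ε
  bound m <ε² = ℚ.≰⇒> λ ε≤∣x∣ → ℚ.<-irrefl ≡.refl (begin-strict
    ε ℚ.* ε                                  ≤⟨ *-mono-≤ (ℚ.<⇒≤ 0<ε) ε≤∣x∣ ⟩
    ℚ.∣ seq (x i) m ∣ ℚ.* ℚ.∣ seq (x i) m ∣  ≡⟨ square-∣∣ (seq (x i) m) ⟨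
    seq (x i) m ℚ.* seq (x i) m              ≤⟨ square≤sumOfSquares x i m ⟩
    seq (sumOfSquares x) m                   ≡⟨ ℚ.0≤p⇒∣p∣≡p (sumOfSquares-nonNeg x m) ⟨
    ℚ.∣ seq (sumOfSquares x) m ∣             ≡⟨ cong ℚ.∣_∣ (ℚ.+-identityʳ (seq (sumOfSquares x) m)) ⟨
    ℚ.∣ seq (sumOfSquares x) m ℚ.- 0ℚ ∣      <⟨ <ε² ⟩
    ε ℚ.* ε                                  ∎)

a≤∣a∣ : ∀ a → a ℚ.≤ ℚ.∣ a ∣
a≤∣a∣ a with ℚ.≤-total 0ℚ a
... | inj₁ 0≤a = ℚ.≤-reflexive (≡.sym (ℚ.0≤p⇒∣p∣≡p 0≤a))
... | inj₂ a≤0 = ℚ.≤-trans a≤0 (ℚ.0≤∣p∣ a)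

∣a-b∣<ε⇒a<b+ε : ∀ {a b ε} → ℚ.∣ a ℚ.- b ∣ ℚ.< ε → a ℚ.< b ℚ.+ ε
∣a-b∣<ε⇒a<b+ε {a} {b} {ε} ∣a-b∣<ε = subst (ℚ._< b ℚ.+ ε) (solve 2 (λ a b → b :+ (a :- b) := a) ≡.refl a b)
  (ℚ.+-monoʳ-< b (ℚ.≤-<-trans (a≤∣a∣ (a ℚ.- b)) ∣a-b∣<ε))
  where open +-*-Solver

≈⇒≤ : ∀ {x y} → x ≈ℝ y → x ≤ℝ y
≈⇒≤ x≈y ε 0<ε = let N , close = x≈y ε 0<ε in N , λ n N≤n → ∣a-b∣<ε⇒a<b+ε (close n N≤n)

≤ℝ-trans : ∀ {x y z} → x ≤ℝ y → y ≤ℝ z → x ≤ℝ z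
≤ℝ-trans {x} {y} {z} x≤y y≤z ε 0<ε = eventually-∧
  (λ n x<y y<z → subst (seq x n ℚ.<_) (≡.trans (ℚ.+-assoc (seq z n) (½ ℚ.* ε) (½ ℚ.* ε)) (cong (seq z n ℚ.+_) (½+½ ε)))
    (ℚ.<-trans x<y (ℚ.+-monoˡ-< (½ ℚ.* ε) y<z)))
  (x≤y (½ ℚ.* ε) (0<½* 0<ε)) (y≤z (½ ℚ.* ε) (0<½* 0<ε))

bounded-above : ∀ x → ∃[ B ] (0ℚ ℚ.≤ B) × Eventually (λ n → seq x n ℚ.< B)
bounded-above x = let N , close = cauchy x 1ℚ 0<1 in
  ℚ.∣ seq x N ∣ ℚ.+ 1ℚ , ℚ.<⇒≤ (ℚ.+-mono-≤-< (ℚ.0≤∣p∣ (seq x N)) 0<1) , N ,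
  λ n N≤n → ℚ.<-≤-trans (∣a-b∣<ε⇒a<b+ε (close n N N≤n ℕ.≤-refl)) (ℚ.+-monoˡ-≤ 1ℚ (a≤∣a∣ (seq x N)))

-- `√-nonNeg` holds from index 0 on for every positive slack. For a negative term, its own negative
-- taken as slack would give `0 < 0`.
√-seq-nonNeg : ∀ x n → 0ℚ ℚ.≤ seq (√ x) n
√-seq-nonNeg x n = ℚ.≮⇒≥ λ s<0 → ℚ.<-irrefl (≡.sym (ℚ.+-inverseʳ (seq (√ x) n)))
  (proj₂ (√-nonNeg x (ℚ.- seq (√ x) n) (ℚ.neg-antimono-< s<0)) n ℕ.z≤n)

square-mono : ∀ s t → (∀ n → 0ℚ ℚ.≤ seq s n) → s ≤ℝ t → s *ℝ s ≤ℝ t *ℝ t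
square-mono s t 0≤s s≤t ε 0<ε =
  let B , 0≤B , t<B = bounded-above t
      -- `(b + μ)² − b² = μ (2 b + μ)`, which for `0 < μ ≤ 1` and `b < B` lies below `μ (2 B + 1)`.
      -- Hence the tolerance `ε / (2 B + 1)`, capped at 1.
      D = B ℚ.+ B ℚ.+ 1ℚ
      0<D = ℚ.+-mono-≤-< (ℚ.+-mono-≤ 0≤B 0≤B) 0<1
      instance
        pos-D = ℚ.positive 0<D
        nz-D  = ℚ.pos⇒nonZero D
      η = ε ℚ.* ℚ.1/ D
      0<η = ℚ.positive⁻¹ η {{ℚ.pos*pos⇒pos ε {{ℚ.positive 0<ε}} (ℚ.1/ D) {{ℚ.1/pos⇒pos D}}}}
      ηC≡ε = ≡.trans (ℚ.*-assoc ε (ℚ.1/ D) D) (≡.trans (cong (ε ℚ.*_) (ℚ.*-inverseˡ D)) (ℚ.*-identityʳ ε))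
  in eventually-∧ (λ n → bound B η (seq s n) (seq t n) 0<η ηC≡ε (0≤s n)) (s≤t (η ℚ.⊓ 1ℚ) (0<⊓1 0<η)) t<B
  where
  open ℚ.≤-Reasoning
  0<⊓1 : ∀ {η} → 0ℚ ℚ.< η → 0ℚ ℚ.< η ℚ.⊓ 1ℚ
  0<⊓1 {η} 0<η with ℚ.⊓-sel η 1ℚ
  ... | inj₁ eq = subst (0ℚ ℚ.<_) (≡.sym eq) 0<η
  ... | inj₂ eq = subst (0ℚ ℚ.<_) (≡.sym eq) 0<1
  bound : ∀ B η a b → 0ℚ ℚ.< η → η ℚ.* (B ℚ.+ B ℚ.+ 1ℚ) ≡ ε → 0ℚ ℚ.≤ a → a ℚ.< b ℚ.+ (η ℚ.⊓ 1ℚ) → b ℚ.< B →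
    a ℚ.* a ℚ.< b ℚ.* b ℚ.+ ε
  bound B η a b 0<η ηC≡ε 0≤a a<b+μ b<B = begin-strict
    a ℚ.* a                                          ≤⟨ *-mono-≤ 0≤a (ℚ.<⇒≤ a<b+μ) ⟩
    (b ℚ.+ μ) ℚ.* (b ℚ.+ μ)
      ≡⟨ solve 2 (λ b d → (b :+ d) :* (b :+ d) := b :* b :+ d :* (b :+ b :+ d)) ≡.refl b μ ⟩
    b ℚ.* b ℚ.+ μ ℚ.* (b ℚ.+ b ℚ.+ μ)
      <⟨ ℚ.+-monoʳ-< (b ℚ.* b) (ℚ.*-monoʳ-<-pos μ {{ℚ.positive (0<⊓1 0<η)}} (ℚ.+-mono-<-≤ (ℚ.+-mono-< b<B b<B) (ℚ.p⊓q≤q η 1ℚ))) ⟩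
    b ℚ.* b ℚ.+ μ ℚ.* (B ℚ.+ B ℚ.+ 1ℚ)
      ≤⟨ ℚ.+-monoʳ-≤ (b ℚ.* b) (ℚ.*-monoʳ-≤-nonNeg (B ℚ.+ B ℚ.+ 1ℚ) {{ℚ.nonNegative 0≤C}} (ℚ.p⊓q≤p η 1ℚ)) ⟩
    b ℚ.* b ℚ.+ η ℚ.* (B ℚ.+ B ℚ.+ 1ℚ)               ≡⟨ cong (b ℚ.* b ℚ.+_) ηC≡ε ⟩
    b ℚ.* b ℚ.+ ε                                    ∎
    where
    open +-*-Solver
    μ = η ℚ.⊓ 1ℚ
    0≤C : 0ℚ ℚ.≤ B ℚ.+ B ℚ.+ 1ℚ
    0≤C = ℚ.<⇒≤ (ℚ.*-cancelˡ-<-nonNeg η {{ℚ.nonNegative (ℚ.<⇒≤ 0<η)}} (subst (ℚ._< η ℚ.* (B ℚ.+ B ℚ.+ 1ℚ)) (≡.sym (ℚ.*-zeroʳ η)) (subst (0ℚ ℚ.<_) (≡.sym ηC≡ε) 0<ε)))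

-- Norms, minimal vectors and lattices.

norm≤⇒norm²≤ : ∀ {n} (u v : ℝ^ n) → ‖ u ‖ ≤ℝ ‖ v ‖ → ‖ u ‖² ≤ℝ ‖ v ‖²
norm≤⇒norm²≤ u v u≤v = ≤ℝ-trans {‖ u ‖²} {‖ u ‖ *ℝ ‖ u ‖} {‖ v ‖²}
  (≈⇒≤ {‖ u ‖²} {‖ u ‖ *ℝ ‖ u ‖} (≈ℝ-sym {‖ u ‖ *ℝ ‖ u ‖} {‖ u ‖²} (√-square ‖ u ‖² (norm²-nonNeg u))))
  (≤ℝ-trans {‖ u ‖ *ℝ ‖ u ‖} {‖ v ‖ *ℝ ‖ v ‖} {‖ v ‖²}
    (square-mono ‖ u ‖ ‖ v ‖ (√-seq-nonNeg ‖ u ‖²) u≤v)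
    (≈⇒≤ {‖ v ‖ *ℝ ‖ v ‖} {‖ v ‖²} (√-square ‖ v ‖² (norm²-nonNeg v))))
  where
  norm²-nonNeg : ∀ {n} (w : ℝ^ n) → 0ℝ ≤ℝ ‖ w ‖²
  norm²-nonNeg w ε 0<ε = 0 , λ n _ → ℚ.+-mono-≤-< (sumOfSquares-nonNeg w n) 0<ε

∈-ℤSpan : ∀ {r n} (b : Fin r → ℝ^ n) l → b l ∈ ℤSpan b
∈-ℤSpan b l = δ l , λ j → FromIntegers.Embedding.δ-combination ℝ-commutativeRing ℤ⇒ℝ-isRingHomomorphism (λ i → b i j) l

shortest⇒minimal : ∀ {n a b} {L : Pred (ℝ^ n) a} {Λ : Pred (ℝ^ n) b} (u v : ℝ^ n) → L ⊆ Λ → IsShortestIn u Λ →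
  u ∈ L → v ∈ L → ‖ v ‖² ≈ℝ ‖ u ‖² → v ∈ MinimalVectors L
shortest⇒minimal u v L⊆Λ (_ , u≉0 , u≤) u∈L v∈L v≈u = v∈L , ‖ u ‖² ,
  ( (u , u∈L , u≉0 , CommutativeRing.refl ℝ-commutativeRing {‖ u ‖²})
  , λ w w∈L w≉0 → norm≤⇒norm²≤ u w (u≤ w (L⊆Λ {w} w∈L) w≉0)) , v≈u

independent⇒lattice : ∀ {r n} (B : Fin r → ℝ^ n) → LinearlyIndependent B → IsLatticeOfRank r (ℤSpan B)
independent⇒lattice B B-independent = B , B-independent , id , id

-- A lattice basis `b` of the span may differ from `B`; its integer coordinates with respect to `B`
-- are what `dependent-span` refutes.
∑≈0⇒¬lattice : ∀ {p} .{{_ : NonZero p}} (B : Fin p → ℝ^ p) → (∀ j → ℝ∑.sum (λ i → B i j) ≈ℝ 0ℝ) → ¬ IsLatticeOfRank p (ℤSpan B)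
∑≈0⇒¬lattice B ∑B≈0 (b , b-independent , _ , b⊆B) =
  dependent-span {B = B} {b} (λ l → proj₁ (b∈B l)) (λ l → proj₂ (b∈B l)) ∑B≈0 b-independent
  where
  b∈B : ∀ l → b l ∈ ℤSpan B
  b∈B l = b⊆B {b l} (∈-ℤSpan b l)
  open FromIntegers.Embedding.Torsionfree ℝ-commutativeRing ℤ⇒ℝ-isRingHomomorphism 1≉0ℝ
    (RationalAlgebra.torsionfree ℝ-commutativeRing ℚ⇒ℝ-isRingHomomorphism ℤ⇒ℝ-isRingHomomorphism
      (λ z → CommutativeRing.refl ℝ-commutativeRing {ℤ⇒ℝ z}))
    using (dependent-span)

-- Trace and well-roundedness for a submodule stable under `θ`.

-- B is a variable, and not the family of conjugates itself: two unfoldings of that family that are not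
-- syntactically equal are too costly to compare below _*ℝ_, where the moduli of convergence get compared.
module _ {c ℓ m p} (pp : Prime p) (K : NumberField c ℓ p) (R : RealEmbedding K) (θ : Automorphism K)
  (galois : IsGalois K) (cyclic : IsCyclicOfOrder K p θ)
  {M : Pred (NumberField.Carrier K) m} (M-submodule : IsℤSubmodule K M) (M⊆𝓞 : M ⊆ 𝓞 K)
  (θM⊆M : ∀ {x} → x ∈ M → Automorphism.map θ x ∈ M)
  {α : NumberField.Carrier K} (α∈M : α ∈ M) (α∉ℤ : α ∉ IsRationalInteger K)
  (B : Fin p → ℝ^ p) (B≈ : ∀ i → B i ≈ᵥ canonicalEmbedding K R θ (iterate K θ (toℕ i) α)) where

  open NumberField K
  open RealEmbedding R
  open IsℤSubmodule M-submodule
  private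
    module S = CommutativeRing ℝ-commutativeRing
    module ι = IsRingMonomorphism ι-isMonomorphism
  open EmbeddedConjugates K θ ℝ-commutativeRing ι.isRingHomomorphism
    ℚ⇒ℝ-isRingHomomorphism ℤ⇒ℝ-isRingHomomorphism (λ z → S.refl {ℤ⇒ℝ z}) 1≉0ℝ
    using (conjugates-independent; σ-combination; σ-trace; σ-hom; σ-norm²-invariant)

  private instance _ = prime⇒nonZero pp

  iterate∈M : ∀ n → iterate K θ n α ∈ M
  iterate∈M zero    = α∈M
  iterate∈M (suc n) = θM⊆M (iterate∈M n)

  ∑∈M : ∀ {n} (k : Fin n → ℤ) (x : Fin n → Carrier) → (∀ i → x i ∈ M) → ∑K (λ i → ℤ⇒K (k i) *K x i) ∈ M
  ∑∈M {zero}  k x x∈M = 0-closed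
  ∑∈M {suc n} k x x∈M = +-closed (·-closed (k zero) (x∈M zero)) (∑∈M (k ∘ suc) (x ∘ suc) (x∈M ∘ suc))

  span⊆Λ : ℤSpan B ⊆ Image K (canonicalEmbedding K R θ) M
  span⊆Λ {v} (k , v≈) = x , ∑∈M k conjugate (iterate∈M ∘ toℕ) , λ j →
    S.trans {v j} {linearCombination (ℤ⇒ℝ ∘ k) B j} {canonicalEmbedding K R θ x j} (v≈ j)
      (σ-combination k conjugate (toℕ j) (λ i → B i j) (λ i → B≈ i j))
    where
    conjugate : Fin p → Carrier
    conjugate i = iterate K θ (toℕ i) α
    x = ∑K (λ i → ℤ⇒K (k i) *K conjugate i)

  trace≉0⇒independent : ¬ (Trace K θ α ≈ 0#) → LinearlyIndependent B
  trace≉0⇒independent Tr≉0 = conjugates-independent galois cyclic pp ι.injective ℝ-formallyReal (M⊆𝓞 α∈M) α∉ℤ Tr≉0 B B≈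

  σα∈span : canonicalEmbedding K R θ α ∈ ℤSpan B
  σα∈span = proj₁ B₀∈ , λ j → 
    S.trans {canonicalEmbedding K R θ α j} {B i₀ j} {linearCombination (ℤ⇒ℝ ∘ proj₁ B₀∈) B j} (σα≈B₀ j) (proj₂ B₀∈ j)
    where
    i₀ : Fin p
    -- The index 0, where `B` is `α` itself under the canonical embedding.
    i₀ = Fin.fromℕ< (ℕ.>-nonZero⁻¹ p)
    B₀∈ = ∈-ℤSpan B i₀
    σα≈B₀ : canonicalEmbedding K R θ α ≈ᵥ B i₀
    σα≈B₀ j = S.sym {B i₀ j} {canonicalEmbedding K R θ α j}
      (subst (λ n → B i₀ j ≈ℝ canonicalEmbedding K R θ (iterate K θ n α) j) (Fin.toℕ-fromℕ< (ℕ.>-nonZero⁻¹ p)) (B≈ i₀ j))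

  conjugate-minimal : IsShortestIn (canonicalEmbedding K R θ α) (Image K (canonicalEmbedding K R θ) M) →
    ∀ i → B i ∈ MinimalVectors (ℤSpan B)
  conjugate-minimal σα-shortest i =
    shortest⇒minimal (canonicalEmbedding K R θ α) (B i) (λ {v} → span⊆Λ {v}) σα-shortest
    σα∈span (∈-ℤSpan B i)
    (σ-norm²-invariant galois cyclic (toℕ i) α (B i) (canonicalEmbedding K R θ α) (B≈ i)
      (λ j → S.refl {canonicalEmbedding K R θ α j}))

  -- Coordinate `j` of the sum of the conjugates is the embedded `j`-th conjugate of the trace.
  trace≈0⇒∑B≈0 : Trace K θ α ≈ 0# → ∀ j → ℝ∑.sum (λ i → B i j) ≈ℝ 0ℝ
  trace≈0⇒∑B≈0 Tr≈0 j = S.trans {ℝ∑.sum (λ i → B i j)} {ℝ∑.sum conjugates} {0ℝ}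
    (ℝ∑.sum-cong-≋ {p} {λ i → B i j} {conjugates} (λ i → B≈ i j))
    (S.trans {ℝ∑.sum conjugates} {canonicalEmbedding K R θ (Trace K θ α) j} {0ℝ} (σ-trace α (toℕ j))
      (S.trans {canonicalEmbedding K R θ (Trace K θ α) j} {canonicalEmbedding K R θ 0# j} {0ℝ} (⟦⟧-cong Tr≈0) 0#-homo))
    where
    open IsRingHomomorphism (σ-hom (toℕ j))
    conjugates : Fin p → ℝ
    conjugates i = canonicalEmbedding K R θ (iterate K θ (toℕ i) α) j

  SpansWellRoundedSublattice : Set (c Level.⊔ m)
  SpansWellRoundedSublattice =
    ℤSpan B ⊆ Image K (canonicalEmbedding K R θ) M × IsLatticeOfRank p (ℤSpan B) × IsWellRounded (ℤSpan B)

  trace≉0⇒wellRounded : IsShortestIn (canonicalEmbedding K R θ α) (Image K (canonicalEmbedding K R θ) M) →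
    ¬ (Trace K θ α ≈ 0#) → SpansWellRoundedSublattice
  trace≉0⇒wellRounded σα-shortest Tr≉0 =
    (λ {v} → span⊆Λ {v}) , lattice , lattice , B , trace≉0⇒independent Tr≉0 , conjugate-minimal σα-shortest
    where
    lattice : IsLatticeOfRank p (ℤSpan B)
    lattice = independent⇒lattice B (trace≉0⇒independent Tr≉0)

  wellRounded⇒trace≉0 : SpansWellRoundedSublattice → ¬ (Trace K θ α ≈ 0#)
  wellRounded⇒trace≉0 (_ , lattice , _) Tr≈0 = ∑≈0⇒¬lattice B (trace≈0⇒∑B≈0 Tr≈0) lattice

  trace≉0⇔wellRounded : IsShortestIn (canonicalEmbedding K R θ α) (Image K (canonicalEmbedding K R θ) M) →
    (¬ (Trace K θ α ≈ 0#)) ⇔ SpansWellRoundedSublattice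
  trace≉0⇔wellRounded σα-shortest = mk⇔ (trace≉0⇒wellRounded σα-shortest) wellRounded⇒trace≉0

corollary3p3 : ∀ {c ℓ m} (p : ℕ) → Prime p → 2 < p →
  (K : NumberField c ℓ p) (R : RealEmbedding K) (θ : Automorphism K) →
  IsGalois K → IsCyclicOfOrder K p θ →
  let open NumberField K
      σ = canonicalEmbedding K R θ
  in (M : Pred Carrier m) → IsℤSubmodule K M → M ⊆ 𝓞 K →
  (∀ {x} → x ∈ M → Automorphism.map θ x ∈ M) →
  (α : Carrier) → α ∈ M → α ∉ IsRationalInteger K →
  let Λ = Image K σ M
      B : Fin p → ℝ^ p
      B = λ i → σ (iterate K θ (toℕ i) α)
  in IsShortestIn (σ α) Λ →
  (¬ (Trace K θ α ≈ 0#)) ⇔ (ℤSpan B ⊆ Λ × IsLatticeOfRank p (ℤSpan B) × IsWellRounded (ℤSpan B))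
corollary3p3 p pp 2<p K R θ galois cyclic M M-submodule M⊆𝓞 θM⊆M α α∈M α∉ℤ =
  trace≉0⇔wellRounded pp K R θ galois cyclic M-submodule M⊆𝓞 θM⊆M α∈M α∉ℤ
    (λ i → canonicalEmbedding K R θ (iterate K θ (toℕ i) α))
    (λ i j → CommutativeRing.refl ℝ-commutativeRing {canonicalEmbedding K R θ (iterate K θ (toℕ i) α) j})
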